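{- Let $M\in\{\mathrm{ITRM},\mathrm{ITTM},\mathrm{OTM}\}$ and $x\subseteq\omega$. Then $x^{r}_{M}$ is not $M$-recognizable relative to $x$.
   Context: ITRMs are Infinite Time Register Machines, ITTMs Hamkins–Lewis Infinite Time Turing Machines, OTMs Koepke's Ordinal Turing Machines without ordinal parameters. Fix a natural enumeration $(P_{i,M})_{i\in\omega}$ of $M$-programs. $\delta(z,y)=1$ if $z=y$, else $0$; $z\oplus x=\{2n:n\in z\}\cup\{2n+1:n\in x\}$; $P^{w}\downarrow=j$ means $P$ in oracle $w$ halts with output $j$. A real $y$ is $M$-recognizable relative to $x$ if there is an $M$-program $P$ with $P^{z\oplus x}\downarrow=\delta(z,y)$ for all $z\subseteq\omega$. The recognizable jump is $x^{r}_{M}=\{i\in\omega:\exists y\subseteq\omega\,\forall z\subseteq\omega\; P_{i,M}^{z\oplus x}\downarrow=\delta(z,y)\}$. -}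

module Defs where

open import Axiom.ExcludedMiddle using (ExcludedMiddle)
open import Data.Bool.Base as Bool using (Bool; true; false; if_then_else_)
import Data.Bool.Properties as Bool
open import Data.Empty using (⊥-elim)
open import Data.Fin.Base using (Fin; zero; suc)
open import Data.List.Base as List using (List; []; _∷_; drop; find)
open import Data.Maybe.Base using (Maybe; just; nothing)
open import Data.Nat.Base as ℕ using (ℕ; zero; suc; pred; _+_)
open import Data.Nat.Binary.Base as ℕᵇ using (ℕᵇ; zero; 2[1+_]; 1+[2_])
open import Data.Nat.Binary.Properties as ℕᵇ using (fromℕ-toℕ)
open import Data.Nat.DivMod using (_/_; _%_)
import Data.Nat.Properties as ℕ
open import Data.Product.Base using (Σ; ∃; ∃-syntax; _×_; _,_)
import Data.Product.Properties as Product
open import Data.Sum.Base using (_⊎_)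
open import Data.Unit.Base using (⊤)
open import Data.Vec.Base as Vec using (Vec; []; _∷_)
import Data.Vec.Properties as Vec
open import Function.Base using (_∘_; flip)
open import Function.Bundles using (_⇔_)
open import Level using (Level; 0ℓ; Lift; _⊔_) renaming (suc to lsuc)
open import Relation.Binary.Core using (Rel)
open import Relation.Binary.PropositionalEquality using (_≡_; _≗_; refl; trans; cong; cong₂)
open import Relation.Nullary using (¬_; does)

1ℓ : Level
1ℓ = lsuc 0ℓ

------------------------------------------------------------------------
-- Reals

Real : Set
Real = ℕ → Bool

infixr 6 _⊕_

_⊕_ : Real → Real → Real
(z ⊕ x) n = if n % 2 ℕ.≡ᵇ 0 then z (n / 2) else x (n / 2)

------------------------------------------------------------------------
-- Ordinals

-- A well-founded tree denotes its rank: sup f is the least ordinal strictly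
-- above every f i. Distinct trees may denote the same ordinal, so equality of
-- ordinals is _≈ₒ_. Under excluded middle _≤ₒ_ is a linear preorder.

data Ord : Set₁ where
  sup : {I : Set} → (I → Ord) → Ord

infix 4 _≤ₒ_ _<ₒ_ _≈ₒ_

mutual
  _≤ₒ_ : Ord → Ord → Set
  sup f ≤ₒ β = ∀ i → f i <ₒ β

  _<ₒ_ : Ord → Ord → Set
  α <ₒ sup g = ∃[ j ] α ≤ₒ g j

_≈ₒ_ : Ord → Ord → Set
α ≈ₒ β = α ≤ₒ β × β ≤ₒ α

zeroₒ : Ord
zeroₒ = sup ⊥-elim

sucₒ : Ord → Ord
sucₒ α = sup {⊤} λ _ → α

fromℕₒ : ℕ → Ord
fromℕₒ zero    = zeroₒ
fromℕₒ (suc n) = sucₒ (fromℕₒ n)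

IsLimit : Ord → Set₁
IsLimit μ = zeroₒ <ₒ μ × (∀ β → β <ₒ μ → sucₒ β <ₒ μ)

------------------------------------------------------------------------
-- Inferior limits of ordinal sequences

Eventually : ∀ {ℓ} → Ord → (Ord → Set ℓ) → Set (1ℓ ⊔ ℓ)
Eventually μ Q = ∃[ β ] β <ₒ μ × (∀ γ → β ≤ₒ γ → γ <ₒ μ → Q γ)

-- v is the liminf of f γ as γ → μ with γ ranging over S: the least upper
-- bound of { b ∣ b ≼ f γ for all sufficiently large γ < μ in S }.

IsLiminfAlong : ∀ {a ℓ s} {A : Set a} → Rel A ℓ → (S : Ord → Set s) →
                Ord → (Ord → A) → A → Set (1ℓ ⊔ a ⊔ ℓ ⊔ s)
IsLiminfAlong _≼_ S μ f v =
  (∀ b → LowerBound b → b ≼ v) ×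
  (∀ u → (∀ b → LowerBound b → b ≼ u) → v ≼ u)
  where
  LowerBound = λ b → Eventually μ λ γ → S γ → b ≼ f γ

IsLiminf : ∀ {a ℓ} {A : Set a} → Rel A ℓ → Ord → (Ord → A) → A → Set (1ℓ ⊔ a ⊔ ℓ)
IsLiminf _≼_ = IsLiminfAlong _≼_ (λ _ → ⊤)

IsLimsup : ∀ {a ℓ} {A : Set a} → Rel A ℓ → Ord → (Ord → A) → A → Set (1ℓ ⊔ a ⊔ ℓ)
IsLimsup _≼_ = IsLiminf (flip _≼_)

------------------------------------------------------------------------
-- Transfinite computations

record System c : Set (lsuc (1ℓ ⊔ c)) where
  field
    Config  : Set c
    Initial : Config → Set (1ℓ ⊔ c)
    Step    : Config → Config → Set (1ℓ ⊔ c)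
    Limit   : Ord → (Ord → Config) → Config → Set (1ℓ ⊔ c)
    Halted  : Config → Set (1ℓ ⊔ c)
    Output  : Config → ℕ → Set

module _ {c} (M : System c) where
  open System M

  -- Only the values of C at ordinals ≤ α are constrained.
  record IsComputation (α : Ord) (C : Ord → Config) : Set (1ℓ ⊔ c) where
    field
      initial   : ∀ β → β ≤ₒ α → β ≈ₒ zeroₒ → Initial (C β)
      successor : ∀ β γ → γ ≤ₒ α → γ ≈ₒ sucₒ β → Step (C β) (C γ)
      limit     : ∀ μ → μ ≤ₒ α → IsLimit μ → Limit μ C (C μ)

  HaltsWith : ℕ → Set (1ℓ ⊔ c)
  HaltsWith j = Σ Ord λ α → Σ (Ord → Config) λ C →
    IsComputation α C × Halted (C α) × Output (C α) j

------------------------------------------------------------------------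
-- Infinite time register machines

data ITRMInstr : Set where
  Z S O : ℕ → ITRMInstr
  T     : ℕ → ℕ → ITRMInstr
  J     : ℕ → ℕ → ℕ → ITRMInstr

record ITRMConfig : Set where
  constructor ⟨_,_⟩
  field
    line : ℕ
    reg  : ℕ → ℕ

open ITRMConfig

_[_≔_] : (ℕ → ℕ) → ℕ → ℕ → (ℕ → ℕ)
(r [ n ≔ v ]) m = if m ℕ.≡ᵇ n then v else r m

execute : Real → ITRMInstr → ITRMConfig → ITRMConfig
execute w (Z n)     ⟨ l , r ⟩ = ⟨ suc l , r [ n ≔ 0 ] ⟩
execute w (S n)     ⟨ l , r ⟩ = ⟨ suc l , r [ n ≔ suc (r n) ] ⟩
execute w (O n)     ⟨ l , r ⟩ = ⟨ suc l , r [ n ≔ (if w (r n) then 1 else 0) ] ⟩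
execute w (T m n)   ⟨ l , r ⟩ = ⟨ suc l , r [ n ≔ r m ] ⟩
execute w (J m n q) ⟨ l , r ⟩ = ⟨ (if r m ℕ.≡ᵇ r n then q else suc l) , r ⟩

fetch : List ITRMInstr → ℕ → Maybe ITRMInstr
fetch P l = List.head (drop l P)

-- A register whose liminf is infinite is reset to 0.

RegisterLimit : Ord → (Ord → ℕ) → ℕ → Set₁
RegisterLimit μ f v =
  IsLiminf ℕ._≤_ μ f v ⊎
  ((∀ b → Eventually μ λ γ → b ℕ.≤ f γ) × v ≡ 0)

itrm : List ITRMInstr → Real → System 0ℓ
itrm P w = record
  { Config  = ITRMConfig
  ; Initial = λ c → Lift 1ℓ (line c ≡ 0 × (∀ n → reg c n ≡ 0))
  ; Step    = λ c c′ → Lift 1ℓ (∃[ i ] fetch P (line c) ≡ just i ×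
                line c′ ≡ line (execute w i c) × reg c′ ≗ reg (execute w i c))
  ; Limit   = λ μ C c → IsLiminf ℕ._≤_ μ (line ∘ C) (line c) ×
                (∀ n → RegisterLimit μ (λ γ → reg (C γ) n) (reg c n))
  ; Halted  = λ c → Lift 1ℓ (fetch P (line c) ≡ nothing)
  ; Output  = λ c j → reg c 0 ≡ j
  }

------------------------------------------------------------------------
-- Turing machines with k work tapes and a read-only oracle tape, all scanned
-- at the same position by one head

data Direction : Set where
  left right : Direction

record TMInstr (k : ℕ) : Set where
  constructor instr
  field
    state     : ℕ
    oracle    : Bool
    read      : Vec Bool k
    write     : Vec Bool k
    direction : Direction
    next      : ℕ

-- A list of instructions is read as a partial transition function: the first
-- instruction matching the state and the scanned symbols is the one executed,
-- and the machine halts when there is none.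

TMProgram : ℕ → Set
TMProgram k = List (TMInstr k)

transition : ∀ {k} → TMProgram k → ℕ → Bool → Vec Bool k → Maybe (TMInstr k)
transition P s o v = find (λ i → key i ≟ (s , o , v)) P
  where
  key = λ i → let open TMInstr i in state , oracle , read
  _≟_ = Product.≡-dec ℕ._≟_ (Product.≡-dec Bool._≟_ (Vec.≡-dec Bool._≟_))

record Tape p : Set (lsuc (1ℓ ⊔ p)) where
  field
    Pos    : Set p
    _≈_    : Pos → Pos → Set
    cell   : ℕ → Pos
    LeftOf : Pos → Pos → Set (1ℓ ⊔ p)
    succ   : Pos → Pos

module TM {p} (T : Tape p) (k : ℕ) where
  open Tape T

  record Config : Set p where
    field
      state   : ℕ
      head    : Pos
      content : Fin k → Pos → Bool

  open Config

  scanned : Config → Vec Bool k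
  scanned c = Vec.tabulate λ t → content c t (head c)

  -- b is the symbol at h on the tape carrying the characteristic function of w
  -- on its first ω cells and 0 elsewhere.
  OracleBit : Real → Pos → Bool → Set
  OracleBit w h b = b ≡ true ⇔ (∃[ n ] h ≈ cell n × w n ≡ true)

  Moves : Direction → Pos → Pos → Set (1ℓ ⊔ p)
  Moves left  h h′ = LeftOf h h′
  Moves right h h′ = Lift (1ℓ ⊔ p) (h′ ≈ succ h)

  record Applies (i : TMInstr k) (c c′ : Config) : Set (1ℓ ⊔ p) where
    field
      state′    : state c′ ≡ TMInstr.next i
      head′     : Moves (TMInstr.direction i) (head c) (head c′)
      written   : ∀ t q → q ≈ head c → content c′ t q ≡ Vec.lookup (TMInstr.write i) t
      unchanged : ∀ t q → ¬ (q ≈ head c) → content c′ t q ≡ content c t q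

  -- A natural number is output in unary: j cells 1 followed by a 0.
  system : (out : Fin k) → (Ord → (Ord → Config) → Config → Set (1ℓ ⊔ p)) →
           TMProgram k → Real → System p
  system out Limit P w = record
    { Config  = Config
    ; Initial = λ c → Lift (1ℓ ⊔ p)
                  (state c ≡ 0 × head c ≈ cell 0 × (∀ t q → content c t q ≡ false))
    ; Step    = λ c c′ → ∃[ o ] OracleBit w (head c) o ×
                  ∃[ i ] transition P (state c) o (scanned c) ≡ just i × Applies i c c′
    ; Limit   = Limit
    ; Halted  = λ c → Lift (1ℓ ⊔ p) (∃[ o ] OracleBit w (head c) o ×
                  transition P (state c) o (scanned c) ≡ nothing)
    ; Output  = λ c j → (∀ i → i ℕ.< j → content c out (cell i) ≡ true) ×
                  content c out (cell j) ≡ false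
    }

------------------------------------------------------------------------
-- Infinite time Turing machines: tapes 0, 1, 2 are the input, scratch and
-- output tape; state 0 is the start state, state 1 the limit state

ωTape : Tape 0ℓ
ωTape = record
  { Pos    = ℕ
  ; _≈_    = _≡_
  ; cell   = λ n → n
  ; LeftOf = λ h h′ → Lift 1ℓ (h′ ≡ pred h)
  ; succ   = suc
  }

ITTMLimit : let open TM ωTape 3 in Ord → (Ord → Config) → Config → Set₁
ITTMLimit μ C c =
  state c ≡ 1 × head c ≡ 0 ×
  (∀ t q → IsLimsup Bool._≤_ μ (λ γ → content (C γ) t q) (content c t q))
  where open TM ωTape 3; open Config

ittm : TMProgram 3 → Real → System 0ℓ
ittm = TM.system ωTape 3 (suc (suc zero)) ITTMLimit

------------------------------------------------------------------------
-- Ordinal Turing machines (no ordinal parameters)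

-- Moving left from a position that is not a successor leads to 0.

data LeftOfₒ (h h′ : Ord) : Set₁ where
  predecessor : h ≈ₒ sucₒ h′ → LeftOfₒ h h′
  toStart     : (∀ q → ¬ (h ≈ₒ sucₒ q)) → h′ ≈ₒ zeroₒ → LeftOfₒ h h′

OrdTape : Tape 1ℓ
OrdTape = record
  { Pos    = Ord
  ; _≈_    = _≈ₒ_
  ; cell   = fromℕₒ
  ; LeftOf = LeftOfₒ
  ; succ   = sucₒ
  }

-- The head position is the liminf over the earlier times at which the machine
-- was in the limit state.

OTMLimit : let open TM OrdTape 1 in Ord → (Ord → Config) → Config → Set₁
OTMLimit μ C c =
  IsLiminf ℕ._≤_ μ (state ∘ C) (state c) ×
  IsLiminfAlong _≤ₒ_ (λ γ → state (C γ) ≡ state c) μ (head ∘ C) (head c) ×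
  (∀ t q → IsLiminf Bool._≤_ μ (λ γ → content (C γ) t q) (content c t q))
  where open TM OrdTape 1; open Config

otm : TMProgram 1 → Real → System 1ℓ
otm = TM.system OrdTape 1 zero OTMLimit

------------------------------------------------------------------------
-- Models of computation

data Model : Set where
  ITRM ITTM OTM : Model

Program : Model → Set
Program ITRM = List ITRMInstr
Program ITTM = TMProgram 3
Program OTM  = TMProgram 1

-- P in oracle w halts with output j.

_^_↓_ : {M : Model} → Program M → Real → ℕ → Set₁
_^_↓_ {ITRM} P w j = HaltsWith (itrm P w) j
_^_↓_ {ITTM} P w j = HaltsWith (ittm P w) j
_^_↓_ {OTM}  P w j = HaltsWith (otm P w) j

------------------------------------------------------------------------
-- Gödel numbering of programs

-- Bijective binary numerals code finite sequences of natural numbers: the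
-- number a is coded by a digits 2 followed by a digit 1, least significant
-- digit first.

tokens : ℕᵇ → List ℕ
tokens zero     = []
tokens 1+[2 b ] = 0 ∷ tokens b
tokens 2[1+ b ] with tokens b
... | []     = []
... | a ∷ as = suc a ∷ as

-- The first n digits, with 1 read as false and 2 as true, padded by false.

bits : ∀ n → ℕᵇ → Vec Bool n
bits zero    _        = []
bits (suc n) zero     = false ∷ bits n zero
bits (suc n) 1+[2 b ] = false ∷ bits n b
bits (suc n) 2[1+ b ] = true ∷ bits n b

parseITRM : List ℕ → List ITRMInstr
parseITRM (0 ∷ n ∷ ts)         = Z n ∷ parseITRM ts
parseITRM (1 ∷ n ∷ ts)         = S n ∷ parseITRM ts
parseITRM (2 ∷ n ∷ ts)         = O n ∷ parseITRM ts
parseITRM (3 ∷ m ∷ n ∷ ts)     = T m n ∷ parseITRM ts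
parseITRM (4 ∷ m ∷ n ∷ q ∷ ts) = J m n q ∷ parseITRM ts
parseITRM _                    = []

fromBits : ∀ {k} → ℕ → Vec Bool (suc (suc (k + k))) → ℕ → TMInstr k
fromBits {k} s (o ∷ d ∷ rw) s′ =
  instr s o (Vec.take k rw) (Vec.drop k rw) (if d then right else left) s′

parseTM : ∀ {k} → List ℕ → TMProgram k
parseTM (s ∷ a ∷ s′ ∷ ts) = fromBits s (bits _ (ℕᵇ.fromℕ a)) s′ ∷ parseTM ts
parseTM _                 = []

program : (M : Model) → ℕ → Program M
program ITRM = parseITRM ∘ tokens ∘ ℕᵇ.fromℕ
program ITTM = parseTM ∘ tokens ∘ ℕᵇ.fromℕ
program OTM  = parseTM ∘ tokens ∘ ℕᵇ.fromℕ

private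
  untoken : ℕ → ℕᵇ → ℕᵇ
  untoken zero    b = 1+[2 b ]
  untoken (suc a) b = 2[1+ untoken a b ]

  tokens-untoken : ∀ a b → tokens (untoken a b) ≡ a ∷ tokens b
  tokens-untoken zero    b = refl
  tokens-untoken (suc a) b rewrite tokens-untoken a b = refl

  untokens : List ℕ → ℕᵇ
  untokens []       = zero
  untokens (a ∷ as) = untoken a (untokens as)

  tokens-untokens : ∀ as → tokens (untokens as) ≡ as
  tokens-untokens []       = refl
  tokens-untokens (a ∷ as) =
    trans (tokens-untoken a (untokens as)) (cong (a ∷_) (tokens-untokens as))

  unbits : ∀ {n} → Vec Bool n → ℕᵇ
  unbits []           = zero
  unbits (false ∷ bs) = 1+[2 unbits bs ]
  unbits (true ∷ bs)  = 2[1+ unbits bs ]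

  bits-unbits : ∀ {n} (bs : Vec Bool n) → bits n (unbits bs) ≡ bs
  bits-unbits []           = refl
  bits-unbits (false ∷ bs) = cong (false ∷_) (bits-unbits bs)
  bits-unbits (true ∷ bs)  = cong (true ∷_) (bits-unbits bs)

  unparseITRM : List ITRMInstr → List ℕ
  unparseITRM []            = []
  unparseITRM (Z n ∷ P)     = 0 ∷ n ∷ unparseITRM P
  unparseITRM (S n ∷ P)     = 1 ∷ n ∷ unparseITRM P
  unparseITRM (O n ∷ P)     = 2 ∷ n ∷ unparseITRM P
  unparseITRM (T m n ∷ P)   = 3 ∷ m ∷ n ∷ unparseITRM P
  unparseITRM (J m n q ∷ P) = 4 ∷ m ∷ n ∷ q ∷ unparseITRM P

  parse-unparseITRM : ∀ P → parseITRM (unparseITRM P) ≡ P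
  parse-unparseITRM []            = refl
  parse-unparseITRM (Z n ∷ P)     = cong (_ ∷_) (parse-unparseITRM P)
  parse-unparseITRM (S n ∷ P)     = cong (_ ∷_) (parse-unparseITRM P)
  parse-unparseITRM (O n ∷ P)     = cong (_ ∷_) (parse-unparseITRM P)
  parse-unparseITRM (T m n ∷ P)   = cong (_ ∷_) (parse-unparseITRM P)
  parse-unparseITRM (J m n q ∷ P) = cong (_ ∷_) (parse-unparseITRM P)

  isRight : Direction → Bool
  isRight left  = false
  isRight right = true

  toBits : ∀ {k} → TMInstr k → Vec Bool (suc (suc (k + k)))
  toBits (instr s o r w d s′) = o ∷ isRight d ∷ r Vec.++ w

  drop-++ : ∀ {k n} (u : Vec Bool k) (v : Vec Bool n) → Vec.drop k (u Vec.++ v) ≡ v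
  drop-++ []      v = refl
  drop-++ (_ ∷ u) v = drop-++ u v

  take-++ : ∀ {k n} (u : Vec Bool k) (v : Vec Bool n) → Vec.take k (u Vec.++ v) ≡ u
  take-++ []      v = refl
  take-++ (b ∷ u) v = cong (b ∷_) (take-++ u v)

  fromBits-toBits : ∀ {k} (i : TMInstr k) →
                    fromBits (TMInstr.state i) (toBits i) (TMInstr.next i) ≡ i
  fromBits-toBits (instr s o r w left  s′) =
    cong₂ (λ u v → instr s o u v left s′) (take-++ r w) (drop-++ r w)
  fromBits-toBits (instr s o r w right s′) =
    cong₂ (λ u v → instr s o u v right s′) (take-++ r w) (drop-++ r w)

  unparseTM : ∀ {k} → TMProgram k → List ℕ
  unparseTM []      = []
  unparseTM (i ∷ P) =
    TMInstr.state i ∷ ℕᵇ.toℕ (unbits (toBits i)) ∷ TMInstr.next i ∷ unparseTM P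

  parse-unparseTM : ∀ {k} (P : TMProgram k) → parseTM (unparseTM P) ≡ P
  parse-unparseTM []      = refl
  parse-unparseTM (i ∷ P) = cong₂ _∷_
    (trans (cong (λ bs → fromBits (TMInstr.state i) bs (TMInstr.next i))
             (trans (cong (bits _) (fromℕ-toℕ (unbits (toBits i)))) (bits-unbits (toBits i))))
           (fromBits-toBits i))
    (parse-unparseTM P)

  decode-encode : ∀ as → tokens (ℕᵇ.fromℕ (ℕᵇ.toℕ (untokens as))) ≡ as
  decode-encode as = trans (cong tokens (fromℕ-toℕ (untokens as))) (tokens-untokens as)

program-surjective : ∀ M (P : Program M) → ∃[ i ] program M i ≡ P
program-surjective ITRM P = ℕᵇ.toℕ (untokens (unparseITRM P)) ,
  trans (cong parseITRM (decode-encode (unparseITRM P))) (parse-unparseITRM P)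
program-surjective ITTM P = ℕᵇ.toℕ (untokens (unparseTM P)) ,
  trans (cong parseTM (decode-encode (unparseTM P))) (parse-unparseTM P)
program-surjective OTM  P = ℕᵇ.toℕ (untokens (unparseTM P)) ,
  trans (cong parseTM (decode-encode (unparseTM P))) (parse-unparseTM P)

------------------------------------------------------------------------
-- Recognizability and the recognizable jump

-- The classical metatheory enters as an explicit instance of excluded middle:
-- equality of reals and membership in the jump are not decidable otherwise.

module _ (em : ExcludedMiddle 1ℓ) where

  δ : Real → Real → ℕ
  δ z y = if does (em {Lift 1ℓ (z ≗ y)}) then 1 else 0

  Recognizes : (M : Model) → Program M → Real → Real → Set₁
  Recognizes M P y x = ∀ z → _^_↓_ {M} P (z ⊕ x) (δ z y)

  RecognizableRelativeTo : Model → Real → Real → Set₁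
  RecognizableRelativeTo M y x = Σ (Program M) λ P → Recognizes M P y x

  recognizableJump : Model → Real → Real
  recognizableJump M x i =
    does (em {Σ Real λ y → Recognizes M (program M i) y x})

{-# OPTIONS --safe #-}
module Submission where

-- Suppose that P recognizes A = x^r relative to x. By the recursion theorem
-- there is a program with a code e which, in the oracle z ⊕ x, halts with output
-- 0 if z(e) = 1, and otherwise behaves like P. If e ∈ A then it recognizes some
-- y; as it accepts y, y(e) = 0 and P accepts y, so that y = A and e ∉ A. But if
-- e ∉ A then it outputs δ(z,A) for every z, so that e ∈ A.
--
-- It remains to realize the fixed point on each machine. The program starts with
-- a finite computation which produces e from its own description, given by
-- numbers hard-wired in unary, and queries the oracle at 2e. Then it erases all
-- traces and starts P, whose computation is shifted by a finite ordinal but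
-- otherwise unchanged.

open import Defs
open import Axiom.ExcludedMiddle using (ExcludedMiddle)
open import Data.Bool.Base as Bool using (Bool; true; false; if_then_else_; not)
import Data.Bool.Properties as Bool
open import Data.Empty using (⊥-elim)
open import Data.Fin.Base using (Fin; zero; suc; toℕ; fromℕ<)
open import Data.Fin.Patterns using (0F; 1F; 2F; 3F; 4F; 5F; 6F)
import Data.Fin.Properties as Fin
open import Data.List.Base as List using (List; []; _∷_; _++_; concatMap; foldr; length)
import Data.List.Properties as List
open import Data.List.Relation.Unary.All as All using (All; []; _∷_)
import Data.List.Relation.Unary.All.Properties as All
open import Data.Maybe.Base as Maybe using (Maybe; just; nothing)
open import Data.Maybe.Properties using (just-injective)
open import Data.Nat.Base as ℕ using (ℕ; zero; suc; _+_; _*_; _^_; _∸_; _<ᵇ_; _≡ᵇ_)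
open import Data.Nat.Binary.Base as ℕᵇ using (ℕᵇ; zero; 2[1+_]; 1+[2_])
open import Data.Nat.Binary.Properties as ℕᵇ using (fromℕ-toℕ; toℕ-fromℕ)
open import Data.Nat.DivMod using (_/_; _%_; [m+kn]%n≡m%n; m<n⇒m%n≡m; m≡m%n+[m/n]*n; m%n<n; m*n%n≡0; m*n/n≡m)
import Data.Nat.Properties as ℕ
open import Data.Nat.Tactic.RingSolver using (solve-∀)
open import Data.Product.Base using (Σ; ∃-syntax; _×_; _,_; proj₁; proj₂; map₂)
import Data.Product.Properties as Product
open import Data.Sum.Base using (_⊎_; inj₁; inj₂)
open import Data.Unit.Base using (⊤; tt)
open import Data.Vec.Base as Vec using (Vec; []; _∷_; lookup; _[_]≔_; _[_]%=_)
import Data.Vec.Properties as Vec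
open import Function.Base using (_∘_; const; flip; id)
open import Function.Bundles using (mk⇔; Equivalence)
open import Level using (0ℓ; Lift; lift; lower; _⊔_) renaming (suc to lsuc)
open import Relation.Binary.Core using (Rel)
open import Relation.Binary.Definitions using (Symmetric; Transitive; tri<; tri≈; tri>)
open import Relation.Binary.PropositionalEquality
  using (_≡_; _≢_; _≗_; refl; sym; trans; cong; cong₂; subst; module ≡-Reasoning)
open import Relation.Nullary using (¬_; Dec; yes; no; contradiction; does)
open import Relation.Nullary.Decidable as Dec using (dec-true; dec-false)
open import Relation.Unary using (Decidable)

-- Ordinals

-- Codes are read from the lowest digit, so putting instructions in front of a program acts on its
-- code by repeated doubling and adding, which counters can do. A program cannot contain its whole
-- code, but the part that hard-wires a number in unary repeats one pattern, so the code of that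
-- part can be computed from the number itself. What is hard-wired differs. The states of a Turing
-- machine can be named freely, so everything behind the counting part is fixed beforehand, and its
-- code is the number. The jumps of a register machine are absolute, so what follows the hard-wired
-- part depends on its length; it is generated at run time from its line number. Only the affine map
-- that puts the first part in front, and the length of that part, are hard-wired. The limit rules
-- constrain how `P` may be embedded: the limit state of an ITTM is fixed, and the inferior limits
-- of line numbers and of OTM states have to commute with the renumbering.

≤ₒ-refl : ∀ α → α ≤ₒ α
≤ₒ-refl (sup f) i = i , ≤ₒ-refl (f i)

≤ₒ-trans : ∀ {α β γ} → α ≤ₒ β → β ≤ₒ γ → α ≤ₒ γ
≤ₒ-trans {sup f} {sup g} {sup h} p q i with p i
... | j , r with q j
... | k , s = k , ≤ₒ-trans {f i} {g j} {h k} r s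

≤-<-transₒ : ∀ {α β γ} → α ≤ₒ β → β <ₒ γ → α <ₒ γ
≤-<-transₒ {α} {β} {sup h} p (k , q) = k , ≤ₒ-trans {α} {β} {h k} p q

<-≤-transₒ : ∀ {α β γ} → α <ₒ β → β ≤ₒ γ → α <ₒ γ
<-≤-transₒ {α} {sup g} {γ} (j , p) q = ≤-<-transₒ {α} {g j} {γ} p (q j)

<ₒ⇒≤ₒ : ∀ {α β} → α <ₒ β → α ≤ₒ β
<ₒ⇒≤ₒ {sup f} {sup g} (j , p) i = j , <ₒ⇒≤ₒ {f i} {g j} (p i)

zeroₒ-min : ∀ α → zeroₒ ≤ₒ α
zeroₒ-min α ()

≮ₒzeroₒ : ∀ α → ¬ α <ₒ zeroₒ
≮ₒzeroₒ α ()

<ₒ-sucₒ : ∀ α → α <ₒ sucₒ α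
<ₒ-sucₒ α = tt , ≤ₒ-refl α

≈ₒ-refl : ∀ α → α ≈ₒ α
≈ₒ-refl α = ≤ₒ-refl α , ≤ₒ-refl α

≈ₒ-sym : ∀ {α β} → α ≈ₒ β → β ≈ₒ α
≈ₒ-sym (p , q) = q , p

≈ₒ-trans : ∀ {α β γ} → α ≈ₒ β → β ≈ₒ γ → α ≈ₒ γ
≈ₒ-trans {α} {β} {γ} (p , p′) (q , q′) = ≤ₒ-trans {α} {β} {γ} p q , ≤ₒ-trans {γ} {β} {α} q′ p′

sucₒ-cong : ∀ {α β} → α ≈ₒ β → sucₒ α ≈ₒ sucₒ β
sucₒ-cong (p , q) = (λ _ → tt , p) , (λ _ → tt , q)

sucₒ-injective : ∀ {α β} → sucₒ α ≈ₒ sucₒ β → α ≈ₒ β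
sucₒ-injective (p , q) = proj₂ (p tt) , proj₂ (q tt)

sucₒ≉zeroₒ : ∀ {α} → ¬ sucₒ α ≈ₒ zeroₒ
sucₒ≉zeroₒ {α} (p , _) = ≮ₒzeroₒ α (p tt)

-- `_<ₒ_` compares ranks and is not the subtree relation. Proving `Φ` for every `γ ≤ₒ β` instead
-- makes the recursion on the tree `β` structural.
≤ₒ-induction : ∀ {ℓ} (Φ : Ord → Set ℓ) → (∀ β → (∀ γ → γ <ₒ β → Φ γ) → Φ β) → ∀ β → Φ β
≤ₒ-induction Φ step β = below β β (≤ₒ-refl β)
  where
  below : ∀ β γ → γ ≤ₒ β → Φ γ
  below (sup g) γ p = step γ λ δ q →
    let j , r = <-≤-transₒ {δ} {γ} {sup g} q p in below (g j) δ r

-- 1 + α is the length of a computation of length α preceded by one step. Unlike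
-- sucₒ α it does not exceed α if α is infinite.

1+ₒ_ : Ord → Ord
1+ₒ sup {I} f = sup {Maybe I} λ where
  nothing  → zeroₒ
  (just i) → 1+ₒ f i

-- This is `-1 + α`, the inverse of `1+ₒ_` on positive ranks: members of rank 0 are dropped
-- hereditarily, which lowers finite positive ranks by one and leaves infinite ranks unchanged.
predₒ : Ord → Ord
predₒ (sup {I} f) = sup {∃[ i ] zeroₒ <ₒ f i} λ (i , _) → predₒ (f i)

1+ₒ-mono : ∀ {α β} → α ≤ₒ β → 1+ₒ α ≤ₒ 1+ₒ β
1+ₒ-mono {sup f} {sup g} p nothing  = nothing , zeroₒ-min _
1+ₒ-mono {sup f} {sup g} p (just i) = let j , q = p i in just j , 1+ₒ-mono {f i} {g j} q

predₒ-mono : ∀ {α β} → α ≤ₒ β → predₒ α ≤ₒ predₒ β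
predₒ-mono {sup f} {sup g} p (i , 0<fi) = let j , q = p i in
  (j , <-≤-transₒ {zeroₒ} {f i} {g j} 0<fi q) , predₒ-mono {f i} {g j} q

predₒ-strict : ∀ {α β} → zeroₒ <ₒ α → α <ₒ β → predₒ α <ₒ predₒ β
predₒ-strict {α} {sup g} 0<α (j , q) = (j , <-≤-transₒ {zeroₒ} {α} {g j} 0<α q) , predₒ-mono {α} {g j} q

1+ₒ-positive : ∀ α → zeroₒ <ₒ 1+ₒ α
1+ₒ-positive (sup f) = nothing , zeroₒ-min _

1+ₒ-strict : ∀ {α β} → α <ₒ β → 1+ₒ α <ₒ 1+ₒ β
1+ₒ-strict {α} {sup g} (j , p) = just j , 1+ₒ-mono {α} {g j} p

predₒ-1+ₒ : ∀ α → predₒ (1+ₒ α) ≈ₒ α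
predₒ-1+ₒ α = to α , from α
  where
  to : ∀ α → predₒ (1+ₒ α) ≤ₒ α
  to (sup f) (nothing , ())
  to (sup f) (just i  , _) = i , to (f i)
  from : ∀ α → α ≤ₒ predₒ (1+ₒ α)
  from (sup f) i = (just i , 1+ₒ-positive (f i)) , from (f i)

1+ₒ-predₒ-≤ : ∀ α → zeroₒ <ₒ α → 1+ₒ predₒ α ≤ₒ α
1+ₒ-predₒ-≤ (sup f) 0<α nothing = 0<α
1+ₒ-predₒ-≤ (sup f) 0<α (just (i , 0<fi)) = i , 1+ₒ-predₒ-≤ (f i) 0<fi

predₒ-sucₒ : ∀ {α} → zeroₒ <ₒ α → predₒ (sucₒ α) ≈ₒ sucₒ (predₒ α)
predₒ-sucₒ {α} 0<α = (λ _ → tt , ≤ₒ-refl (predₒ α)) , (λ _ → (tt , 0<α) , ≤ₒ-refl (predₒ α))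

predₒ-cong : ∀ {α β} → α ≈ₒ β → predₒ α ≈ₒ predₒ β
predₒ-cong {α} {β} (p , q) = predₒ-mono {α} {β} p , predₒ-mono {β} {α} q

predₒ-≤1 : ∀ {α} → α ≤ₒ sucₒ zeroₒ → predₒ α ≈ₒ zeroₒ
predₒ-≤1 {sup f} p = (λ (i , 0<fi) → ⊥-elim (≮ₒzeroₒ zeroₒ
  (<-≤-transₒ {zeroₒ} {f i} {zeroₒ} 0<fi (proj₂ (p i))))) ,
                     zeroₒ-min _

IsLimit-cong : ∀ {μ ν} → μ ≈ₒ ν → IsLimit μ → IsLimit ν
IsLimit-cong {μ} {ν} (p , q) (0<μ , closed) = <-≤-transₒ {zeroₒ} {μ} {ν} 0<μ p , λ β β<ν →
  <-≤-transₒ {sucₒ β} {μ} {ν} (closed β (<-≤-transₒ {β} {ν} {μ} β<ν q)) p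

module _ (em : ExcludedMiddle 1ℓ) where

  decide : ∀ {P : Set} → Dec P
  decide = Dec.map′ lower lift em

  ≤ₒ-<ₒ-total : ∀ α β → α ≤ₒ β ⊎ β <ₒ α
  ≤ₒ-<ₒ-total (sup {I} f) β with decide {∃[ i ] β ≤ₒ f i}
  ... | yes β<α = inj₂ β<α
  ... | no  β≮α = inj₁ below
    where
    below : ∀ i → f i <ₒ β
    below i with ≤ₒ-<ₒ-total β (f i)
    ... | inj₁ β≤fi = contradiction (i , β≤fi) β≮α
    ... | inj₂ fi<β = fi<β

  positive? : ∀ α → α ≈ₒ zeroₒ ⊎ zeroₒ <ₒ α
  positive? α with ≤ₒ-<ₒ-total α zeroₒ
  ... | inj₁ α≤0 = inj₁ (α≤0 , zeroₒ-min α)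
  ... | inj₂ 0<α = inj₂ 0<α

  -- Excluded middle decides which members `predₒ` has dropped; these are bounded by the member 0
  -- that `1+ₒ_` adds. Rank 0 is no exception in this direction.
  1+ₒ-predₒ-≥ : ∀ α → α ≤ₒ 1+ₒ predₒ α
  1+ₒ-predₒ-≥ (sup f) i with positive? (f i)
  ... | inj₁ (fi≤0 , _) = nothing , fi≤0
  ... | inj₂ 0<fi       = just (i , 0<fi) , 1+ₒ-predₒ-≥ (f i)

  data View (β : Ord) : Set₁ where
    zeroᵛ  : β ≈ₒ zeroₒ → View β
    sucᵛ   : ∀ γ → β ≈ₒ sucₒ γ → View β
    limitᵛ : IsLimit β → View β

  -- A positive rank is a successor if its family has a maximum. Otherwise every member lies
  -- strictly below another one, whence closure under `sucₒ`.
  view : ∀ β → View β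
  view (sup {I} f) with positive? (sup f)
  ... | inj₁ β≈0 = zeroᵛ β≈0
  ... | inj₂ 0<β with decide {∃[ i ] ∀ j → f j ≤ₒ f i}
  ...   | yes (i , max) = sucᵛ (f i) ((λ j → tt , max j) , λ _ → i , ≤ₒ-refl (f i))
  ...   | no  noMax = limitᵛ (0<β , closed)
    where
    larger : ∀ i → ∃[ j ] f i <ₒ f j
    larger i with decide {∃[ j ] f i <ₒ f j}
    ... | yes p = p
    ... | no  p = contradiction (i , max) noMax
      where
      max : ∀ j → f j ≤ₒ f i
      max j with ≤ₒ-<ₒ-total (f j) (f i)
      ... | inj₁ q = q
      ... | inj₂ q = contradiction (j , q) p
    closed : ∀ γ → γ <ₒ sup f → sucₒ γ <ₒ sup f
    closed γ (i , γ≤fi) = let j , q = larger i in j , λ _ → ≤-<-transₒ {γ} {f i} {f j} γ≤fi q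

-- Transfinite computations

-- Follows _~_ μ C ν D: close to ν, the sequence D only takes values related to
-- values which C takes close to μ.

record Follows {a b r} {A : Set a} {B : Set b} (_~_ : A → B → Set r)
               (μ : Ord) (C : Ord → A) (ν : Ord) (D : Ord → B) : Set (1ℓ ⊔ r) where
  constructor mkFollows
  field
    values : ∀ β → β <ₒ μ → ∃[ γ ] γ <ₒ ν ×
      (∀ δ → γ ≤ₒ δ → δ <ₒ ν → ∃[ ε ] β ≤ₒ ε × ε <ₒ μ × C ε ~ D δ)

open Follows

-- Limit rules see a sequence only through its behaviour close to the limit, so they should not
-- separate two sequences related in this way. The limits `μ` and `ν` may differ, which allows for a
-- shift in time.
Tails : ∀ {a r} {A : Set a} → Rel A r → Ord → (Ord → A) → Ord → (Ord → A) → Set (1ℓ ⊔ r)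
Tails _~_ μ C ν D = Follows _~_ μ C ν D × Follows (flip _~_) ν D μ C

eventually-follows : ∀ {a b r p q} {A : Set a} {B : Set b} {_~_ : A → B → Set r}
  {P : A → Set p} {Q : B → Set q} {μ ν C D} →
  Follows _~_ μ C ν D → (∀ {c d} → c ~ d → P c → Q d) →
  Eventually μ (P ∘ C) → Eventually ν (Q ∘ D)
eventually-follows F P⇒Q (β , β<μ , PC) =
  let γ , γ<ν , same = values F β β<μ in γ , γ<ν , λ δ γ≤δ δ<ν →
  let ε , β≤ε , ε<μ , Cε~Dδ = same δ γ≤δ δ<ν in P⇒Q Cε~Dδ (PC ε β≤ε ε<μ)

follows-map : ∀ {a b r r′} {A : Set a} {B : Set b} {_~_ : A → B → Set r} {_≃_ : A → B → Set r′} →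
  (∀ {c d} → c ~ d → c ≃ d) → ∀ {μ C ν D} → Follows _~_ μ C ν D → Follows _≃_ μ C ν D
follows-map f F = mkFollows λ β β<μ → map₂ (map₂ λ same δ γ≤δ δ<ν →
  map₂ (map₂ (map₂ f)) (same δ γ≤δ δ<ν)) (values F β β<μ)

pointwise-follows : ∀ {a b r} {A : Set a} {B : Set b} (_~_ : A → B → Set r) {μ ν C D} →
  μ ≈ₒ ν → (∀ δ → δ <ₒ μ → C δ ~ D δ) → Follows _~_ μ C ν D
pointwise-follows _ {μ} {ν} (μ≤ν , ν≤μ) C~D = mkFollows λ β β<μ →
  β , <-≤-transₒ {β} {μ} {ν} β<μ μ≤ν , λ δ β≤δ δ<ν →
  let δ<μ = <-≤-transₒ {δ} {ν} {μ} δ<ν ν≤μ in δ , β≤δ , δ<μ , C~D δ δ<μ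

-- The properties under which runs are unique and can be extended at the beginning. Configurations
-- contain functions and trees, so `_~_` takes the place of equality. It need not be reflexive: on
-- an ordinal tape `c ~ c` will say that the contents of `c` respect `_≈ₒ_`.
record Regular {c} (M : System c) : Set (lsuc (1ℓ ⊔ c)) where
  open System M
  infix 4 _~_
  field
    _~_           : Rel Config c
    ~-sym         : Symmetric _~_
    ~-trans       : Transitive _~_
    step-unique   : ∀ {c c′ d d′} → c ~ c′ → Step c d → Step c′ d′ → d ~ d′
    step-resp     : ∀ {c d d′} → Step c d → d ~ d′ → Step c d′
    limit-unique  : ∀ {μ C c ν D d} → Tails _~_ μ C ν D → Limit μ C c → Limit ν D d → c ~ d
    limit-resp    : ∀ {μ C c ν D d} → Tails _~_ μ C ν D → c ~ d → Limit μ C c → Limit ν D d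
    halted-step   : ∀ {c d} → Halted c → ¬ Step c d
    halted-resp   : ∀ {c d} → c ~ d → Halted c → Halted d
    output-resp   : ∀ {c d j} → c ~ d → Output c j → Output d j
    output-unique : ∀ {c i j} → Output c i → Output c j → i ≡ j

restart : ∀ {c} (M : System c) → (System.Config M → Set (1ℓ ⊔ c)) → System c
restart M I = record M { Initial = I }

module _ (em : ExcludedMiddle 1ℓ) {c} {M : System c} (R : Regular M) where
  open System M
  open Regular R
  open IsComputation

  module _ {I : Config → Set (1ℓ ⊔ c)} (I-unique : ∀ {c d} → I c → I d → c ~ d) where

    -- Indices are compared up to `_≈ₒ_` because a computation assigns a configuration to every
    -- tree. Applied to one computation twice, this shows that its values depend on ranks only, up
    -- to `_~_`, and in particular that they are related to themselves.
    computation-unique : ∀ {α C α′ C′} →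
      IsComputation (restart M I) α C → IsComputation (restart M I) α′ C′ →
      ∀ β β′ → β ≈ₒ β′ → β ≤ₒ α → β′ ≤ₒ α′ → C β ~ C′ β′
    computation-unique {α} {C} {α′} {C′} comp comp′ =
      ≤ₒ-induction (λ β → ∀ β′ → β ≈ₒ β′ → β ≤ₒ α → β′ ≤ₒ α′ → C β ~ C′ β′) step
      where
      step : ∀ β → (∀ γ → γ <ₒ β → ∀ γ′ → γ ≈ₒ γ′ → γ ≤ₒ α → γ′ ≤ₒ α′ → C γ ~ C′ γ′) →
             ∀ β′ → β ≈ₒ β′ → β ≤ₒ α → β′ ≤ₒ α′ → C β ~ C′ β′
      step β rec β′ β≈β′ β≤α β′≤α′ = case (view em β)
        where
        rec′ : ∀ γ → γ <ₒ β → C γ ~ C′ γ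
        rec′ γ γ<β = rec γ γ<β γ (≈ₒ-refl γ)
          (<ₒ⇒≤ₒ {γ} {α} (<-≤-transₒ {γ} {β} {α} γ<β β≤α))
          (<ₒ⇒≤ₒ {γ} {α′} (<-≤-transₒ {γ} {β} {α′} γ<β
            (≤ₒ-trans {β} {β′} {α′} (proj₁ β≈β′) β′≤α′)))
        case : View em β → C β ~ C′ β′
        case (zeroᵛ β≈0) = I-unique (initial comp β β≤α β≈0)
          (initial comp′ β′ β′≤α′ (≈ₒ-trans {β′} {β} {zeroₒ} (≈ₒ-sym {β} {β′} β≈β′) β≈0))
        case (sucᵛ γ β≈sγ) = step-unique (rec′ γ (proj₂ β≈sγ tt)) (successor comp γ β β≤α β≈sγ)
          (successor comp′ γ β′ β′≤α′ (≈ₒ-trans {β′} {β} {sucₒ γ} (≈ₒ-sym {β} {β′} β≈β′) β≈sγ))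
        case (limitᵛ lim) = limit-unique
          (pointwise-follows _~_ β≈β′ rec′ ,
           pointwise-follows (flip _~_) {C = C′} (≈ₒ-sym {β} {β′} β≈β′)
             (λ δ δ<β′ → rec′ δ (<-≤-transₒ {δ} {β′} {β} δ<β′ (proj₂ β≈β′))))
          (limit comp β β≤α lim) (limit comp′ β′ β′≤α′ (IsLimit-cong {β} {β′} β≈β′ lim))

    -- A longer run would make a step out of a configuration related to a halted one.
    halts-unique : ∀ {i j} → HaltsWith (restart M I) i → HaltsWith (restart M I) j → i ≡ j
    halts-unique (α , C , comp , halted , out) (α′ , C′ , comp′ , halted′ , out′)
      with ≤ₒ-<ₒ-total em α α′ | ≤ₒ-<ₒ-total em α′ α
    ... | inj₁ p | inj₁ q = output-unique
      (output-resp (computation-unique comp comp′ α α′ (p , q) (≤ₒ-refl α) (≤ₒ-refl α′)) out) out′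
    ... | inj₂ α′<α | _ = ⊥-elim (halted-step
      (halted-resp (computation-unique comp′ comp α′ α′ (≈ₒ-refl α′) (≤ₒ-refl α′)
        (<ₒ⇒≤ₒ {α′} {α} α′<α)) halted′)
      (successor comp α′ (sucₒ α′) (λ _ → α′<α) (≈ₒ-refl (sucₒ α′))))
    ... | inj₁ _ | inj₂ α<α′ = ⊥-elim (halted-step
      (halted-resp (computation-unique comp comp′ α α (≈ₒ-refl α) (≤ₒ-refl α)
        (<ₒ⇒≤ₒ {α} {α′} α<α′)) halted)
      (successor comp′ α (sucₒ α) (λ _ → α<α′) (≈ₒ-refl (sucₒ α))))

  From : Config → System c
  From c₀ = restart M λ d → Lift (1ℓ ⊔ c) (c₀ ~ d)

  module _ {c d : Config} {j : ℕ} (cc : c ~ c) (c→d : Step c d) where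

    -- The new run is `c` at time 0 and `C (predₒ β)` at every positive time `β`. One extra step
    -- delays finite times only and leaves the tails at limits as they were.
    prepend-step : HaltsWith (From d) j → HaltsWith (From c) j
    prepend-step (α , C , comp , halted , out) = 1+ₒ α , C⁺ , comp⁺ , halted⁺ , out⁺
      where
      stable : ∀ β γ → β ≈ₒ γ → β ≤ₒ α → γ ≤ₒ α → C β ~ C γ
      stable = computation-unique (λ p q → ~-trans (~-sym (lower p)) (lower q)) comp comp

      C⁺ : Ord → Config
      C⁺ β with positive? em β
      ... | inj₁ _ = c
      ... | inj₂ _ = C (predₒ β)

      C⁺-positive : ∀ β → zeroₒ <ₒ β → C⁺ β ≡ C (predₒ β)
      C⁺-positive β 0<β with positive? em β
      ... | inj₁ (β≤0 , _) = ⊥-elim (≮ₒzeroₒ zeroₒ (<-≤-transₒ {zeroₒ} {β} 0<β β≤0))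
      ... | inj₂ _ = refl

      C⁺-zero : ∀ β → β ≈ₒ zeroₒ → C⁺ β ≡ c
      C⁺-zero β (β≤0 , _) with positive? em β
      ... | inj₁ _   = refl
      ... | inj₂ 0<β = ⊥-elim (≮ₒzeroₒ zeroₒ (<-≤-transₒ {zeroₒ} {β} 0<β β≤0))

      predₒ-≤ : ∀ {β} → β ≤ₒ 1+ₒ α → predₒ β ≤ₒ α
      predₒ-≤ {β} β≤1+α = ≤ₒ-trans {predₒ β} {predₒ (1+ₒ α)} {α}
        (predₒ-mono {β} {1+ₒ α} β≤1+α) (proj₁ (predₒ-1+ₒ α))

      final : C α ~ C⁺ (1+ₒ α)
      final rewrite C⁺-positive (1+ₒ α) (1+ₒ-positive α) =
        stable α (predₒ (1+ₒ α)) (≈ₒ-sym {predₒ (1+ₒ α)} (predₒ-1+ₒ α)) (≤ₒ-refl α)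
          (proj₁ (predₒ-1+ₒ α))

      halted⁺ : Halted (C⁺ (1+ₒ α))
      halted⁺ = halted-resp final halted

      out⁺ : Output (C⁺ (1+ₒ α)) j
      out⁺ = output-resp final out

      step⁺ : ∀ β γ → γ ≤ₒ 1+ₒ α → γ ≈ₒ sucₒ β → Step (C⁺ β) (C⁺ γ)
      step⁺ β γ γ≤ γ≈sβ with positive? em β
      ... | inj₁ β≈0 rewrite C⁺-positive γ (≤-<-transₒ {zeroₒ} {β} {γ} (zeroₒ-min β) (proj₂ γ≈sβ tt)) =
        -- At time 1 the old run is at its beginning, which is related to `d` but need not be equal
        -- to it.
        step-resp c→d (lower (initial comp (predₒ γ) (predₒ-≤ {γ} γ≤)
          (predₒ-≤1 {γ} (≤ₒ-trans {γ} {sucₒ β} {sucₒ zeroₒ} (proj₁ γ≈sβ) (λ _ → tt , proj₁ β≈0)))))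
      ... | inj₂ 0<β rewrite C⁺-positive γ (≤-<-transₒ {zeroₒ} {β} {γ} (zeroₒ-min β) (proj₂ γ≈sβ tt)) =
        successor comp (predₒ β) (predₒ γ) (predₒ-≤ {γ} γ≤)
          (≈ₒ-trans {predₒ γ} {predₒ (sucₒ β)} {sucₒ (predₒ β)}
            (predₒ-cong {γ} {sucₒ β} γ≈sβ) (predₒ-sucₒ {β} 0<β))

      limit⁺ : ∀ μ → μ ≤ₒ 1+ₒ α → IsLimit μ → Limit μ C⁺ (C⁺ μ)
      limit⁺ μ μ≤ lim@(0<μ , closed) rewrite C⁺-positive μ 0<μ =
        -- `ν = predₒ μ` is a limit too, and `1+ₒ_` and `predₒ` carry end segments of `ν` and `μ`
        -- into each other. So the limit rule at `ν` can be transported to `μ`.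
        limit-resp (shifted , shifted′) (stable ν ν (≈ₒ-refl ν) ν≤α ν≤α) (limit comp ν ν≤α limν)
        where
        ν = predₒ μ
        ν≤α = predₒ-≤ {μ} μ≤
        into : ∀ {β} → β <ₒ ν → 1+ₒ β <ₒ μ
        into {β} β<ν = <-≤-transₒ {1+ₒ β} {1+ₒ ν} {μ} (1+ₒ-strict {β} {ν} β<ν) (1+ₒ-predₒ-≤ μ 0<μ)
        1<μ : sucₒ zeroₒ <ₒ μ
        1<μ = closed zeroₒ 0<μ
        limν : IsLimit ν
        limν = ≤-<-transₒ {zeroₒ} {predₒ (sucₒ zeroₒ)} {ν} (zeroₒ-min (predₒ (sucₒ zeroₒ)))
                 (predₒ-strict {sucₒ zeroₒ} {μ} (<ₒ-sucₒ zeroₒ) 1<μ) ,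
          λ β β<ν → ≤-<-transₒ {sucₒ β} {predₒ (sucₒ (1+ₒ β))} {ν}
            (λ _ → ≤-<-transₒ {β} {predₒ (1+ₒ β)} {predₒ (sucₒ (1+ₒ β))} (proj₂ (predₒ-1+ₒ β))
              (predₒ-strict {1+ₒ β} {sucₒ (1+ₒ β)} (1+ₒ-positive β) (<ₒ-sucₒ (1+ₒ β))))
            (predₒ-strict {sucₒ (1+ₒ β)} {μ} (≤-<-transₒ {zeroₒ} {1+ₒ β} {sucₒ (1+ₒ β)}
              (zeroₒ-min (1+ₒ β)) (<ₒ-sucₒ (1+ₒ β)))
              (closed (1+ₒ β) (into {β} β<ν)))
        outOf : ∀ {β δ} → 1+ₒ β ≤ₒ δ → δ <ₒ μ →
                β ≤ₒ predₒ δ × predₒ δ <ₒ ν × C (predₒ δ) ~ C⁺ δ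
        outOf {β} {δ} 1+β≤δ δ<μ rewrite C⁺-positive δ (<-≤-transₒ {zeroₒ} {1+ₒ β} {δ} (1+ₒ-positive β) 1+β≤δ) =
          ≤ₒ-trans {β} {predₒ (1+ₒ β)} {predₒ δ} (proj₂ (predₒ-1+ₒ β)) (predₒ-mono {1+ₒ β} {δ} 1+β≤δ) ,
          pδ<ν , stable (predₒ δ) (predₒ δ) (≈ₒ-refl _) pδ≤α pδ≤α
          where
          pδ<ν = predₒ-strict {δ} {μ} (<-≤-transₒ {zeroₒ} {1+ₒ β} {δ} (1+ₒ-positive β) 1+β≤δ) δ<μ
          pδ≤α = <ₒ⇒≤ₒ {predₒ δ} {α} (<-≤-transₒ {predₒ δ} {ν} {α} pδ<ν ν≤α)
        shifted : Follows _~_ ν C μ C⁺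
        shifted = mkFollows λ β β<ν → 1+ₒ β , into {β} β<ν , λ δ 1+β≤δ δ<μ →
          predₒ δ , outOf {β} {δ} 1+β≤δ δ<μ
        shifted′ : Follows (flip _~_) μ C⁺ ν C
        shifted′ = mkFollows λ β β<μ → predₒ β , predₒ-< β β<μ , λ δ pβ≤δ δ<ν →
          1+ₒ δ , ≤ₒ-trans {β} {1+ₒ predₒ β} {1+ₒ δ} (1+ₒ-predₒ-≥ em β) (1+ₒ-mono {predₒ β} {δ} pβ≤δ) ,
          into {δ} δ<ν , same δ δ<ν
          where
          predₒ-< : ∀ β → β <ₒ μ → predₒ β <ₒ ν
          predₒ-< β β<μ with positive? em β
          ... | inj₁ (β≤0 , _) = ≤-<-transₒ {predₒ β} {zeroₒ} {ν}
            (proj₁ (predₒ-≤1 {β} (≤ₒ-trans {β} {zeroₒ} {sucₒ zeroₒ} β≤0 (zeroₒ-min _)))) (proj₁ limν)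
          ... | inj₂ 0<β = predₒ-strict {β} {μ} 0<β β<μ
          same : ∀ δ → δ <ₒ ν → C δ ~ C⁺ (1+ₒ δ)
          same δ δ<ν rewrite C⁺-positive (1+ₒ δ) (1+ₒ-positive δ) =
            stable δ (predₒ (1+ₒ δ)) (≈ₒ-sym {predₒ (1+ₒ δ)} (predₒ-1+ₒ δ)) δ≤α
              (≤ₒ-trans {predₒ (1+ₒ δ)} {δ} {α} (proj₁ (predₒ-1+ₒ δ)) δ≤α)
            where δ≤α = <ₒ⇒≤ₒ {δ} {α} (<-≤-transₒ {δ} {ν} {α} δ<ν ν≤α)

      comp⁺ : IsComputation (From c) (1+ₒ α) C⁺
      comp⁺ = record
        { initial   = λ β _ β≈0 → lift (subst (c ~_) (sym (C⁺-zero β β≈0)) cc)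
        ; successor = step⁺
        ; limit     = limit⁺
        }

-- Inferior limits

module _ {a ℓ s} {A : Set a} {_≼_ : Rel A ℓ} {S T : Ord → Set s} {μ ν : Ord} {f g : Ord → A} where

  Bounds-⊆ : Set _
  Bounds-⊆ = ∀ b → Eventually μ (λ γ → S γ → b ≼ f γ) → Eventually ν (λ γ → T γ → b ≼ g γ)

  liminf-≼ : ∀ {v w} → Bounds-⊆ → IsLiminfAlong _≼_ S μ f v → IsLiminfAlong _≼_ T ν g w → v ≼ w
  liminf-≼ ⊆ (_ , least) (upper , _) = least _ λ b bound → upper b (⊆ b bound)

  -- No order laws are assumed of `_≼_`, so the agreement of `v` and `w` is expressed by how they
  -- compare with every other element.
  liminf-resp : ∀ {v w} → Bounds-⊆ →
    (∀ b → Eventually ν (λ γ → T γ → b ≼ g γ) → Eventually μ (λ γ → S γ → b ≼ f γ)) →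
    (∀ b → b ≼ v → b ≼ w) → (∀ u → v ≼ u → w ≼ u) →
    IsLiminfAlong _≼_ S μ f v → IsLiminfAlong _≼_ T ν g w
  liminf-resp ⊆ ⊇ v≼w w≼v (upper , least) =
    (λ b bound → v≼w b (upper b (⊇ b bound))) ,
    (λ u bounded → w≼v u (least u λ b bound → bounded b (⊆ b bound)))

module _ {c r} {A : Set c} {_~_ : Rel A r} {b ℓ} {B : Set b} (_≼_ : Rel B ℓ) (f : A → B)
         (f-mono : ∀ {c d} → c ~ d → ∀ x → x ≼ f c → x ≼ f d)
         (f-anti : ∀ {c d} → c ~ d → ∀ x → x ≼ f d → x ≼ f c)
         {μ ν : Ord} {C D : Ord → A} (tails : Tails _~_ μ C ν D) where

  private
    to : ∀ x → Eventually μ (λ γ → ⊤ → x ≼ f (C γ)) → Eventually ν (λ γ → ⊤ → x ≼ f (D γ))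
    to x = eventually-follows {P = λ c → ⊤ → x ≼ f c} {Q = λ c → ⊤ → x ≼ f c} (proj₁ tails)
             λ c~d p _ → f-mono c~d x (p tt)
    from : ∀ x → Eventually ν (λ γ → ⊤ → x ≼ f (D γ)) → Eventually μ (λ γ → ⊤ → x ≼ f (C γ))
    from x = eventually-follows {P = λ c → ⊤ → x ≼ f c} {Q = λ c → ⊤ → x ≼ f c} (proj₂ tails)
               λ c~d p _ → f-anti c~d x (p tt)

  tails-liminf-unique : (∀ {v w} → v ≼ w → w ≼ v → v ≡ w) → ∀ {v w} →
    IsLiminf _≼_ μ (f ∘ C) v → IsLiminf _≼_ ν (f ∘ D) w → v ≡ w
  tails-liminf-unique antisym p q = antisym (liminf-≼ to p q) (liminf-≼ from q p)

  tails-liminf-resp : ∀ {v} → IsLiminf _≼_ μ (f ∘ C) v → IsLiminf _≼_ ν (f ∘ D) v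
  tails-liminf-resp = liminf-resp to from (λ _ → id) (λ _ → id)

module _ {c c′} {M : System c} {N : System c′} {I : System.Config N → Set (1ℓ ⊔ c′)} where
  open System M

  simulation : (φ : Config → System.Config N) →
    (∀ {c} → Initial c → I (φ c)) →
    (∀ {c d} → Step c d → System.Step N (φ c) (φ d)) →
    (∀ {μ C c} → IsLimit μ → Limit μ C c → System.Limit N μ (φ ∘ C) (φ c)) →
    (∀ {c} → Halted c → System.Halted N (φ c)) →
    (∀ {c j} → Output c j → System.Output N (φ c) j) →
    ∀ {j} → HaltsWith M j → HaltsWith (restart N I) j
  simulation φ initial′ step′ limit′ halted′ output′ (α , C , comp , halted , out) =
    α , φ ∘ C , record
      { initial   = λ β β≤α β≈0 → initial′ (initial β β≤α β≈0)
      ; successor = λ β γ γ≤α γ≈sβ → step′ (successor β γ γ≤α γ≈sβ)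
      ; limit     = λ μ μ≤α lim → limit′ lim (limit μ μ≤α lim)
      } , halted′ halted , output′ out
    where
    open IsComputation comp

-- Register machines

open ITRMConfig

infix 4 _≐_
record _≐_ (c d : ITRMConfig) : Set where
  constructor _,_
  field
    line≡ : line c ≡ line d
    reg≗  : reg c ≗ reg d

open _≐_

≔-cong : ∀ {r r′} n {v v′} → r ≗ r′ → v ≡ v′ → r [ n ≔ v ] ≗ r′ [ n ≔ v′ ]
≔-cong n r≗r′ refl m with m ℕ.≡ᵇ n
... | true  = refl
... | false = r≗r′ m

execute-cong : ∀ w i {c d} → c ≐ d → execute w i c ≐ execute w i d
execute-cong w (Z n) (refl , eq) = refl , ≔-cong n eq refl
execute-cong w (S n) (refl , eq) = refl , ≔-cong n eq (cong suc (eq n))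
execute-cong w (O n) (refl , eq) = refl , ≔-cong n eq (cong (λ v → if w v then 1 else 0) (eq n))
execute-cong w (T m n) (refl , eq) = refl , ≔-cong n eq (eq m)
execute-cong w (J m n q) (refl , eq) rewrite eq m | eq n = refl , eq

module _ (P : List ITRMInstr) (w : Real) where

  ≐-sym : ∀ {c d} → c ≐ d → d ≐ c
  ≐-sym (p , q) = sym p , λ n → sym (q n)

  ≐-trans : ∀ {c d e} → c ≐ d → d ≐ e → c ≐ e
  ≐-trans (p , q) (p′ , q′) = trans p p′ , λ n → trans (q n) (q′ n)

  module _ (f : ITRMConfig → ℕ) (f-cong : ∀ {c d} → c ≐ d → f c ≡ f d)
           {μ ν C D} (tails : Tails _≐_ μ C ν D) where

    private
      mono : ∀ {c d} → c ≐ d → ∀ x → x ℕ.≤ f c → x ℕ.≤ f d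
      mono c≐d x = subst (x ℕ.≤_) (f-cong c≐d)
      anti : ∀ {c d} → c ≐ d → ∀ x → x ℕ.≤ f d → x ℕ.≤ f c
      anti c≐d x = subst (x ℕ.≤_) (sym (f-cong c≐d))

    ≤-liminf-unique : ∀ {v w} → IsLiminf ℕ._≤_ μ (f ∘ C) v → IsLiminf ℕ._≤_ ν (f ∘ D) w → v ≡ w
    ≤-liminf-unique = tails-liminf-unique ℕ._≤_ f mono anti tails ℕ.≤-antisym

    ≤-liminf-resp : ∀ {v} → IsLiminf ℕ._≤_ μ (f ∘ C) v → IsLiminf ℕ._≤_ ν (f ∘ D) v
    ≤-liminf-resp = tails-liminf-resp ℕ._≤_ f mono anti tails

    unbounded-resp : (∀ b → Eventually μ λ γ → b ℕ.≤ f (C γ)) → ∀ b → Eventually ν λ γ → b ℕ.≤ f (D γ)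
    unbounded-resp unbounded b = eventually-follows {P = λ c → b ℕ.≤ f c} {Q = λ c → b ℕ.≤ f c} (proj₁ tails)
      (λ c≐d → mono c≐d b) (unbounded b)

  -- `suc v` would be one of the lower bounds. Hence the two cases of `RegisterLimit` exclude each
  -- other, and the content of a register at a limit is unique.
  unbounded⇒no-liminf : ∀ {μ f v} → (∀ b → Eventually μ λ γ → b ℕ.≤ f γ) → ¬ IsLiminf ℕ._≤_ μ f v
  unbounded⇒no-liminf {v = v} unbounded (upper , _) =
    let β , β<μ , large = unbounded (suc v) in
    ℕ.<-irrefl refl (upper (suc v) (β , β<μ , λ γ β≤γ γ<μ _ → large γ β≤γ γ<μ))

  Tails-flip : ∀ {μ ν C D} → Tails _≐_ μ C ν D → Tails _≐_ ν D μ C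
  Tails-flip (p , q) = follows-map ≐-sym q , follows-map ≐-sym p

  itrm-regular : Regular (itrm P w)
  itrm-regular = record
    { _~_           = _≐_
    ; ~-sym         = ≐-sym
    ; ~-trans       = ≐-trans
    ; step-unique   = step-unique
    ; step-resp     = λ { (lift (i , eq , p , q)) (p′ , q′) →
        lift (i , eq , trans (sym p′) p , λ n → trans (sym (q′ n)) (q n)) }
    ; limit-unique  = λ tails (l , rs) (l′ , rs′) → ≤-liminf-unique line line≡ tails l l′ ,
        λ n → register-unique n tails (rs n) (rs′ n)
    ; limit-resp    = λ { tails (refl , eq) (l , rs) → ≤-liminf-resp line line≡ tails l ,
        λ n → register-resp n tails (eq n) (rs n) }
    ; halted-step   = λ (lift stop) (lift (_ , go , _)) → contradiction (trans (sym stop) go) λ ()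
    ; halted-resp   = λ { (refl , _) stop → stop }
    ; output-resp   = λ (_ , eq) out → trans (sym (eq 0)) out
    ; output-unique = λ p q → trans (sym p) q
    }
    where
    open System (itrm P w) using (Step)
    step-unique : ∀ {c c′ d d′} → c ≐ c′ → Step c d → Step c′ d′ → d ≐ d′
    step-unique c≐c′@(refl , _) (lift (i , eq , p , q)) (lift (i′ , eq′ , p′ , q′))
      with refl ← just-injective (trans (sym eq) eq′) =
      ≐-trans (p , q) (≐-trans (execute-cong w i c≐c′) (sym p′ , λ n → sym (q′ n)))

    register-unique : ∀ n {μ ν C D v v′} → Tails _≐_ μ C ν D →
      RegisterLimit μ (λ γ → reg (C γ) n) v → RegisterLimit ν (λ γ → reg (D γ) n) v′ → v ≡ v′
    register-unique n tails (inj₁ p) (inj₁ q) = ≤-liminf-unique (λ c → reg c n) (λ c≐d → reg≗ c≐d n) tails p q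
    register-unique n tails (inj₂ (_ , refl)) (inj₂ (_ , refl)) = refl
    register-unique n {μ} {ν} {C} {D} tails (inj₁ p) (inj₂ (u , _)) = ⊥-elim (unbounded⇒no-liminf
      (unbounded-resp (λ c → reg c n) (λ c≐d → reg≗ c≐d n) (Tails-flip tails) u) p)
    register-unique n {μ} {ν} {C} {D} tails (inj₂ (u , _)) (inj₁ q) = ⊥-elim (unbounded⇒no-liminf
      (unbounded-resp (λ c → reg c n) (λ c≐d → reg≗ c≐d n) tails u) q)

    register-resp : ∀ n {μ ν C D v v′} → Tails _≐_ μ C ν D → v ≡ v′ →
      RegisterLimit μ (λ γ → reg (C γ) n) v → RegisterLimit ν (λ γ → reg (D γ) n) v′
    register-resp n tails refl (inj₁ p) = inj₁ (≤-liminf-resp (λ c → reg c n) (λ c≐d → reg≗ c≐d n) tails p)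
    register-resp n tails refl (inj₂ (u , eq)) =
      inj₂ (unbounded-resp (λ c → reg c n) (λ c≐d → reg≗ c≐d n) tails u , eq)

-- Turing machines

record TapeLaws {p} (T : Tape p) : Set (lsuc (1ℓ ⊔ p)) where
  open Tape T
  field
    ≈-refl         : ∀ {q} → q ≈ q
    ≈-sym          : ∀ {q r} → q ≈ r → r ≈ q
    ≈-trans        : ∀ {q r s} → q ≈ r → r ≈ s → q ≈ s
    ≈-dec          : ∀ q r → Dec (q ≈ r)
    cell-injective : ∀ {m n} → cell m ≈ cell n → m ≡ n
    cell?          : ∀ q → Dec (∃[ n ] q ≈ cell n)
    succ-cong      : ∀ {q r} → q ≈ r → succ q ≈ succ r
    cell-suc       : ∀ n → cell (suc n) ≈ succ (cell n)
    left-cell      : ∀ n → LeftOf (cell (suc n)) (cell n)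
    left-unique    : ∀ {q q′ r r′} → q ≈ q′ → LeftOf q r → LeftOf q′ r′ → r ≈ r′
    left-resp      : ∀ {q r r′} → r ≈ r′ → LeftOf q r → LeftOf q r′

module TMRegular {p} {T : Tape p} (laws : TapeLaws T) {k : ℕ} where
  open Tape T
  open TapeLaws laws
  open TM T k
  open Config

  infix 4 _≐ᵗ_
  -- Contents are compared at all pairs of equivalent positions, since a configuration may treat
  -- distinct trees of the same rank differently. The relation is therefore only a partial
  -- equivalence.
  record _≐ᵗ_ (c d : Config) : Set p where
    constructor mk≐
    field
      state≡   : state c ≡ state d
      head≈    : head c ≈ head d
      content≡ : ∀ t q r → q ≈ r → content c t q ≡ content d t r
  open _≐ᵗ_ public

  ≐ᵗ-sym : ∀ {c d} → c ≐ᵗ d → d ≐ᵗ c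
  ≐ᵗ-sym (mk≐ p q r) = mk≐ (sym p) (≈-sym q) λ t x y x≈y → sym (r t y x (≈-sym x≈y))

  ≐ᵗ-trans : ∀ {c d e} → c ≐ᵗ d → d ≐ᵗ e → c ≐ᵗ e
  ≐ᵗ-trans (mk≐ p q r) (mk≐ p′ q′ r′) =
    mk≐ (trans p p′) (≈-trans q q′) λ t x y x≈y → trans (r t x y x≈y) (r′ t y y ≈-refl)

  scanned-cong : ∀ {c d} → c ≐ᵗ d → scanned c ≡ scanned d
  scanned-cong (mk≐ _ q r) = Vec.tabulate-cong λ t → r t _ _ q

  oracle-unique : ∀ {w h h′ o o′} → h ≈ h′ → OracleBit w h o → OracleBit w h′ o′ → o ≡ o′
  oracle-unique {o = true}  {true}  _ _ _ = refl
  oracle-unique {o = false} {false} _ _ _ = refl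
  oracle-unique {o = true}  {false} h≈h′ b b′ =
    let n , h≈n , wn = Equivalence.to b refl in sym (Equivalence.from b′ (n , ≈-trans (≈-sym h≈h′) h≈n , wn))
  oracle-unique {o = false} {true}  h≈h′ b b′ =
    let n , h≈n , wn = Equivalence.to b′ refl in Equivalence.from b (n , ≈-trans h≈h′ h≈n , wn)

  moves-unique : ∀ d {q q′ r r′} → q ≈ q′ → Moves d q r → Moves d q′ r′ → r ≈ r′
  moves-unique left  q≈q′ p p′ = left-unique q≈q′ p p′
  moves-unique right q≈q′ (lift p) (lift p′) = ≈-trans p (≈-trans (succ-cong q≈q′) (≈-sym p′))

  moves-resp : ∀ d {q r r′} → r ≈ r′ → Moves d q r → Moves d q r′
  moves-resp left  r≈r′ p = left-resp r≈r′ p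
  moves-resp right r≈r′ (lift p) = lift (≈-trans (≈-sym r≈r′) p)

  applies-unique : ∀ {i c c′ d d′} → c ≐ᵗ c′ → Applies i c d → Applies i c′ d′ → d ≐ᵗ d′
  applies-unique {i} {c} {c′} {d} {d′} (mk≐ _ h r) a a′ =
    mk≐ (trans (state′ a) (sym (state′ a′)))
        (moves-unique (TMInstr.direction i) h (head′ a) (head′ a′)) same
    where
    open Applies
    same : ∀ t x y → x ≈ y → content d t x ≡ content d′ t y
    same t x y x≈y with ≈-dec x (head c)
    ... | yes x≈h = trans (written a t x x≈h) (sym (written a′ t y (≈-trans (≈-sym x≈y) (≈-trans x≈h h))))
    ... | no  x≉h = trans (unchanged a t x x≉h) (trans (r t x y x≈y)
      (sym (unchanged a′ t y λ y≈h → x≉h (≈-trans x≈y (≈-trans y≈h (≈-sym h))))))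

  applies-resp : ∀ {i c d d′} → Applies i c d → d ≐ᵗ d′ → Applies i c d′
  applies-resp {i} a (mk≐ s h r) = record
    { state′    = trans (sym s) (state′ a)
    ; head′     = moves-resp (TMInstr.direction i) h (head′ a)
    ; written   = λ t q q≈h → trans (sym (r t q q ≈-refl)) (written a t q q≈h)
    ; unchanged = λ t q q≉h → trans (sym (r t q q ≈-refl)) (unchanged a t q q≉h)
    }
    where
    open Applies

  module _ {out : Fin k} {Limit : Ord → (Ord → Config) → Config → Set (1ℓ ⊔ p)}
           (limit-unique : ∀ {μ C c ν D d} → Tails _≐ᵗ_ μ C ν D → Limit μ C c → Limit ν D d → c ≐ᵗ d)
           (limit-resp : ∀ {μ C c ν D d} → Tails _≐ᵗ_ μ C ν D → c ≐ᵗ d → Limit μ C c → Limit ν D d)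
           (P : TMProgram k) (w : Real) where

    tm-regular : Regular (system out Limit P w)
    tm-regular = record
      { _~_           = _≐ᵗ_
      ; ~-sym         = ≐ᵗ-sym
      ; ~-trans       = ≐ᵗ-trans
      ; step-unique   = step-unique
      ; step-resp     = λ (o , ob , i , eq , a) d≐d′ → o , ob , i , eq , applies-resp a d≐d′
      ; limit-unique  = limit-unique
      ; limit-resp    = limit-resp
      ; halted-step   = halted-step
      ; halted-resp   = halted-resp
      ; output-resp   = λ { (mk≐ _ _ r) (ones , end) →
          (λ i i<j → trans (sym (r out _ _ ≈-refl)) (ones i i<j)) , trans (sym (r out _ _ ≈-refl)) end }
      ; output-unique = λ {c} → output-unique {c}
      }
      where
      open System (system out Limit P w) using (Step; Halted; Output)
      step-unique : ∀ {c c′ d d′} → c ≐ᵗ c′ → Step c d → Step c′ d′ → d ≐ᵗ d′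
      step-unique c≐c′ (o , ob , i , eq , a) (o′ , ob′ , i′ , eq′ , a′)
        with refl ← oracle-unique (head≈ c≐c′) ob ob′
        rewrite state≡ c≐c′ | scanned-cong c≐c′
        with refl ← just-injective (trans (sym eq) eq′) = applies-unique c≐c′ a a′

      halted-step : ∀ {c d} → Halted c → ¬ Step c d
      halted-step (lift (o , ob , stop)) (o′ , ob′ , i , go , _)
        with refl ← oracle-unique ≈-refl ob ob′ = contradiction (trans (sym stop) go) λ ()

      halted-resp : ∀ {c d} → c ≐ᵗ d → Halted c → Halted d
      halted-resp c≐d (lift (o , ob , stop)) rewrite state≡ c≐d | scanned-cong c≐d =
        lift (o , mk⇔ (λ e → let n , h≈n , wn = Equivalence.to ob e in n , ≈-trans (≈-sym (head≈ c≐d)) h≈n , wn)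
                      (λ (n , h≈n , wn) → Equivalence.from ob (n , ≈-trans (head≈ c≐d) h≈n , wn)) , stop)

      output-unique : ∀ {c i j} → Output c i → Output c j → i ≡ j
      output-unique {i = i} {j} (ones , end) (ones′ , end′) with ℕ.<-cmp i j
      ... | tri< i<j _ _ = contradiction (trans (sym (ones′ i i<j)) end) λ ()
      ... | tri≈ _ i≡j _ = i≡j
      ... | tri> _ _ j<i = contradiction (trans (sym (ones j j<i)) end′) λ ()

ωTape-laws : ExcludedMiddle 1ℓ → TapeLaws ωTape
ωTape-laws em = record
  { ≈-refl = refl ; ≈-sym = sym ; ≈-trans = trans ; ≈-dec = ℕ._≟_
  ; cell-injective = id ; cell? = λ q → yes (q , refl)
  ; succ-cong = cong suc ; cell-suc = λ _ → refl ; left-cell = λ _ → lift refl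
  ; left-unique = λ { refl (lift p) (lift q) → trans p (sym q) }
  ; left-resp = λ { refl p → p }
  }

fromℕₒ-injective : ∀ {m n} → fromℕₒ m ≈ₒ fromℕₒ n → m ≡ n
fromℕₒ-injective {zero}  {zero}  _ = refl
fromℕₒ-injective {zero}  {suc n} p = ⊥-elim (sucₒ≉zeroₒ (≈ₒ-sym {fromℕₒ zero} p))
fromℕₒ-injective {suc m} {zero}  p = ⊥-elim (sucₒ≉zeroₒ p)
fromℕₒ-injective {suc m} {suc n} p = cong suc (fromℕₒ-injective (sucₒ-injective p))

OrdTape-laws : ExcludedMiddle 1ℓ → TapeLaws OrdTape
OrdTape-laws em = record
  { ≈-refl = λ {α} → ≈ₒ-refl α ; ≈-sym = λ {α} {β} → ≈ₒ-sym {α} {β}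
  ; ≈-trans = λ {α} {β} {γ} → ≈ₒ-trans {α} {β} {γ}
  ; ≈-dec = λ _ _ → decide em
  ; cell-injective = fromℕₒ-injective ; cell? = λ _ → decide em
  ; succ-cong = sucₒ-cong ; cell-suc = λ n → ≈ₒ-refl (fromℕₒ (suc n))
  ; left-cell = λ n → predecessor (≈ₒ-refl (fromℕₒ (suc n)))
  ; left-unique = left-unique
  ; left-resp = left-resp
  }
  where
  left-unique : ∀ {q q′ r r′} → q ≈ₒ q′ → LeftOfₒ q r → LeftOfₒ q′ r′ → r ≈ₒ r′
  left-unique {q} {q′} {r} {r′} q≈q′ (predecessor p) (predecessor p′) =
    sucₒ-injective (≈ₒ-trans {sucₒ r} {q} {sucₒ r′} (≈ₒ-sym {q} p) (≈ₒ-trans {q} {q′} {sucₒ r′} q≈q′ p′))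
  left-unique {q} {q′} {r} q≈q′ (predecessor p) (toStart np′ _) =
    ⊥-elim (np′ r (≈ₒ-trans {q′} {q} {sucₒ r} (≈ₒ-sym {q} {q′} q≈q′) p))
  left-unique {q} {q′} {r} {r′} q≈q′ (toStart np _) (predecessor p′) =
    ⊥-elim (np r′ (≈ₒ-trans {q} {q′} {sucₒ r′} q≈q′ p′))
  left-unique {r = r} {r′} q≈q′ (toStart _ z) (toStart _ z′) = ≈ₒ-trans {r} {zeroₒ} {r′} z (≈ₒ-sym {r′} z′)

  left-resp : ∀ {q r r′} → r ≈ₒ r′ → LeftOfₒ q r → LeftOfₒ q r′
  left-resp {q} {r} {r′} r≈r′ (predecessor p) = predecessor (≈ₒ-trans {q} {sucₒ r} {sucₒ r′} p (sucₒ-cong r≈r′))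
  left-resp {q} {r} {r′} r≈r′ (toStart np z) = toStart np (≈ₒ-trans {r′} {r} {zeroₒ} (≈ₒ-sym {r} {r′} r≈r′) z)

module _ (em : ExcludedMiddle 1ℓ) where

  module _ where
    open TM ωTape 3
    open Config
    open TMRegular (ωTape-laws em) {3}

    ittm-regular : ∀ P w → Regular (ittm P w)
    ittm-regular = tm-regular
      (λ tails (s , h , r) (s′ , h′ , r′) → mk≐ (trans s (sym s′)) (trans h (sym h′))
        λ { t q _ refl → tails-liminf-unique _ (λ c → content c t q) (mono t q) (anti t q) tails
              (λ p q → Bool.≤-antisym q p) (r t q) (r′ t q) })
      (λ { tails (mk≐ s h r) (s′ , h′ , r′) → trans (sym s) s′ , trans (sym h) h′ , λ t q →
            subst (IsLimsup Bool._≤_ _ _) (r t q q refl)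
              (tails-liminf-resp _ (λ c → content c t q) (mono t q) (anti t q) tails (r′ t q)) })
      where
      mono : ∀ t q {c d} → c ≐ᵗ d → ∀ x → content c t q Bool.≤ x → content d t q Bool.≤ x
      mono t q c≐d x = subst (Bool._≤ x) (content≡ c≐d t q q refl)
      anti : ∀ t q {c d} → c ≐ᵗ d → ∀ x → content d t q Bool.≤ x → content c t q Bool.≤ x
      anti t q c≐d x = subst (Bool._≤ x) (sym (content≡ c≐d t q q refl))

  module _ where
    open TM OrdTape 1
    open Config
    open TMRegular (OrdTape-laws em) {1}

    otm-regular : ∀ P w → Regular (otm P w)
    otm-regular = tm-regular limit-unique limit-resp
      where
      mono : ∀ t {q r} → q ≈ₒ r → ∀ {c d} → c ≐ᵗ d → ∀ x → x Bool.≤ content c t q → x Bool.≤ content d t r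
      mono t {q} {r} q≈r c≐d x = subst (x Bool.≤_) (content≡ c≐d t q r q≈r)
      anti : ∀ t {q r} → q ≈ₒ r → ∀ {c d} → c ≐ᵗ d → ∀ x → x Bool.≤ content d t r → x Bool.≤ content c t q
      anti t {q} {r} q≈r c≐d x = subst (x Bool.≤_) (sym (content≡ c≐d t q r q≈r))
      smono : ∀ {c d} → c ≐ᵗ d → ∀ x → x ℕ.≤ state c → x ℕ.≤ state d
      smono c≐d x = subst (x ℕ.≤_) (state≡ c≐d)
      santi : ∀ {c d} → c ≐ᵗ d → ∀ x → x ℕ.≤ state d → x ℕ.≤ state c
      santi c≐d x = subst (x ℕ.≤_) (sym (state≡ c≐d))

      module _ {μ C ν D} (tails : Tails _≐ᵗ_ μ C ν D) (s : ℕ) where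
        heads-⊆ : ∀ x → Eventually μ (λ γ → state (C γ) ≡ s → x ≤ₒ head (C γ)) →
                        Eventually ν (λ γ → state (D γ) ≡ s → x ≤ₒ head (D γ))
        heads-⊆ x = eventually-follows
          {P = λ c → state c ≡ s → x ≤ₒ head c} {Q = λ c → state c ≡ s → x ≤ₒ head c} (proj₁ tails)
          λ {c} {d} c≐d p s≡ → ≤ₒ-trans {x} {head c} {head d} (p (trans (state≡ c≐d) s≡)) (proj₁ (head≈ c≐d))
        heads-⊇ : ∀ x → Eventually ν (λ γ → state (D γ) ≡ s → x ≤ₒ head (D γ)) →
                        Eventually μ (λ γ → state (C γ) ≡ s → x ≤ₒ head (C γ))
        heads-⊇ x = eventually-follows
          {P = λ c → state c ≡ s → x ≤ₒ head c} {Q = λ c → state c ≡ s → x ≤ₒ head c} (proj₂ tails)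
          λ {d} {c} c≐d p s≡ → ≤ₒ-trans {x} {head d} {head c} (p (trans (sym (state≡ c≐d)) s≡))
            (proj₂ (head≈ c≐d))

      limit-unique : ∀ {μ C c ν D d} → Tails _≐ᵗ_ μ C ν D → OTMLimit μ C c → OTMLimit ν D d → c ≐ᵗ d
      limit-unique {c = c} {d = d} tails (s , h , r) (s′ , h′ , r′)
        -- The states have to be identified first: they select the times over which the head
        -- positions are taken.
        with s≡ ← tails-liminf-unique ℕ._≤_ state smono santi tails ℕ.≤-antisym s s′ rewrite s≡ =
        mk≐ s≡ (liminf-≼ (heads-⊆ tails _) h h′ , liminf-≼ (heads-⊇ tails _) h′ h)
          λ t x y x≈y → Bool.≤-antisym
            (liminf-≼ (λ b → eventually-follows {P = λ c → ⊤ → b Bool.≤ content c t x}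
              {Q = λ c → ⊤ → b Bool.≤ content c t y}
              (proj₁ tails) λ c≐d p _ → mono t {x} {y} x≈y c≐d b (p tt)) (r t x) (r′ t y))
            (liminf-≼ (λ b → eventually-follows {P = λ c → ⊤ → b Bool.≤ content c t y}
              {Q = λ c → ⊤ → b Bool.≤ content c t x}
              (proj₂ tails) λ c≐d p _ → anti t {x} {y} x≈y c≐d b (p tt)) (r′ t y) (r t x))

      limit-resp : ∀ {μ C c ν D d} → Tails _≐ᵗ_ μ C ν D → c ≐ᵗ d → OTMLimit μ C c → OTMLimit ν D d
      limit-resp {c = c} {d = d} tails c≐d@(mk≐ s≡ (c≤d , d≤c) content≡) (s , h , r) rewrite s≡ =
        tails-liminf-resp ℕ._≤_ state smono santi tails s ,
        liminf-resp (heads-⊆ tails _) (heads-⊇ tails _)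
          (λ x p → ≤ₒ-trans {x} {head c} {head d} p c≤d) (λ x p → ≤ₒ-trans {head d} {head c} {x} d≤c p) h ,
        λ t q → subst (IsLiminf Bool._≤_ _ _) (content≡ t q q (≈ₒ-refl q))
          (tails-liminf-resp _ (λ c → content c t q) (mono t {q} {q} (≈ₒ-refl q))
            (anti t {q} {q} (≈ₒ-refl q)) tails (r t q))

-- Counter programs

infixr 5 _⨾_

-- A common source language for all three machines. The only test is for zero, and `drain` lowers
-- its counter before each round. A derivation of `_⊢_⇓_` is a terminating run, so termination needs
-- no separate argument.
data Cmd : Set where
  skip  : Cmd
  inc   : Fin 7 → Cmd
  _⨾_   : Cmd → Cmd → Cmd
  drain : Fin 7 → Cmd → Cmd

Counters : Set
Counters = Vec ℕ 7

infix 4 _⊢_⇓_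

data _⊢_⇓_ : Cmd → Counters → Counters → Set where
  skip⇓ : ∀ {σ} → skip ⊢ σ ⇓ σ
  inc⇓  : ∀ {r σ} → inc r ⊢ σ ⇓ (σ [ r ]%= suc)
  _⨾⇓_  : ∀ {c d σ τ υ} → c ⊢ σ ⇓ τ → d ⊢ τ ⇓ υ → c ⨾ d ⊢ σ ⇓ υ
  done⇓ : ∀ {r c σ} → lookup σ r ≡ 0 → drain r c ⊢ σ ⇓ σ
  next⇓ : ∀ {r c σ τ υ m} → lookup σ r ≡ suc m → c ⊢ σ [ r ]≔ m ⇓ τ → drain r c ⊢ τ ⇓ υ →
          drain r c ⊢ σ ⇓ υ

infixr 5 _⨾⇓_

times : ℕ → Cmd → Cmd
times zero    c = skip
times (suc n) c = c ⨾ times n c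

-- `e#` carries the code being built, `t#` is scratch for doubling it, and `j#` holds the number on
-- which the emitted tokens depend. The others hold inputs, loop counts and copies.
private
  pattern a# = 0F
  pattern b# = 1F
  pattern j# = 2F
  pattern e# = 3F
  pattern t# = 4F
  pattern p# = 5F
  pattern r# = 6F

-- For `k` equal to 1 or 2 this appends a lowest digit to a bijective binary numeral. With `k = 0`
-- it serves for multiplication by powers of 2.
double+ : ℕ → Cmd
double+ k = drain e# (inc t# ⨾ inc t#) ⨾ times k (inc t#) ⨾ drain t# (inc e#)

module _ {a b j p r : ℕ} where

  double+⇓ : ∀ k e {u} → k + 2 * e ≡ u →
             double+ k ⊢ a ∷ b ∷ j ∷ e ∷ 0 ∷ p ∷ r ∷ [] ⇓ a ∷ b ∷ j ∷ u ∷ 0 ∷ p ∷ r ∷ []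
  double+⇓ k e {u} eq = forth e 0 refl ⨾⇓ more k (2 * e + 0) eq′ ⨾⇓ back u 0 (ℕ.+-identityʳ u)
    where
    eq′ : k + (2 * e + 0) ≡ u
    eq′ = trans (cong (k +_) (ℕ.+-identityʳ (2 * e))) eq
    forth : ∀ e t {u} → 2 * e + t ≡ u → drain e# (inc t# ⨾ inc t#) ⊢
            a ∷ b ∷ j ∷ e ∷ t ∷ p ∷ r ∷ [] ⇓ a ∷ b ∷ j ∷ 0 ∷ u ∷ p ∷ r ∷ []
    forth zero    t refl = done⇓ refl
    forth (suc e) t refl = next⇓ refl (inc⇓ ⨾⇓ inc⇓) (forth e (2 + t) (lemma e t))
      where
      lemma : ∀ e t → 2 * e + (2 + t) ≡ 2 * suc e + t
      lemma = solve-∀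
    more : ∀ k t {u} → k + t ≡ u → times k (inc t#) ⊢
           a ∷ b ∷ j ∷ 0 ∷ t ∷ p ∷ r ∷ [] ⇓ a ∷ b ∷ j ∷ 0 ∷ u ∷ p ∷ r ∷ []
    more zero    t refl = skip⇓
    more (suc k) t eq   = inc⇓ ⨾⇓ more k (suc t) (trans (ℕ.+-suc k t) eq)
    back : ∀ t e {u} → t + e ≡ u → drain t# (inc e#) ⊢
           a ∷ b ∷ j ∷ e ∷ t ∷ p ∷ r ∷ [] ⇓ a ∷ b ∷ j ∷ u ∷ 0 ∷ p ∷ r ∷ []
    back zero    e refl = done⇓ refl
    back (suc t) e eq   = next⇓ refl inc⇓ (back t (suc e) (trans (ℕ.+-suc t e) eq))

-- Codes with tokens put in front

opaque
  -- The new token lies below all digits of `e`: its terminating digit 1, and under it `a` digits 2.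
  -- Values grow exponentially with the tokens, so only the two equations are exposed.
  emit : ℕ → ℕ → ℕ
  emit zero    e = suc (2 * e)
  emit (suc a) e = 2 * suc (emit a e)

  emit-zero : ∀ e → emit 0 e ≡ suc (2 * e)
  emit-zero e = refl

  emit-suc : ∀ a e → emit (suc a) e ≡ 2 * suc (emit a e)
  emit-suc a e = refl

tokensℕ : ℕ → List ℕ
tokensℕ e = tokens (ℕᵇ.fromℕ e)

fromℕ-odd : ∀ n → ℕᵇ.fromℕ (suc (2 * n)) ≡ 1+[2 ℕᵇ.fromℕ n ]
fromℕ-odd n = trans (cong (λ m → ℕᵇ.fromℕ (suc (2 * m))) (sym (toℕ-fromℕ n))) (fromℕ-toℕ 1+[2 ℕᵇ.fromℕ n ])

fromℕ-even : ∀ n → ℕᵇ.fromℕ (2 * suc n) ≡ 2[1+ ℕᵇ.fromℕ n ]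
fromℕ-even n = trans (cong (λ m → ℕᵇ.fromℕ (2 * suc m)) (sym (toℕ-fromℕ n))) (fromℕ-toℕ 2[1+ ℕᵇ.fromℕ n ])

tokens-emit : ∀ a e → tokensℕ (emit a e) ≡ a ∷ tokensℕ e
tokens-emit zero    e = trans (cong tokensℕ (emit-zero e)) (cong tokens (fromℕ-odd e))
tokens-emit (suc a) e = trans (cong tokensℕ (emit-suc a e))
  (trans (cong tokens (fromℕ-even (emit a e))) (tokens-2 (ℕᵇ.fromℕ (emit a e)) (tokens-emit a e)))
  where
  tokens-2 : ∀ b {a as} → tokens b ≡ a ∷ as → tokens 2[1+ b ] ≡ suc a ∷ as
  tokens-2 b eq rewrite eq = refl

emits : List ℕ → ℕ → ℕ
emits as e = foldr emit e as

tokens-emits : ∀ as e → tokensℕ (emits as e) ≡ as ++ tokensℕ e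
tokens-emits []       e = refl
tokens-emits (a ∷ as) e = trans (tokens-emit a (emits as e)) (cong (a ∷_) (tokens-emits as e))

-- The tokens to be produced depend linearly on a number j which is known only at
-- run time.

Linear : Set
Linear = ℕ × ℕ

⟦_⟧ : Linear → ℕ → ℕ
⟦ m , c ⟧ j = m * j + c

⟦_⟧* : List Linear → ℕ → List ℕ
⟦ ls ⟧* j = List.map (λ l → ⟦ l ⟧ j) ls

-- The digit 1 that ends a token is its most significant one and is written first; then each
-- `double+ 2` raises the token by one. Every pass over `j#` saves it in `a#` and restores it.
emitᶜ : Linear → Cmd
emitᶜ (m , c) = double+ 1 ⨾
  times m (drain j# (inc a# ⨾ double+ 2) ⨾ drain a# (inc j#)) ⨾ times c (double+ 2)

emitsᶜ : List Linear → Cmd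
emitsᶜ []       = skip
-- The last token is produced first, because each new one is put in front.
emitsᶜ (l ∷ ls) = emitsᶜ ls ⨾ emitᶜ l

module _ {b p r : ℕ} where

  private
    state : ℕ → ℕ → ℕ → Counters
    state a j e = a ∷ b ∷ j ∷ e ∷ 0 ∷ p ∷ r ∷ []

  emitᶜ⇓ : ∀ l j e → emitᶜ l ⊢ state 0 j e ⇓ state 0 j (emit (⟦ l ⟧ j) e)
  emitᶜ⇓ (m , c) j e = double+⇓ 1 e (sym (emit-zero e)) ⨾⇓ multiples m 0 (ℕ.+-identityʳ (m * j)) ⨾⇓
    constant c (m * j) (ℕ.+-comm c (m * j))
    where
    twice : ∀ k → 2 + 2 * emit k e ≡ emit (suc k) e
    twice k = trans (lemma (emit k e)) (sym (emit-suc k e))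
      where
      lemma : ∀ n → 2 + 2 * n ≡ 2 * suc n
      lemma = solve-∀
    constant : ∀ c k {l} → c + k ≡ l → times c (double+ 2) ⊢
               state 0 j (emit k e) ⇓ state 0 j (emit l e)
    constant zero    k refl = skip⇓
    constant (suc c) k eq   = double+⇓ 2 (emit k e) (twice k) ⨾⇓ constant c (suc k) (trans (ℕ.+-suc c k) eq)
    forth : ∀ i a k {l} → i + k ≡ l → i + a ≡ j → drain j# (inc a# ⨾ double+ 2) ⊢
            state a i (emit k e) ⇓ state j 0 (emit l e)
    forth zero    a k refl refl = done⇓ refl
    forth (suc i) a k eq   eq′  = next⇓ refl (inc⇓ ⨾⇓ double+⇓ 2 (emit k e) (twice k))
      (forth i (suc a) (suc k) (trans (ℕ.+-suc i k) eq) (trans (ℕ.+-suc i a) eq′))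
    back : ∀ a i {u} → a + i ≡ j → drain a# (inc j#) ⊢ state a i u ⇓ state 0 j u
    back zero    i refl = done⇓ refl
    back (suc a) i eq   = next⇓ refl inc⇓ (back a (suc i) (trans (ℕ.+-suc a i) eq))
    multiples : ∀ m k {l} → m * j + k ≡ l →
      times m (drain j# (inc a# ⨾ double+ 2) ⨾ drain a# (inc j#)) ⊢
      state 0 j (emit k e) ⇓ state 0 j (emit l e)
    multiples zero    k refl = skip⇓
    multiples (suc m) k eq   = (forth j 0 k refl (ℕ.+-identityʳ j) ⨾⇓ back j 0 (ℕ.+-identityʳ j)) ⨾⇓
      multiples m (j + k) (trans (lemma m j k) eq)
      where
      lemma : ∀ m j k → m * j + (j + k) ≡ suc m * j + k
      lemma = solve-∀

  emitsᶜ⇓ : ∀ ls j e → emitsᶜ ls ⊢ state 0 j e ⇓ state 0 j (emits (⟦ ls ⟧* j) e)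
  emitsᶜ⇓ []       j e = skip⇓
  emitsᶜ⇓ (l ∷ ls) j e = emitsᶜ⇓ ls j e ⨾⇓ emitᶜ⇓ l j _

-- Finite runs

module _ {ℓ} {M : System ℓ} (R : Regular M) where
  open System M
  open Regular R

  -- Stated backwards, as a transformation of halting runs: finite runs then compose as functions,
  -- and `prepend-step` remains the only place that deals with ordinals.
  Reaches : Config → Config → Set (lsuc 0ℓ ⊔ ℓ)
  Reaches c d = ∀ {j} → HaltsWith (restart M λ e → Lift (1ℓ ⊔ ℓ) (d ~ e)) j →
                        HaltsWith (restart M λ e → Lift (1ℓ ⊔ ℓ) (c ~ e)) j

  weaken-initial : ∀ {I I′ : Config → Set (1ℓ ⊔ ℓ)} → (∀ {c} → I c → I′ c) →
                   ∀ {j} → HaltsWith (restart M I) j → HaltsWith (restart M I′) j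
  weaken-initial I⇒I′ (α , C , comp , halts) = α , C , record
    { initial   = λ β β≤α β≈0 → I⇒I′ (initial β β≤α β≈0)
    ; successor = successor
    ; limit     = limit
    } , halts
    where
    open IsComputation comp

  reaches-~ : ∀ {c d} → c ~ d → Reaches c d
  reaches-~ c~d = weaken-initial λ (lift d~e) → lift (~-trans c~d d~e)

module _ {I : Set} where

  At : (ℕ → I → Set) → ℕ → List I → Set
  At F l []       = ⊤
  At F l (i ∷ is) = F l i × At F (suc l) is

  -- Equal to `length is + l`, but computed by raising `l` so as to match the line numbers of `At`
  -- definitionally.
  advance : List I → ℕ → ℕ
  advance []       l = l
  advance (_ ∷ is) l = advance is (suc l)

  advance-++ : ∀ is js l → advance (is ++ js) l ≡ advance js (advance is l)
  advance-++ []       js l = refl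
  advance-++ (_ ∷ is) js l = advance-++ is js (suc l)

  advance-length : ∀ (is : List I) l → advance is l ≡ length is + l
  advance-length []       l = refl
  advance-length (_ ∷ is) l = trans (advance-length is (suc l)) (ℕ.+-suc (length is) l)

  at-++ : ∀ {F} is {js l} → At F l (is ++ js) → At F l is × At F (advance is l) js
  at-++ []       at       = tt , at
  at-++ (_ ∷ is) (x , at) = let y , at′ = at-++ is at in (x , y) , at′

-- Register 0 contains 0 and the registers 1 and 2 are used for decrementing,
-- which takes a loop counting up to the predecessor.

private
  pattern ρ r = suc (suc (suc r))

lineAfter : Cmd → ℕ → ℕ
lineAfter skip        l = l
lineAfter (inc r)     l = suc l
lineAfter (c ⨾ d)     l = lineAfter d (lineAfter c l)
lineAfter (drain r c) l = suc (lineAfter c (8 + l))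

itrmCode : Cmd → ℕ → List ITRMInstr
itrmCode skip        l = []
itrmCode (inc r)     l = S (ρ (toℕ r)) ∷ []
itrmCode (c ⨾ d)     l = itrmCode c l ++ itrmCode d (lineAfter c l)
itrmCode (drain r c) l =
  J (ρ (toℕ r)) 0 (lineAfter (drain r c) l) ∷
  -- Register 2 is the successor of register 1, which counts up from 0 until register 2 equals the
  -- counter; then register 1 is the predecessor.
  Z 1 ∷ T 1 2 ∷ S 2 ∷ J 2 (ρ (toℕ r)) (7 + l) ∷ S 1 ∷ J 1 1 (2 + l) ∷ T 1 (ρ (toℕ r)) ∷
  itrmCode c (8 + l) ++ J 0 0 l ∷ []

advance-itrmCode : ∀ c l → advance (itrmCode c l) l ≡ lineAfter c l
advance-itrmCode skip        l = refl
advance-itrmCode (inc r)     l = refl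
advance-itrmCode (c ⨾ d)     l = trans (advance-++ (itrmCode c l) _ l)
  (trans (cong (advance (itrmCode d (lineAfter c l))) (advance-itrmCode c l))
    (advance-itrmCode d (lineAfter c l)))
advance-itrmCode (drain r c) l = trans (advance-++ (itrmCode c (8 + l)) _ (8 + l))
  (cong suc (advance-itrmCode c (8 + l)))

-- Registers 3 to 9 are the counters, register 10 will tell two passes through a program apart, and
-- 1 and 2 are left open. The registers from 11 on are recorded to be 0, because `P` will later be
-- started in this store.
record Holds (f : ℕ) (σ : Counters) (r : ℕ → ℕ) : Set where
  field
    zero≡    : r 0 ≡ 0
    counter≡ : ∀ i → r (ρ (toℕ i)) ≡ lookup σ i
    flag≡    : r 10 ≡ f
    unused   : ∀ n → r (11 + n) ≡ 0
open Holds

≡ᵇ-refl : ∀ n → (n ℕ.≡ᵇ n) ≡ true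
≡ᵇ-refl zero    = refl
≡ᵇ-refl (suc n) = ≡ᵇ-refl n

≢⇒≡ᵇ : ∀ {m n} → m ≢ n → (m ℕ.≡ᵇ n) ≡ false
≢⇒≡ᵇ {m} {n} m≢n with m ℕ.≡ᵇ n in eq
... | false = refl
... | true  = contradiction (ℕ.≡ᵇ⇒≡ m n (subst Bool.T (sym eq) tt)) m≢n

[≔]-hit : ∀ (r : ℕ → ℕ) n {v} → (r [ n ≔ v ]) n ≡ v
[≔]-hit r n rewrite ≡ᵇ-refl n = refl

[≔]-miss : ∀ (r : ℕ → ℕ) {n m v} → m ≢ n → (r [ n ≔ v ]) m ≡ r m
[≔]-miss r m≢n rewrite ≢⇒≡ᵇ m≢n = refl

holds-scratch₁ : ∀ {f σ r v} → Holds f σ r → Holds f σ (r [ 1 ≔ v ])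
holds-scratch₁ h = record { zero≡ = zero≡ h ; counter≡ = counter≡ h ; flag≡ = flag≡ h ; unused = unused h }

holds-scratch₂ : ∀ {f σ r v} → Holds f σ r → Holds f σ (r [ 2 ≔ v ])
holds-scratch₂ h = record { zero≡ = zero≡ h ; counter≡ = counter≡ h ; flag≡ = flag≡ h ; unused = unused h }

holds-update : ∀ {f σ r} i {g v} → v ≡ g (lookup σ i) → Holds f σ r →
               Holds f (σ [ i ]%= g) (r [ ρ (toℕ i) ≔ v ])
holds-update {f} {σ} {r} i {g} {v} eq h = record
  { zero≡    = zero≡ h
  ; counter≡ = counter
  ; flag≡    = trans ([≔]-miss r (ℕ.>⇒≢ (ℕ.+-monoʳ-< 3 (Fin.toℕ<n i)))) (flag≡ h)
  ; unused   = λ n → trans ([≔]-miss r (ℕ.>⇒≢ (ℕ.+-monoʳ-< 3 (ℕ.<-≤-trans (Fin.toℕ<n i) (ℕ.m≤m+n 7 (suc n))))))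
                           (unused h n)
  }
  where
  counter : ∀ k → (r [ ρ (toℕ i) ≔ v ]) (ρ (toℕ k)) ≡ lookup (σ [ i ]%= g) k
  counter k with k Fin.≟ i
  ... | yes refl = trans ([≔]-hit r (ρ (toℕ i))) (trans eq (sym (Vec.lookup∘updateAt i σ)))
  ... | no  k≢i  = trans ([≔]-miss r λ p → k≢i (Fin.toℕ-injective
    (ℕ.suc-injective (ℕ.suc-injective (ℕ.suc-injective p)))))
                         (trans (counter≡ h k) (sym (Vec.lookup∘updateAt′ k i k≢i σ)))

module _ (em : ExcludedMiddle 1ℓ) (P : List ITRMInstr) (w : Real) where

  infix 4 _↠_
  _↠_ : ITRMConfig → ITRMConfig → Set₁
  _↠_ = Reaches (itrm-regular P w)

  Fetch : ℕ → ITRMInstr → Set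
  Fetch l i = fetch P l ≡ just i

  ↠-step : ∀ {l r i} → Fetch l i → ⟨ l , r ⟩ ↠ execute w i ⟨ l , r ⟩
  ↠-step {i = i} eq = prepend-step em (itrm-regular P w) (refl , λ _ → refl)
    (lift (i , eq , refl , λ _ → refl))

  ↠-jump : ∀ {l r m n q} → Fetch l (J m n q) → r m ≡ r n → ⟨ l , r ⟩ ↠ ⟨ q , r ⟩
  ↠-jump {l} {r} {m} {n} {q} eq rm≡rn = subst (⟨ l , r ⟩ ↠_) landed (↠-step {r = r} eq)
    where
    landed : execute w (J m n q) ⟨ l , r ⟩ ≡ ⟨ q , r ⟩
    landed rewrite rm≡rn | ≡ᵇ-refl (r n) = refl

  ↠-stay : ∀ {l r m n q} → Fetch l (J m n q) → r m ≢ r n → ⟨ l , r ⟩ ↠ ⟨ suc l , r ⟩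
  ↠-stay {l} {r} {m} {n} {q} eq rm≢rn = subst (⟨ l , r ⟩ ↠_) landed (↠-step {r = r} eq)
    where
    landed : execute w (J m n q) ⟨ l , r ⟩ ≡ ⟨ suc l , r ⟩
    landed rewrite ≢⇒≡ᵇ rm≢rn = refl

  infix 4 _at_⇝_at_[_]
  _at_⇝_at_[_] : Counters → ℕ → Counters → ℕ → ℕ → Set₁
  σ at l ⇝ τ at l′ [ f ] = ∀ {r} → Holds f σ r → ∃[ r′ ] Holds f τ r′ × (⟨ l , r ⟩ ↠ ⟨ l′ , r′ ⟩)

  ⇝-trans : ∀ {σ l τ l′ υ l″ f} → σ at l ⇝ τ at l′ [ f ] → τ at l′ ⇝ υ at l″ [ f ] → σ at l ⇝ υ at l″ [ f ]
  ⇝-trans p q h = let r′ , h′ , s = p h ; r″ , h″ , s′ = q h′ in r″ , h″ , λ x → s (s′ x)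

  decrement : ∀ {σ i m l f} → lookup σ i ≡ suc m →
    At Fetch (suc l) (Z 1 ∷ T 1 2 ∷ S 2 ∷ J 2 (ρ (toℕ i)) (7 + l) ∷ S 1 ∷ J 1 1 (2 + l) ∷ T 1
      (ρ (toℕ i)) ∷ []) →
    σ at suc l ⇝ σ [ i ]≔ m at 8 + l [ f ]
  decrement {σ} {i} {m} {l} {f} eq (at₁ , at₂ , at₃ , at₄ , at₅ , at₆ , at₇ , _) {r₀} h₀ =
    let r′ , h′ , s = loop m 0 (ℕ.+-identityʳ m) (holds-scratch₁ h₀) refl in r′ , h′ , λ x → ↠-step
          {r = r₀} at₁ (s x)
    where
    -- Register 1 contains `x`, and `y` more rounds lead to the predecessor `m`.
    loop : ∀ y x {r} → y + x ≡ m → Holds f σ r → r 1 ≡ x →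
           ∃[ r′ ] Holds f (σ [ i ]≔ m) r′ × (⟨ 2 + l , r ⟩ ↠ ⟨ 8 + l , r′ ⟩)
    loop zero x {r} refl h r1 =
      _ , holds-update i {g = const x} r1 (holds-scratch₂ (holds-scratch₂ h)) , λ z →
      ↠-step {r = r} at₂ (↠-step {r = r [ 2 ≔ r 1 ]} at₃ (↠-jump {r = r [ 2 ≔ r 1 ] [ 2 ≔ suc (r 1) ]} at₄
        (trans (cong suc r1) (sym (trans (counter≡ h i) eq)))
        (↠-step {r = r [ 2 ≔ r 1 ] [ 2 ≔ suc (r 1) ]} at₇ z)))
    loop (suc y) x {r} y+x h r1 =
      let r′ , h′ , s = loop y (suc x) (trans (ℕ.+-suc y x) y+x)
            (holds-scratch₁ {v = suc (r 1)} (holds-scratch₂ {v = suc (r 1)} (holds-scratch₂ {v = r 1} h)))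
              (cong suc r1)
      in r′ , h′ , λ z →
      ↠-step {r = r} at₂ (↠-step {r = r [ 2 ≔ r 1 ]} at₃ (↠-stay {r = r [ 2 ≔ r 1 ] [ 2 ≔ suc (r 1) ]} at₄
        (λ p → ℕ.<⇒≢ (ℕ.≤-trans (ℕ.m≤n+m (suc x) y) (ℕ.≤-reflexive (trans (ℕ.+-suc y x) y+x)))
          (ℕ.suc-injective (trans (sym (cong suc r1)) (trans p (trans (counter≡ h i) eq)))))
        (↠-step {r = r [ 2 ≔ r 1 ] [ 2 ≔ suc (r 1) ]} at₅
          (↠-jump {r = r [ 2 ≔ r 1 ] [ 2 ≔ suc (r 1) ] [ 1 ≔ suc (r 1) ]} at₆ refl (s z)))))

  itrm-correct : ∀ {c σ τ l f} → c ⊢ σ ⇓ τ → At Fetch l (itrmCode c l) → σ at l ⇝ τ at lineAfter c l [ f ]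
  itrm-correct skip⇓ at h = _ , h , λ x → x
  itrm-correct {inc i} inc⇓ (at , _) {r} h =
    _ , holds-update i (cong suc (counter≡ h i)) h , ↠-step {r = r} at
  itrm-correct {c ⨾ d} {l = l} {f} (p ⨾⇓ q) at with atᶜ , atᵈ ← at-++ (itrmCode c l) at
    rewrite advance-itrmCode c l =
    ⇝-trans {f = f} (itrm-correct p atᶜ) (itrm-correct q atᵈ)
  itrm-correct {drain i c} (done⇓ eq) (at , _) {r} h =
    r , h , ↠-jump {r = r} at (trans (counter≡ h i) (trans eq (sym (zero≡ h))))
  itrm-correct {drain i c} {σ} {l = l} {f} (next⇓ {τ = τ} {m = m} eq p q)
    whole@(at , at₁ , at₂ , at₃ , at₄ , at₅ , at₆ , at₇ , at′) {r} h
    with atᶜ , atᵉ , _ ← at-++ (itrmCode c (8 + l)) at′ rewrite advance-itrmCode c (8 + l) =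
    let r₁ , h₁ , s₁ = decrement {f = f} eq (at₁ , at₂ , at₃ , at₄ , at₅ , at₆ , at₇ , tt) h
        r₂ , h₂ , s₂ = itrm-correct {f = f} p atᶜ h₁
        r₃ , h₃ , s₃ = itrm-correct {f = f} q whole h₂
    in r₃ , h₃ , λ x → ↠-stay {r = r} at
         (λ p → ℕ.1+n≢0 (trans (sym (trans (counter≡ h i) eq)) (trans p (zero≡ h))))
         (s₁ (s₂ (↠-jump {r = r₂} atᵉ refl (s₃ x))))

module _ {ℓ} {M : System ℓ} {I : System.Config M → Set (1ℓ ⊔ ℓ)} where
  open System M

  halted-now : ∀ {c j} → I c → Halted c → Output c j → HaltsWith (restart M I) j
  halted-now {c} init halted out = zeroₒ , const c , record
    { initial   = λ _ _ _ → init
    ; successor = λ β γ γ≤0 γ≈sβ → ⊥-elim (≮ₒzeroₒ β (<-≤-transₒ {β} {γ} {zeroₒ} (proj₂ γ≈sβ tt) γ≤0))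
    ; limit     = λ μ μ≤0 (0<μ , _) → ⊥-elim (≮ₒzeroₒ zeroₒ (<-≤-transₒ {zeroₒ} {μ} {zeroₒ} 0<μ μ≤0))
    } , halted , out

module _ (em : ExcludedMiddle 1ℓ) where

  -- If `suc v` were not an eventual lower bound, all of them would be at most `v`, against the
  -- leastness of `suc v`. At 0 only the positivity of `μ` is needed.
  liminf-attained : ∀ {μ f v} → IsLimit μ → IsLiminf ℕ._≤_ μ f v → Eventually μ λ γ → ⊤ → v ℕ.≤ f γ
  liminf-attained {v = zero} (0<μ , _) _ = zeroₒ , 0<μ , λ _ _ _ _ → ℕ.z≤n
  liminf-attained {μ} {f} {suc v} _ (_ , least) with em {Eventually μ λ γ → ⊤ → suc v ℕ.≤ f γ}
  ... | yes p = p
  ... | no ¬p = contradiction (least v bounded) (ℕ.<-irrefl refl)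
    where
    bounded : ∀ b → Eventually μ (λ γ → ⊤ → b ℕ.≤ f γ) → b ℕ.≤ v
    bounded b (β , β<μ , b≤f) with b ℕ.≤? v
    ... | yes b≤v = b≤v
    ... | no  b≰v = contradiction (β , β<μ , λ γ β≤γ γ<μ _ → ℕ.≤-trans (ℕ.≰⇒> b≰v) (b≤f γ β≤γ γ<μ tt)) ¬p

  -- ψ is the lower adjoint of φ.

  module _ (φ ψ : ℕ → ℕ) (φ-mono : ∀ {m n} → m ℕ.≤ n → φ m ℕ.≤ φ n)
           (to : ∀ {m n} → m ℕ.≤ φ n → ψ m ℕ.≤ n) (from : ∀ {m n} → ψ m ℕ.≤ n → m ℕ.≤ φ n) where

    -- Lower bounds of `φ ∘ f` are pulled back along `ψ`; conversely, the limit `v` is attained as a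
    -- lower bound and can be pushed forward along `φ`. This will be applied to shifted line numbers
    -- and to renamed states.
    liminf-map : ∀ {μ f v} → IsLimit μ → IsLiminf ℕ._≤_ μ f v → IsLiminf ℕ._≤_ μ (φ ∘ f) (φ v)
    liminf-map lim l@(upper , _) =
      (λ { b (β , β<μ , bound) → from (upper (ψ b) (β , β<μ , λ γ p q _ → to (bound γ p q tt))) }) ,
      (λ u bounded → let β , β<μ , bound = liminf-attained lim l in
        bounded _ (β , β<μ , λ γ p q _ → φ-mono (bound γ p q tt)))

-- The gate for register machines

shift : ℕ → ITRMInstr → ITRMInstr
shift p (Z n)     = Z n
shift p (S n)     = S n
shift p (O n)     = O n
shift p (T m n)   = T m n
shift p (J m n q) = J m n (p + q)

open ITRMConfig

fetch-++ : ∀ is js k → fetch (is ++ js) (length is + k) ≡ fetch js k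
fetch-++ []       js k = refl
fetch-++ (_ ∷ is) js k = fetch-++ is js k

fetch-map : ∀ f is k → fetch (List.map f is) k ≡ Maybe.map f (fetch is k)
fetch-map f []       zero    = refl
fetch-map f []       (suc k) = refl
fetch-map f (i ∷ is) zero    = refl
fetch-map f (i ∷ is) (suc k) = fetch-map f is k

fetch-end : ∀ (is : List ITRMInstr) → fetch is (length is) ≡ nothing
fetch-end []       = refl
fetch-end (i ∷ is) = fetch-end is

at-suc : ∀ {I : Set} {F : ℕ → I → Set} is {l} → At (F ∘ suc) l is → At F (suc l) is
at-suc []       _        = tt
at-suc (i ∷ is) (x , at) = x , at-suc is at

at-self : ∀ is → At (λ l i → fetch is l ≡ just i) 0 is
at-self []       = tt
at-self (i ∷ is) = refl , at-suc is (at-self is)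

module _ (em : ExcludedMiddle 1ℓ) {Q : List ITRMInstr} {p : ℕ} {P : List ITRMInstr}
         (located : ∀ k → fetch Q (p + k) ≡ fetch (List.map (shift p) P) k) (w : Real) where

  relocate : ITRMConfig → ITRMConfig
  relocate ⟨ l , r ⟩ = ⟨ p + l , r ⟩

  execute-shift : ∀ i c → execute w (shift p i) (relocate c) ≐ relocate (execute w i c)
  execute-shift (Z n)   ⟨ l , r ⟩ = sym (ℕ.+-suc p l) , λ _ → refl
  execute-shift (S n)   ⟨ l , r ⟩ = sym (ℕ.+-suc p l) , λ _ → refl
  execute-shift (O n)   ⟨ l , r ⟩ = sym (ℕ.+-suc p l) , λ _ → refl
  execute-shift (T m n) ⟨ l , r ⟩ = sym (ℕ.+-suc p l) , λ _ → refl
  execute-shift (J m n q) ⟨ l , r ⟩ with r m ℕ.≡ᵇ r n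
  ... | true  = refl , λ _ → refl
  ... | false = sym (ℕ.+-suc p l) , λ _ → refl

  -- `located` also covers the lines beyond the end of `P`, on which `P` halts and the relocated
  -- copy has to halt as well. Therefore `P` has to come last in `Q`.
  itrm-relocate : ∀ {r j} → (∀ n → r n ≡ 0) → HaltsWith (itrm P w) j →
    HaltsWith (restart (itrm Q w) λ e → Lift 1ℓ (⟨ p , r ⟩ ≐ e)) j
  itrm-relocate {r} r≡0 = simulation {M = itrm P w} {N = itrm Q w} relocate
    (λ { {⟨ _ , r′ ⟩} (lift (refl , r′≡0)) → lift (sym (ℕ.+-identityʳ p) , λ n → trans (r≡0 n)
      (sym (r′≡0 n))) })
    (λ { {c} (lift (i , eq , l≡ , r≡)) → lift (shift p i ,
        trans (located (line c)) (trans (fetch-map (shift p) P (line c)) (cong (Maybe.map (shift p)) eq)) ,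
        trans (cong (p +_) l≡) (sym (line≡ (execute-shift i c))) ,
        λ n → trans (r≡ n) (sym (reg≗ (execute-shift i c) n))) })
    (λ lim (l , rs) → liminf-map em (p +_) (_∸ p) (ℕ.+-monoʳ-≤ p)
        (λ {m} {n} → ℕ.m≤n+o⇒m∸n≤o m p) (λ {m} {n} le → ℕ.≤-trans (ℕ.m≤n+m∸n m p) (ℕ.+-monoʳ-≤ p le)) lim
          l , rs)
    (λ { {c} (lift stop) → lift (trans (located (line c))
        (trans (fetch-map (shift p) P (line c)) (cong (Maybe.map (shift p)) stop))) })
    (λ {c} {j} out → out)

affine-∘ : ∀ x y e m n → x * (y * e + m) + n ≡ x * y * e + (x * m + n)
affine-∘ = solve-∀

emit-affine : ∀ a → ∃[ l ] ∃[ n ] ∀ e → emit a e ≡ 2 ^ l * e + n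
emit-affine zero    = 1 , 1 , λ e → trans (emit-zero e) (ℕ.+-comm 1 (2 * e))
emit-affine (suc a) = let l , n , eq = emit-affine a in
  suc l , 2 * n + 2 , λ e → trans (emit-suc a e) (trans (cong (λ x → 2 * suc x) (eq e)) (lemma (2 ^ l) e n))
  where
  lemma : ∀ x e n → 2 * suc (x * e + n) ≡ 2 * x * e + (2 * n + 2)
  lemma = solve-∀

-- Putting a fixed list of instructions in front of a program is described by two numbers. With
-- these a program can account for its own first part without containing its token list.
emits-affine : ∀ as → ∃[ l ] ∃[ n ] ∀ e → emits as e ≡ 2 ^ l * e + n
emits-affine []       = 0 , 0 , λ e → lemma e
  where
  lemma : ∀ e → e ≡ 1 * e + 0
  lemma = solve-∀
emits-affine (a ∷ as) =
  let l , n , eq = emit-affine a ; l′ , n′ , eq′ = emits-affine as in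
  l + l′ , 2 ^ l * n′ + n , λ e → trans (eq (emits as e)) (trans (cong (λ x → 2 ^ l * x + n) (eq′ e))
    (trans (affine-∘ (2 ^ l) (2 ^ l′) e n′ n) (cong (λ x → x * e + (2 ^ l * n′ + n))
      (sym (ℕ.^-distribˡ-+-* 2 l l′)))))

itrmTokens : ITRMInstr → List ℕ
itrmTokens (Z n)     = 0 ∷ n ∷ []
itrmTokens (S n)     = 1 ∷ n ∷ []
itrmTokens (O n)     = 2 ∷ n ∷ []
itrmTokens (T m n)   = 3 ∷ m ∷ n ∷ []
itrmTokens (J m n q) = 4 ∷ m ∷ n ∷ q ∷ []

parse-itrmTokens : ∀ is ts → parseITRM (concatMap itrmTokens is ++ ts) ≡ is ++ parseITRM ts
parse-itrmTokens []             ts = refl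
parse-itrmTokens (Z n ∷ is)     ts = cong (_ ∷_) (parse-itrmTokens is ts)
parse-itrmTokens (S n ∷ is)     ts = cong (_ ∷_) (parse-itrmTokens is ts)
parse-itrmTokens (O n ∷ is)     ts = cong (_ ∷_) (parse-itrmTokens is ts)
parse-itrmTokens (T m n ∷ is)   ts = cong (_ ∷_) (parse-itrmTokens is ts)
parse-itrmTokens (J m n q ∷ is) ts = cong (_ ∷_) (parse-itrmTokens is ts)

program-emits : ∀ is e → program ITRM (emits (concatMap itrmTokens is) e) ≡ is ++ program ITRM e
program-emits is e = trans (cong parseITRM (tokens-emits (concatMap itrmTokens is) e))
  (parse-itrmTokens is (tokensℕ e))

constants : List ℕ → List Linear
constants = List.map (0 ,_)

-- 13 is the length of query.

shiftedTokens : ITRMInstr → List Linear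
shiftedTokens (J m n q) = (0 , 4) ∷ (0 , m) ∷ (0 , n) ∷ (1 , 13 + q) ∷ []
shiftedTokens i         = constants (itrmTokens i)

shiftedTokens-value : ∀ j i → ⟦ shiftedTokens i ⟧* j ≡ itrmTokens (shift (13 + j) i)
shiftedTokens-value j (Z n)     = refl
shiftedTokens-value j (S n)     = refl
shiftedTokens-value j (O n)     = refl
shiftedTokens-value j (T m n)   = refl
shiftedTokens-value j (J m n q) = cong (λ l → 4 ∷ m ∷ n ∷ l ∷ []) (lemma j q)
  where
  lemma : ∀ j q → 1 * j + (13 + q) ≡ 13 + j + q
  lemma j q = trans (cong (_+ (13 + q)) (ℕ.*-identityˡ j))
    (trans (sym (ℕ.+-assoc j 13 q)) (cong (_+ q) (ℕ.+-comm j 13)))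

module ITRMGate (P : List ITRMInstr) where

  -- The query is reached twice. At first register 10 is 0; after the computation
  -- of the code e it is 1 and register 6 contains 2e.

  query : ℕ → List ITRMInstr
  query j = J 10 0 1 ∷ O 6 ∷ Z 1 ∷ Z 2 ∷ Z 3 ∷ Z 4 ∷ Z 5 ∷ Z 7 ∷ Z 8 ∷ Z 9 ∷ Z 10 ∷
            J 6 0 (13 + j + 0) ∷ J 0 0 (13 + j + length P) ∷ []

  tail : ℕ → List ITRMInstr
  tail j = query j ++ List.map (shift (13 + j)) P

  opaque
    tailTokens : List Linear
    tailTokens = constants (4 ∷ 10 ∷ 0 ∷ 1 ∷ []) ++ concatMap shiftedTokens
      (O 6 ∷ Z 1 ∷ Z 2 ∷ Z 3 ∷ Z 4 ∷ Z 5 ∷ Z 7 ∷ Z 8 ∷ Z 9 ∷ Z 10 ∷ J 6 0 0 ∷ J 0 0 (length P) ∷ P)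

    tailTokens-value : ∀ j → ⟦ tailTokens ⟧* j ≡ concatMap itrmTokens (tail j)
    tailTokens-value j = cong (λ ts → 4 ∷ 10 ∷ 0 ∷ 1 ∷ ts)
      (go (O 6 ∷ Z 1 ∷ Z 2 ∷ Z 3 ∷ Z 4 ∷ Z 5 ∷ Z 7 ∷ Z 8 ∷ Z 9 ∷ Z 10 ∷ J 6 0 0 ∷ J 0 0 (length P) ∷ P))
      where
      go : ∀ is → ⟦ concatMap shiftedTokens is ⟧* j ≡ concatMap itrmTokens (List.map (shift (13 + j)) is)
      go []       = refl
      go (i ∷ is) = trans (List.map-++ _ (shiftedTokens i) _) (cong₂ _++_ (shiftedTokens-value j i) (go is))

  opaque
    main : Cmd
    main =
      -- The first three loops put `l + 2 * h + n`, the line of `tail`, into `j#`, and keep `l`, `h`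
      -- and `n` in `r#`, `b#` and `p#`.
      drain b# (inc j# ⨾ inc r#) ⨾
      drain p# (inc j# ⨾ inc j# ⨾ inc b#) ⨾
      drain a# (inc j# ⨾ inc p#) ⨾
      emitsᶜ tailTokens ⨾
      -- `S 8`, `S 4` and `S 3` increment the registers of `p#`, `b#` and `a#`. The initialisation
      -- is emitted from its end.
      drain b# (emitsᶜ (constants (1 ∷ 8 ∷ []))) ⨾
      drain r# (emitsᶜ (constants (1 ∷ 4 ∷ [])) ⨾ inc b#) ⨾
      drain p# (emitsᶜ (constants (1 ∷ 3 ∷ [])) ⨾ inc r#) ⨾
      -- The map taking `e` to `2 ^ l * e + n` now puts `front` before the rest. The last doubling
      -- turns the code into the position of the query.
      drain b# (double+ 0) ⨾
      drain r# (inc e#) ⨾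
      double+ 0

  increments : ℕ → ℕ → ℕ → ℕ
  increments i zero    e = e
  increments i (suc n) e = emits (1 ∷ i ∷ []) (increments i n e)

  initialisation : ℕ → ℕ → ℕ → Cmd
  initialisation n l h = times n (inc a#) ⨾ times l (inc b#) ⨾ times h (inc p#)

  module _ (n l h : ℕ) where

    -- The line at which `tail` begins: `h` is the length of `front`, and the initialisation takes
    -- `n + l + h` lines, as `h` is hard-wired too.
    base : ℕ
    base = h + (l + (n + h))

    inner : ℕ
    inner = increments 3 n (increments 4 l (increments 8 h (emits (⟦ tailTokens ⟧* base) 0)))

    code : ℕ
    code = 2 ^ l * inner + n

    opaque
      unfolding main

      main⇓ : main ⊢ n ∷ l ∷ 0 ∷ 0 ∷ 0 ∷ h ∷ 0 ∷ [] ⇓ 0 ∷ 0 ∷ base ∷ 2 * code ∷ 0 ∷ 0 ∷ 0 ∷ []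
      main⇓ = scan-l l 0 (ℕ.+-identityʳ l) ⨾⇓ scan-h h l 0 refl (ℕ.+-identityʳ h) ⨾⇓
        scan-n n (2 * h + l) 0 (rearrange h l n) (ℕ.+-identityʳ n) ⨾⇓
        emitsᶜ⇓ tailTokens base 0 ⨾⇓
        emit-h h _ refl ⨾⇓ emit-l l _ 0 refl (ℕ.+-identityʳ l) ⨾⇓ emit-n n _ 0 refl (ℕ.+-identityʳ n) ⨾⇓
        scale l inner refl ⨾⇓ add n (2 ^ l * inner) (ℕ.+-comm n _) ⨾⇓ double+⇓ 0 code refl
        where
        rearrange : ∀ h l n → n + (2 * h + l) ≡ h + (l + (n + h))
        rearrange = solve-∀
        scan-l : ∀ i k → i + k ≡ l → drain b# (inc j# ⨾ inc r#) ⊢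
          n ∷ i ∷ k ∷ 0 ∷ 0 ∷ h ∷ k ∷ [] ⇓ n ∷ 0 ∷ l ∷ 0 ∷ 0 ∷ h ∷ l ∷ []
        scan-l zero    k refl = done⇓ refl
        scan-l (suc i) k eq   = next⇓ refl (inc⇓ ⨾⇓ inc⇓) (scan-l i (suc k) (trans (ℕ.+-suc i k) eq))
        scan-h : ∀ i j k {u} → 2 * i + j ≡ u → i + k ≡ h → drain p# (inc j# ⨾ inc j# ⨾ inc b#) ⊢
          n ∷ k ∷ j ∷ 0 ∷ 0 ∷ i ∷ l ∷ [] ⇓ n ∷ h ∷ u ∷ 0 ∷ 0 ∷ 0 ∷ l ∷ []
        scan-h zero    j k refl refl = done⇓ refl
        scan-h (suc i) j k eq   eq′  = next⇓ refl (inc⇓ ⨾⇓ inc⇓ ⨾⇓ inc⇓)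
          (scan-h i (2 + j) (suc k) (trans (lemma i j) eq) (trans (ℕ.+-suc i k) eq′))
          where
          lemma : ∀ i j → 2 * i + (2 + j) ≡ 2 * suc i + j
          lemma = solve-∀
        scan-n : ∀ i j k {u} → i + j ≡ u → i + k ≡ n → drain a# (inc j# ⨾ inc p#) ⊢
          i ∷ h ∷ j ∷ 0 ∷ 0 ∷ k ∷ l ∷ [] ⇓ 0 ∷ h ∷ u ∷ 0 ∷ 0 ∷ n ∷ l ∷ []
        scan-n zero    j k refl refl = done⇓ refl
        scan-n (suc i) j k eq   eq′  = next⇓ refl (inc⇓ ⨾⇓ inc⇓)
          (scan-n i (suc j) (suc k) (trans (ℕ.+-suc i j) eq) (trans (ℕ.+-suc i k) eq′))
        once-more : ∀ i k e → increments i k (emits (1 ∷ i ∷ []) e) ≡ emits (1 ∷ i ∷ []) (increments i k e)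
        once-more i zero    e = refl
        once-more i (suc k) e = cong (emits (1 ∷ i ∷ [])) (once-more i k e)
        emit-h : ∀ i e {u} → increments 8 i e ≡ u → drain b# (emitsᶜ (constants (1 ∷ 8 ∷ []))) ⊢
          0 ∷ i ∷ base ∷ e ∷ 0 ∷ n ∷ l ∷ [] ⇓ 0 ∷ 0 ∷ base ∷ u ∷ 0 ∷ n ∷ l ∷ []
        emit-h zero    e refl = done⇓ refl
        emit-h (suc i) e eq   = next⇓ refl (emitsᶜ⇓ (constants (1 ∷ 8 ∷ [])) base e)
          (emit-h i _ (trans (once-more 8 i e) eq))
        emit-l : ∀ i e k {u} → increments 4 i e ≡ u → i + k ≡ l →
          drain r# (emitsᶜ (constants (1 ∷ 4 ∷ [])) ⨾ inc b#) ⊢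
          0 ∷ k ∷ base ∷ e ∷ 0 ∷ n ∷ i ∷ [] ⇓ 0 ∷ l ∷ base ∷ u ∷ 0 ∷ n ∷ 0 ∷ []
        emit-l zero    e k refl refl = done⇓ refl
        emit-l (suc i) e k eq   eq′  = next⇓ refl (emitsᶜ⇓ (constants (1 ∷ 4 ∷ [])) base e ⨾⇓ inc⇓)
          (emit-l i _ (suc k) (trans (once-more 4 i e) eq) (trans (ℕ.+-suc i k) eq′))
        emit-n : ∀ i e k {u} → increments 3 i e ≡ u → i + k ≡ n →
          drain p# (emitsᶜ (constants (1 ∷ 3 ∷ [])) ⨾ inc r#) ⊢
          0 ∷ l ∷ base ∷ e ∷ 0 ∷ i ∷ k ∷ [] ⇓ 0 ∷ l ∷ base ∷ u ∷ 0 ∷ 0 ∷ n ∷ []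
        emit-n zero    e k refl refl = done⇓ refl
        emit-n (suc i) e k eq   eq′  = next⇓ refl (emitsᶜ⇓ (constants (1 ∷ 3 ∷ [])) base e ⨾⇓ inc⇓)
          (emit-n i _ (suc k) (trans (once-more 3 i e) eq) (trans (ℕ.+-suc i k) eq′))
        scale : ∀ i e {u} → 2 ^ i * e ≡ u → drain b# (double+ 0) ⊢
          0 ∷ i ∷ base ∷ e ∷ 0 ∷ 0 ∷ n ∷ [] ⇓ 0 ∷ 0 ∷ base ∷ u ∷ 0 ∷ 0 ∷ n ∷ []
        scale zero    e refl rewrite ℕ.+-identityʳ e = done⇓ refl
        scale (suc i) e eq   = next⇓ refl (double+⇓ 0 e refl) (scale i (2 * e) (trans (lemma (2 ^ i) e) eq))
          where
          lemma : ∀ x e → x * (2 * e) ≡ 2 * x * e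
          lemma = solve-∀
        add : ∀ i e {u} → i + e ≡ u → drain r# (inc e#) ⊢
          0 ∷ 0 ∷ base ∷ e ∷ 0 ∷ 0 ∷ i ∷ [] ⇓ 0 ∷ 0 ∷ base ∷ u ∷ 0 ∷ 0 ∷ 0 ∷ []
        add zero    e refl = done⇓ refl
        add (suc i) e eq   = next⇓ refl inc⇓ (add i (suc e) (trans (ℕ.+-suc i e) eq))

  -- The initialisation of the counters cannot precede front, as its length depends
  -- on the code of front, and the targets of the jumps in front must not. The
  -- numbers to be hard-wired are n and l, such that prepending front to a program
  -- changes its code from e to 2^l e + n, and the number of lines of front.

  opaque
    hardwired : ℕ
    hardwired = suc (lineAfter main 1)

    hardwired-≡ : suc (lineAfter main 1) ≡ hardwired
    hardwired-≡ = refl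

  front : List ITRMInstr
  front = J 0 0 hardwired ∷ itrmCode main 1 ++ S 10 ∷ []

  private opaque
    affine : ∃[ l ] ∃[ n ] ∀ e → emits (concatMap itrmTokens front) e ≡ 2 ^ l * e + n
    affine = emits-affine (concatMap itrmTokens front)

  private
    l = proj₁ affine
    n = proj₁ (proj₂ affine)

  initialise : Cmd
  initialise = initialisation n l hardwired

  opaque
    start : ℕ
    start = base n l hardwired

    start-≡ : base n l hardwired ≡ start
    start-≡ = refl

  index : ℕ
  index = code n l hardwired

  gate : List ITRMInstr
  gate = front ++ itrmCode initialise hardwired ++ tail start

  program-increments : ∀ i k s e → program ITRM (increments (ρ (toℕ i)) k e) ≡
                       itrmCode (times k (inc i)) s ++ program ITRM e
  program-increments i zero    s e = refl
  program-increments i (suc k) s e =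
    trans (program-emits (S (ρ (toℕ i)) ∷ []) _) (cong (_ ∷_) (program-increments i k (suc s) e))

  program-increments* : ∀ n l h s e →
    program ITRM (increments 3 n (increments 4 l (increments 8 h e))) ≡
    itrmCode (initialisation n l h) s ++ program ITRM e
  program-increments* n l h s e = begin
    program ITRM (increments 3 n e₁)
      ≡⟨ program-increments a# n s e₁ ⟩
    is₁ ++ program ITRM e₁
      ≡⟨ cong (is₁ ++_) (program-increments b# l s₂ e₂) ⟩
    is₁ ++ is₂ ++ program ITRM e₂
      ≡⟨ cong (λ is → is₁ ++ is₂ ++ is) (program-increments p# h s₃ e) ⟩
    is₁ ++ is₂ ++ is₃ ++ program ITRM e
      ≡⟨ cong (is₁ ++_) (List.++-assoc is₂ is₃ _) ⟨
    is₁ ++ (is₂ ++ is₃) ++ program ITRM e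
      ≡⟨ List.++-assoc is₁ (is₂ ++ is₃) _ ⟨
    (is₁ ++ is₂ ++ is₃) ++ program ITRM e ∎
    where
    open ≡-Reasoning
    e₂ = increments 8 h e
    e₁ = increments 4 l e₂
    s₂ = lineAfter (times n (inc a#)) s
    s₃ = lineAfter (times l (inc b#)) s₂
    is₁ = itrmCode (times n (inc a#)) s
    is₂ = itrmCode (times l (inc b#)) s₂
    is₃ = itrmCode (times h (inc p#)) s₃

  program-tail : ∀ j → program ITRM (emits (⟦ tailTokens ⟧* j) 0) ≡ tail j
  program-tail j = trans (cong (λ ts → program ITRM (emits ts 0)) (tailTokens-value j))
    (trans (program-emits (tail j) 0) (List.++-identityʳ (tail j)))

  -- The circle closes: `index` is what `main` computes from the three hard-wired numbers, and
  -- decoding it yields the affine part as `front` and the increments that hard-wire these very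
  -- numbers.
  program-index : program ITRM index ≡ gate
  program-index =
    trans (cong (program ITRM) (sym (proj₂ (proj₂ affine) (inner n l hardwired))))
    (trans (program-emits front (inner n l hardwired)) (cong (front ++_)
    (trans (program-increments* n l hardwired hardwired (emits (⟦ tailTokens ⟧* (base n l hardwired)) 0))
    (cong (itrmCode initialise hardwired ++_)
    (trans (program-tail (base n l hardwired)) (cong tail start-≡))))))

  times-inc : ∀ i k s → lineAfter (times k (inc i)) s ≡ k + s
  times-inc i zero    s = refl
  times-inc i (suc k) s = trans (times-inc i k (suc s)) (ℕ.+-suc k s)

  after-initialise : lineAfter initialise hardwired ≡ start
  after-initialise = trans (times-inc p# hardwired _) (trans (cong (hardwired +_)
    (trans (times-inc b# l _) (cong (l +_) (times-inc a# n hardwired)))) start-≡)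

  initialise⇓ : ∀ {j e} → initialise ⊢ 0 ∷ 0 ∷ j ∷ e ∷ 0 ∷ 0 ∷ 0 ∷ [] ⇓ n ∷ l ∷ j ∷ e ∷ 0 ∷ hardwired ∷ 0 ∷ []
  initialise⇓ {j} {e} = go-n n 0 (ℕ.+-identityʳ n) ⨾⇓ go-l l 0 (ℕ.+-identityʳ l) ⨾⇓
                        go-h hardwired 0 (ℕ.+-identityʳ hardwired)
    where
    go-n : ∀ k m {u} → k + m ≡ u → times k (inc a#) ⊢
           m ∷ 0 ∷ j ∷ e ∷ 0 ∷ 0 ∷ 0 ∷ [] ⇓ u ∷ 0 ∷ j ∷ e ∷ 0 ∷ 0 ∷ 0 ∷ []
    go-n zero    m refl = skip⇓
    go-n (suc k) m eq   = inc⇓ ⨾⇓ go-n k (suc m) (trans (ℕ.+-suc k m) eq)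
    go-l : ∀ k m {u} → k + m ≡ u → times k (inc b#) ⊢
           n ∷ m ∷ j ∷ e ∷ 0 ∷ 0 ∷ 0 ∷ [] ⇓ n ∷ u ∷ j ∷ e ∷ 0 ∷ 0 ∷ 0 ∷ []
    go-l zero    m refl = skip⇓
    go-l (suc k) m eq   = inc⇓ ⨾⇓ go-l k (suc m) (trans (ℕ.+-suc k m) eq)
    go-h : ∀ k m {u} → k + m ≡ u → times k (inc p#) ⊢
           n ∷ l ∷ j ∷ e ∷ 0 ∷ m ∷ 0 ∷ [] ⇓ n ∷ l ∷ j ∷ e ∷ 0 ∷ u ∷ 0 ∷ []
    go-h zero    m refl = skip⇓
    go-h (suc k) m eq   = inc⇓ ⨾⇓ go-h k (suc m) (trans (ℕ.+-suc k m) eq)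

  private
    beforeP : List ITRMInstr
    beforeP = front ++ itrmCode initialise hardwired ++ query start

    advance-front : ∀ is → advance (front ++ is) 0 ≡ advance is hardwired
    advance-front is = trans (advance-++ front is 0) (cong (advance is)
      (trans (advance-++ (itrmCode main 1) _ 1) (trans (cong suc (advance-itrmCode main 1)) hardwired-≡)))

    advance-initialise : advance (itrmCode initialise hardwired) hardwired ≡ start
    advance-initialise = trans (advance-itrmCode initialise hardwired) after-initialise

    length-beforeP : length beforeP ≡ 13 + start
    length-beforeP = begin
      length beforeP                                                ≡⟨ ℕ.+-identityʳ _ ⟨
      length beforeP + 0                                            ≡⟨ advance-length beforeP 0 ⟨
      advance beforeP 0                                            
        ≡⟨ advance-front (itrmCode initialise hardwired ++ query start) ⟩
      advance (itrmCode initialise hardwired ++ query start) hardwired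
        ≡⟨ advance-++ (itrmCode initialise hardwired) (query start) hardwired ⟩
      advance (query start) (advance (itrmCode initialise hardwired) hardwired)
        ≡⟨ cong (advance (query start)) advance-initialise ⟩
      13 + start ∎
      where
      open ≡-Reasoning

    located : ∀ k → fetch gate (13 + start + k) ≡ fetch (List.map (shift (13 + start)) P) k
    located k = begin
      fetch gate (13 + start + k)
        ≡⟨ cong (λ P′ → fetch P′ (13 + start + k)) (sym assoc) ⟩
      fetch (beforeP ++ List.map (shift (13 + start)) P) (13 + start + k)
        ≡⟨ cong (λ m → fetch (beforeP ++ List.map (shift (13 + start)) P) (m + k)) (sym length-beforeP) ⟩
      fetch (beforeP ++ List.map (shift (13 + start)) P) (length beforeP + k)
        ≡⟨ fetch-++ beforeP _ k ⟩
      fetch (List.map (shift (13 + start)) P) k ∎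
      where
      open ≡-Reasoning
      assoc : beforeP ++ List.map (shift (13 + start)) P ≡ gate
      assoc = trans (List.++-assoc front _ _) (cong (front ++_)
        (List.++-assoc (itrmCode initialise hardwired) _ _))

  module _ (em : ExcludedMiddle 1ℓ) (w : Real) where

    private
      infix 4 _⇒_
      _⇒_ : ITRMConfig → ITRMConfig → Set₁
      _⇒_ = _↠_ em gate w

      F = Fetch em gate w

      blocks : F 0 (J 0 0 hardwired) × At F 1 (itrmCode main 1) × F (lineAfter main 1) (S 10) ×
               At F hardwired (itrmCode initialise hardwired) × At F start (tail start)
      blocks with at₀ , at ← at-self gate
             with at₁ , at₂ ← at-++ (itrmCode main 1 ++ S 10 ∷ []) at
             with at₃ , at₄ , _ ← at-++ (itrmCode main 1) at₁
             rewrite advance-++ (itrmCode main 1) (S 10 ∷ []) 1 | advance-itrmCode main 1 | hardwired-≡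
             with at₅ , at₆ ← at-++ (itrmCode initialise hardwired) at₂
             rewrite advance-initialise = at₀ , at₃ , at₄ , at₅ , at₆

      j = base n l hardwired

      run : ∃[ r ] Holds 1 (n ∷ l ∷ j ∷ 2 * index ∷ 0 ∷ hardwired ∷ 0 ∷ []) r ×
        (⟨ 0 , const 0 ⟩ ⇒ ⟨ start , r ⟩)
      run =
        let at₀ , at₁ , at₂ , at₃ , at₄ , _ = blocks
            initially = record { zero≡ = refl ; counter≡ = λ i → sym (Vec.lookup-replicate i 0) ; flag≡ =
              refl ; unused = λ _ → refl }
            r₁ , h₁ , s₁ = init {0} at₃ initially
            r₂ , h₂ , s₂ = itrm-correct em gate w {f = 0} (main⇓ n l hardwired) at₁ h₁
            -- After `S 10` control falls into the initialisation again. It touches only `a#`, `b#`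
            -- and `p#`, so `e#` keeps `2 * index`.
            r₃ , h₃ , s₃ = init {1} at₃ (raise h₂)
        in r₃ , h₃ , λ x → ↠-jump em gate w {r = const 0} at₀ refl (s₁
          (↠-jump em gate w {r = r₁} at₄ (trans (flag≡ h₁) (sym (zero≡ h₁)))
          (s₂ (raised {r = r₂} at₂ (s₃ x)))))
        where
        open Holds
        raise : ∀ {σ r} → Holds 0 σ r → Holds 1 σ (r [ 10 ≔ suc (r 10) ])
        raise {σ} {r} h = record { zero≡ = zero≡ h ; counter≡ = counter ; flag≡ = cong suc (flag≡ h) ;
          unused = unused h }
          where
          counter : ∀ i → (r [ 10 ≔ suc (r 10) ]) (ρ (toℕ i)) ≡ lookup σ i
          counter i = trans ([≔]-miss r (ℕ.<⇒≢ (ℕ.+-monoʳ-< 3 (Fin.toℕ<n i)))) (counter≡ h i)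
        raised : ∀ {r} → F (lineAfter main 1) (S 10) →
                 ⟨ lineAfter main 1 , r ⟩ ⇒ ⟨ hardwired , r [ 10 ≔ suc (r 10) ] ⟩
        raised {r} at₂ = subst (λ q → ⟨ lineAfter main 1 , r ⟩ ⇒ ⟨ q , r [ 10 ≔ suc (r 10) ] ⟩) hardwired-≡
          (↠-step em gate w {r = r} at₂)
        init : ∀ {f j′ e} → At F hardwired (itrmCode initialise hardwired) → _at_⇝_at_[_] em gate w
          (0 ∷ 0 ∷ j′ ∷ e ∷ 0 ∷ 0 ∷ 0 ∷ []) hardwired
                              (n ∷ l ∷ j′ ∷ e ∷ 0 ∷ hardwired ∷ 0 ∷ []) start f
        init {f} {j′} {e} at₃ {r} h = subst (λ q → ∃[ r′ ] Holds f
          (n ∷ l ∷ j′ ∷ e ∷ 0 ∷ hardwired ∷ 0 ∷ []) r′ × (⟨ hardwired , r ⟩ ⇒ ⟨ q , r′ ⟩))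
          after-initialise (itrm-correct em gate w {f = f} initialise⇓ at₃ h)

      -- The store after the query and the clearing. If the oracle answers 0 it is blank, as `P`
      -- requires; if it answers 1, register 0 already contains the output 0.
      queried : ℕ → ℕ
      queried 6 = if w (2 * index) then 1 else 0
      queried _ = 0

      r₁ r₂ r₃ r₄ r₅ r₆ r₇ r₈ r₉ r₁₀ : (ℕ → ℕ) → ℕ → ℕ
      r₁ r = r [ 6 ≔ (if w (r 6) then 1 else 0) ]
      r₂ r = r₁ r [ 1 ≔ 0 ]
      r₃ r = r₂ r [ 2 ≔ 0 ]
      r₄ r = r₃ r [ 3 ≔ 0 ]
      r₅ r = r₄ r [ 4 ≔ 0 ]
      r₆ r = r₅ r [ 5 ≔ 0 ]
      r₇ r = r₆ r [ 7 ≔ 0 ]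
      r₈ r = r₇ r [ 8 ≔ 0 ]
      r₉ r = r₈ r [ 9 ≔ 0 ]
      r₁₀ r = r₉ r [ 10 ≔ 0 ]

      cleared : ∀ {σ r} → Holds 1 σ r → lookup σ 3F ≡ 2 * index → r₁₀ r ≗ queried
      cleared h eq 0 = Holds.zero≡ h
      cleared h eq 1 = refl
      cleared h eq 2 = refl
      cleared h eq 3 = refl
      cleared h eq 4 = refl
      cleared h eq 5 = refl
      cleared h eq 6 = cong (λ m → if w m then 1 else 0) (trans (Holds.counter≡ h 3F) eq)
      cleared h eq 7 = refl
      cleared h eq 8 = refl
      cleared h eq 9 = refl
      cleared h eq 10 = refl
      cleared h eq (suc (suc (suc (suc (suc (suc (suc (suc (suc (suc (suc m))))))))))) = Holds.unused h m

      query-steps : ∀ {σ r} → Holds 1 σ r → lookup σ 3F ≡ 2 * index → At F start (tail start) →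
                    ⟨ start , r ⟩ ⇒ ⟨ 11 + start , queried ⟩
      query-steps {σ} {r} h eq (at₀ , at₁ , at₂ , at₃ , at₄ , at₅ , at₆ , at₇ , at₈ , at₉ , at₁₀ , _) x =
        ↠-stay em gate w {r = r} at₀ (λ p → ℕ.1+n≢0 (trans (sym (Holds.flag≡ h)) (trans p (Holds.zero≡ h))))
        (↠-step em gate w {r = r} at₁ (↠-step em gate w {r = r₁ r} at₂ (↠-step em gate w {r = r₂ r} at₃
        (↠-step em gate w {r = r₃ r} at₄ (↠-step em gate w {r = r₄ r} at₅ (↠-step em gate w {r = r₅ r} at₆
        (↠-step em gate w {r = r₆ r} at₇ (↠-step em gate w {r = r₇ r} at₈ (↠-step em gate w {r = r₈ r} at₉
        (↠-step em gate w {r = r₉ r} at₁₀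
        (reaches-~ (itrm-regular gate w) {c = ⟨ 11 + start , r₁₀ r ⟩} (refl , cleared h eq) x)))))))))))

      run-query : ⟨ 0 , const 0 ⟩ ⇒ ⟨ 11 + start , queried ⟩
      run-query x = let r , h , s = run ; _ , _ , _ , _ , at = blocks in s (query-steps h refl at x)

      initially : ∀ {c} → Lift 1ℓ (⟨ 0 , const 0 ⟩ ≐ c) → System.Initial (itrm gate w) c
      initially (lift (l≡ , r≡)) = lift (sym l≡ , λ n → sym (r≡ n))

    itrm-rejects : w (2 * index) ≡ true → HaltsWith (itrm gate w) 0
    itrm-rejects bit =
      let _ , _ , _ , _ , _ , _ , _ , _ , _ , _ , _ , _ , _ , _ , _ , at₁₁ , at₁₂ , _ = blocks
      in weaken-initial (itrm-regular gate w) initially (run-query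
        (↠-stay em gate w {r = queried} at₁₁ nonzero (↠-jump em gate w {r = queried} at₁₂ refl
          (halted-now {M = itrm gate w} {c = ⟨ 13 + start + length P , queried ⟩}
            (lift (refl , λ _ → refl)) (lift stop) refl))))
      where
      nonzero : queried 6 ≢ queried 0
      nonzero rewrite bit = λ ()
      stop : fetch gate (13 + start + length P) ≡ nothing
      stop = trans (located (length P)) (trans (fetch-map _ P (length P)) (cong (Maybe.map _) (fetch-end P)))

    itrm-accepts : w (2 * index) ≡ false → ∀ {i} → HaltsWith (itrm P w) i → HaltsWith (itrm gate w) i
    itrm-accepts bit {i} halts =
      let _ , _ , _ , _ , _ , _ , _ , _ , _ , _ , _ , _ , _ , _ , _ , at₁₁ , _ = blocks
      in weaken-initial (itrm-regular gate w) initially (run-query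
        (↠-jump em gate w {r = queried} at₁₁ is-zero (subst
          (λ p → HaltsWith (restart (itrm gate w) λ e → Lift 1ℓ (⟨ p , queried ⟩ ≐ e)) i)
          (sym (ℕ.+-identityʳ (13 + start))) (itrm-relocate em located w zeros halts))))
      where
      is-zero : queried 6 ≡ queried 0
      is-zero rewrite bit = refl
      zeros : ∀ m → queried m ≡ 0
      zeros 0 = refl
      zeros 1 = refl
      zeros 2 = refl
      zeros 3 = refl
      zeros 4 = refl
      zeros 5 = refl
      zeros 6 = is-zero
      zeros (suc (suc (suc (suc (suc (suc (suc m))))))) = refl

-- Programs for one head on a binary tape

infixr 5 _⨟_

data Routine : Set where
  skip  : Routine
  move  : Direction → Routine
  write : Bool → Routine
  _⨟_   : Routine → Routine → Routine
  while : Bool → Routine → Routine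

_⟨_≔_⟩ : (ℕ → Bool) → ℕ → Bool → ℕ → Bool
(τ ⟨ p ≔ b ⟩) q = if q ≡ᵇ p then b else τ q

infix 4 _⊢_,_⇓_,_

-- No rule moves left from cell 0, so these runs do not depend on what a machine does at the left
-- end of the tape.
data _⊢_,_⇓_,_ : Routine → (ℕ → Bool) → ℕ → (ℕ → Bool) → ℕ → Set where
  skip⇓  : ∀ {τ p} → skip ⊢ τ , p ⇓ τ , p
  right⇓ : ∀ {τ p} → move right ⊢ τ , p ⇓ τ , suc p
  left⇓  : ∀ {τ p} → move left ⊢ τ , suc p ⇓ τ , p
  write⇓ : ∀ {b τ p} → write b ⊢ τ , p ⇓ τ ⟨ p ≔ b ⟩ , p
  _⨟⇓_   : ∀ {c d τ p τ′ p′ τ″ p″} → c ⊢ τ , p ⇓ τ′ , p′ → d ⊢ τ′ , p′ ⇓ τ″ , p″ → c ⨟ d ⊢ τ , p ⇓ τ″ , p″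
  stop⇓  : ∀ {b c τ p} → τ p ≡ not b → while b c ⊢ τ , p ⇓ τ , p
  loop⇓  : ∀ {b c τ p τ′ p′ τ″ p″} → τ p ≡ b → c ⊢ τ , p ⇓ τ′ , p′ → while b c ⊢ τ′ , p′ ⇓ τ″ , p″ →
           while b c ⊢ τ , p ⇓ τ″ , p″

infixr 5 _⨟⇓_

rights lefts : ℕ → Routine
rights zero    = skip
rights (suc n) = move right ⨟ rights n
lefts zero    = skip
lefts (suc n) = move left ⨟ lefts n

rights⇓ : ∀ n p {q τ} → n + p ≡ q → rights n ⊢ τ , p ⇓ τ , q
rights⇓ zero    p refl = skip⇓
rights⇓ (suc n) p eq   = right⇓ ⨟⇓ rights⇓ n (suc p) (trans (ℕ.+-suc n p) eq)

lefts⇓ : ∀ n p {τ} → lefts n ⊢ τ , n + p ⇓ τ , p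
lefts⇓ zero    p = skip⇓
lefts⇓ (suc n) p = left⇓ ⨟⇓ lefts⇓ n p

-- The tape is divided into blocks of eight cells: cell 0 of a block tells whether
-- it is the initial one, and the cells 1 + r carry the counter r in unary.

symbol : Counters → ℕ → Fin 8 → Bool
symbol σ i zero    = i ≡ᵇ 0
symbol σ i (suc r) = i <ᵇ lookup σ r

symbol-zero : ∀ i r → symbol (Vec.replicate 7 0) i (suc r) ≡ false
symbol-zero i r = cong (i <ᵇ_) (Vec.lookup-replicate r 0)

record Represents (σ : Counters) (τ : ℕ → Bool) : Set where
  constructor represents
  field symbol≡ : ∀ i t → τ (i * 8 + toℕ t) ≡ symbol σ i t

open Represents

home : ℕ → Routine
home t = lefts t ⨟ while false (lefts 8)

routine : Cmd → Routine
routine skip        = skip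
routine (inc r)     = rights (suc (toℕ r)) ⨟ while true (rights 8) ⨟ write true ⨟ home (suc (toℕ r))
routine (c ⨾ d)     = routine c ⨟ routine d
routine (drain r c) = rights (suc (toℕ r)) ⨟
  -- The counter is positive if its cell in block 0 carries 1. Each round erases the last 1 of the
  -- numeral and runs `c` with the head back on cell 0.
  while true (while true (rights 8) ⨟ lefts 8 ⨟ write false ⨟ home (suc (toℕ r)) ⨟ routine c ⨟ rights
    (suc (toℕ r))) ⨟
  lefts (suc (toℕ r))

position-injective : ∀ i j (t u : Fin 8) → i * 8 + toℕ t ≡ j * 8 + toℕ u → i ≡ j × t ≡ u
position-injective i j t u eq = i≡j , Fin.toℕ-injective t≡u
  where
  rem : ∀ i (t : Fin 8) → (i * 8 + toℕ t) % 8 ≡ toℕ t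
  rem i t = trans (cong (_% 8) (ℕ.+-comm (i * 8) (toℕ t)))
    (trans ([m+kn]%n≡m%n (toℕ t) i 8) (m<n⇒m%n≡m (Fin.toℕ<n t)))
  t≡u : toℕ t ≡ toℕ u
  t≡u = trans (sym (rem i t)) (trans (cong (_% 8) eq) (rem j u))
  i≡j : i ≡ j
  i≡j = ℕ.*-cancelʳ-≡ i j 8 (ℕ.+-cancelʳ-≡ (toℕ t) (i * 8) (j * 8) (trans eq (cong (j * 8 +_) (sym t≡u))))

⟨≔⟩-hit : ∀ τ p {b} → (τ ⟨ p ≔ b ⟩) p ≡ b
⟨≔⟩-hit τ p rewrite ≡ᵇ-refl p = refl

⟨≔⟩-miss : ∀ τ {p q b} → q ≢ p → (τ ⟨ p ≔ b ⟩) q ≡ τ q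
⟨≔⟩-miss τ q≢p rewrite ≢⇒≡ᵇ q≢p = refl

<ᵇ-suc : ∀ {i n} → i ≢ n → (i <ᵇ suc n) ≡ (i <ᵇ n)
<ᵇ-suc {zero}  {zero}  i≢n = contradiction refl i≢n
<ᵇ-suc {zero}  {suc n} i≢n = refl
<ᵇ-suc {suc i} {zero}  i≢n = refl
<ᵇ-suc {suc i} {suc n} i≢n = <ᵇ-suc (i≢n ∘ cong suc)

<ᵇ-irrefl : ∀ n → (n <ᵇ n) ≡ false
<ᵇ-irrefl zero    = refl
<ᵇ-irrefl (suc n) = <ᵇ-irrefl n

n<ᵇ1+n : ∀ n → (n <ᵇ suc n) ≡ true
n<ᵇ1+n zero    = refl
n<ᵇ1+n (suc n) = n<ᵇ1+n n

represents-update : ∀ {σ τ} r n {g b} → Represents σ τ → b ≡ (n <ᵇ g (lookup σ r)) →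
  (∀ i → i ≢ n → (i <ᵇ lookup σ r) ≡ (i <ᵇ g (lookup σ r))) →
  Represents (σ [ r ]%= g) (τ ⟨ n * 8 + suc (toℕ r) ≔ b ⟩)
represents-update {σ} {τ} r n {g} {b} rep here elsewhere = represents updated
  where
  other : ∀ i t → t ≢ suc r → symbol σ i t ≡ symbol (σ [ r ]%= g) i t
  other i zero    _  = refl
  other i (suc s) s≢ = cong (i <ᵇ_) (sym (Vec.lookup∘updateAt′ s r (s≢ ∘ cong suc) σ))
  updated : ∀ i t → (τ ⟨ n * 8 + suc (toℕ r) ≔ b ⟩) (i * 8 + toℕ t) ≡ symbol (σ [ r ]%= g) i t
  updated i t with i ℕ.≟ n | t Fin.≟ suc r
  ... | yes refl | yes refl = trans (⟨≔⟩-hit τ (i * 8 + suc (toℕ r)))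
    (trans here (cong (i <ᵇ_) (sym (Vec.lookup∘updateAt r σ))))
  ... | no i≢n | yes refl = trans (⟨≔⟩-miss τ (i≢n ∘ proj₁ ∘ position-injective i n (suc r) (suc r)))
    (trans (symbol≡ rep i (suc r)) (trans (elsewhere i i≢n) (cong (i <ᵇ_) (sym (Vec.lookup∘updateAt r σ)))))
  ... | _ | no t≢ = trans (⟨≔⟩-miss τ (t≢ ∘ proj₂ ∘ position-injective i n t (suc r)))
    (trans (symbol≡ rep i t) (other i t t≢))

represents-suc : ∀ {σ τ} r → Represents σ τ →
  Represents (σ [ r ]%= suc) (τ ⟨ lookup σ r * 8 + suc (toℕ r) ≔ true ⟩)
represents-suc {σ} r rep = represents-update r (lookup σ r) {suc} rep (sym (n<ᵇ1+n (lookup σ r))) λ i i≢ →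
  sym (<ᵇ-suc i≢)

represents-pred : ∀ {σ τ} r {m} → lookup σ r ≡ suc m → Represents σ τ →
  Represents (σ [ r ]≔ m) (τ ⟨ m * 8 + suc (toℕ r) ≔ false ⟩)
represents-pred {σ} r {m} eq rep = represents-update r m {const m} rep (sym (<ᵇ-irrefl m))
  λ i i≢m → trans (cong (i <ᵇ_) eq) (<ᵇ-suc i≢m)

home⇓ : ∀ {σ τ} (t : Fin 8) i → Represents σ τ → home (toℕ t) ⊢ τ , i * 8 + toℕ t ⇓ τ , 0
home⇓ {σ} {τ} t i rep rewrite ℕ.+-comm (i * 8) (toℕ t) = lefts⇓ (toℕ t) (i * 8) ⨟⇓ back i
  where
  mark : ∀ i → τ (i * 8) ≡ (i ≡ᵇ 0)
  mark i = trans (cong τ (sym (ℕ.+-identityʳ (i * 8)))) (symbol≡ rep i zero)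
  back : ∀ i → while false (lefts 8) ⊢ τ , i * 8 ⇓ τ , 0
  back zero    = stop⇓ (mark 0)
  back (suc i) = loop⇓ (mark (suc i)) (lefts⇓ 8 (i * 8)) (back i)

scan⇓ : ∀ {σ τ} r → Represents σ τ → ∀ d i {n} → d + i ≡ n → lookup σ r ≡ n →
  while true (rights 8) ⊢ τ , i * 8 + suc (toℕ r) ⇓ τ , n * 8 + suc (toℕ r)
scan⇓ r rep zero    i refl eq = stop⇓ (trans (symbol≡ rep i (suc r)) (trans (cong (i <ᵇ_) eq) (<ᵇ-irrefl i)))
scan⇓ r rep (suc d) i refl eq = loop⇓
  (trans (symbol≡ rep i (suc r)) (trans (cong (i <ᵇ_) eq) (below d i)))
  (rights⇓ 8 (i * 8 + suc (toℕ r)) refl) (scan⇓ r rep d (suc i) (ℕ.+-suc d i) eq)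
  where
  below : ∀ d i → (i <ᵇ suc (d + i)) ≡ true
  below d zero    = refl
  below d (suc i) rewrite ℕ.+-suc d i = below d i

routine-correct : ∀ {c σ σ′} → c ⊢ σ ⇓ σ′ → ∀ {τ} → Represents σ τ →
                  ∃[ τ′ ] Represents σ′ τ′ × routine c ⊢ τ , 0 ⇓ τ′ , 0
routine-correct skip⇓ rep = _ , rep , skip⇓
routine-correct {inc r} {σ} inc⇓ rep = _ , represents-suc r rep ,
  rights⇓ (suc (toℕ r)) 0 (ℕ.+-identityʳ _) ⨟⇓ scan⇓ r rep (lookup σ r) 0 (ℕ.+-identityʳ _) refl ⨟⇓
  write⇓ ⨟⇓ home⇓ (suc r) (lookup σ r) (represents-suc r rep)
routine-correct (p ⨾⇓ q) rep =
  let _ , rep₁ , s₁ = routine-correct p rep ; _ , rep₂ , s₂ = routine-correct q rep₁ in _ , rep₂ , s₁ ⨟⇓ s₂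
routine-correct {drain r c} p rep =
  let τ′ , rep′ , s = rounds p rep in τ′ , rep′ ,
  rights⇓ (suc (toℕ r)) 0 (ℕ.+-identityʳ _) ⨟⇓ s ⨟⇓ subst (λ p → lefts (suc (toℕ r)) ⊢ τ′ , p ⇓ τ′ , 0)
    (ℕ.+-identityʳ _) (lefts⇓ (suc (toℕ r)) 0)
  where
  body = while true (rights 8) ⨟ lefts 8 ⨟ write false ⨟ home (suc (toℕ r)) ⨟ routine c ⨟ rights (suc (toℕ r))
  rounds : ∀ {σ σ′} → drain r c ⊢ σ ⇓ σ′ → ∀ {τ} → Represents σ τ →
    ∃[ τ′ ] Represents σ′ τ′ × while true body ⊢ τ , suc (toℕ r) ⇓ τ′ , suc (toℕ r)
  rounds (done⇓ eq) rep = _ , rep , stop⇓ (trans (symbol≡ rep 0 (suc r)) (cong (0 <ᵇ_) eq))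
  rounds {σ} (next⇓ {m = m} eq p q) {τ} rep =
    let rep₁ = represents-pred r eq rep
        _ , rep₂ , s₂ = routine-correct p rep₁
        _ , rep₃ , s₃ = rounds q rep₂
    in _ , rep₃ , loop⇓ (trans (symbol≡ rep 0 (suc r)) (cong (0 <ᵇ_) eq))
         (scan⇓ r rep (suc m) 0 (ℕ.+-identityʳ _) eq ⨟⇓ lefts⇓ 8 (m * 8 + suc (toℕ r)) ⨟⇓ write⇓ ⨟⇓
          home⇓ (suc r) m rep₁ ⨟⇓ s₂ ⨟⇓ rights⇓ (suc (toℕ r)) 0 (ℕ.+-identityʳ _)) s₃

-- Every step of a machine moves the head, so tests and writes are followed by a
-- step back to the left.

data Action : Set where
  go   : Direction → ℕ → Action
  put  : Bool → ℕ → Action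
  test : Bool → ℕ → ℕ → Action
  ask  : ℕ → ℕ → Action

writes : Action → Bool → Bool
writes (put x _) b = x
writes _         b = b

heads : Action → Direction
heads (go d _) = d
heads _        = right

leadsTo : Action → Bool → Bool → ℕ
leadsTo (go _ n)     o b = n
leadsTo (put _ n)    o b = n
leadsTo (test x m n) o b = if does (b Bool.≟ x) then m else n
leadsTo (ask m n)    o b = if o then m else n

mapAction : (ℕ → ℕ) → Action → Action
mapAction f (go d n)     = go d (f n)
mapAction f (put x n)    = put x (f n)
mapAction f (test x m n) = test x (f m) (f n)
mapAction f (ask m n)    = ask (f m) (f n)

after : Routine → ℕ → ℕ
after skip        l = l
after (move d)    l = suc l
after (write x)   l = 2 + l
after (c ⨟ d)     l = after d (after c l)
after (while x c) l = 2 + after c (3 + l)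

table : Routine → ℕ → List Action
table skip        l = []
table (move d)    l = go d (suc l) ∷ []
table (write x)   l = put x (suc l) ∷ go left (2 + l) ∷ []
table (c ⨟ d)     l = table c l ++ table d (after c l)
table (while x c) l = test x (1 + l) (2 + l) ∷ go left (3 + l) ∷ go left (after (while x c) l) ∷
  -- The jump back to the test has to move the head. Going right before going left is possible on
  -- every cell.
  table c (3 + l) ++ go right (suc (after c (3 + l))) ∷ go left l ∷ []

advance-table : ∀ c l → advance (table c l) l ≡ after c l
advance-table skip        l = refl
advance-table (move d)    l = refl
advance-table (write x)   l = refl
advance-table (c ⨟ d)     l = trans (advance-++ (table c l) _ l)
  (trans (cong (advance (table d (after c l))) (advance-table c l)) (advance-table d (after c l)))
advance-table (while x c) l = trans (advance-++ (table c (3 + l)) _ (3 + l))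
  (cong (2 +_) (advance-table c (3 + l)))

after-+ : ∀ c m l → after c (m + l) ≡ after c m + l
after-+ skip        m l = refl
after-+ (move d)    m l = refl
after-+ (write x)   m l = refl
after-+ (c ⨟ d)     m l = trans (cong (after d) (after-+ c m l)) (after-+ d (after c m) l)
after-+ (while x c) m l = cong (2 +_) (after-+ c (3 + m) l)

-- Targets are relative to the place of the table, so a copy placed elsewhere is a renumbering. This
-- makes the tokens of the copy with number `j` linear in `j`.
table-+ : ∀ c m l → table c (m + l) ≡ List.map (mapAction (_+ l)) (table c m)
table-+ skip        m l = refl
table-+ (move d)    m l = refl
table-+ (write x)   m l = refl
table-+ (c ⨟ d)     m l = trans (cong₂ _++_ (table-+ c m l)
    (trans (cong (table d) (after-+ c m l)) (table-+ d (after c m) l)))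
  (sym (List.map-++ (mapAction (_+ l)) (table c m) _))
table-+ (while x c) m l rewrite after-+ c (3 + m) l = 
  cong (λ as → test x (suc (m + l)) (2 + (m + l)) ∷ go left (3 + (m + l)) ∷ go left
    (2 + (after c (3 + m) + l)) ∷ as)
  (trans (cong (_++ go right (suc (after c (3 + m) + l)) ∷ go left (m + l) ∷ []) (table-+ c (3 + m) l))
    (sym (List.map-++ (mapAction (_+ l)) (table c (3 + m)) _)))

-- Transition tables for actions

module _ {k} (work : Fin k) where

  -- The finite computations write on the tape `work` only, so no entries are needed for a symbol 1
  -- on another tape.
  scan : Bool → Vec Bool k
  scan b = Vec.replicate k false [ work ]≔ b

  instruction : ℕ → Bool → Bool → Action → TMInstr k
  instruction s o b a = instr s o (scan b) (scan (writes a b)) (heads a) (leadsTo a o b)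

  instructions : ℕ → Action → TMProgram k
  instructions s a = instruction s false false a ∷ instruction s false true a ∷
                     instruction s true false a ∷ instruction s true true a ∷ []

  block : (ℕ → ℕ) → ℕ → List Action → TMProgram k
  block ς l []       = []
  block ς l (a ∷ as) = instructions (ς l) a ++ block ς (suc l) as

module _ {k : ℕ} where

  key : TMInstr k → ℕ × Bool × Vec Bool k
  key i = TMInstr.state i , TMInstr.oracle i , TMInstr.read i

  key≟ : ∀ s o v → Decidable λ i → key i ≡ (s , o , v)
  key≟ s o v i = Product.≡-dec ℕ._≟_ (Product.≡-dec Bool._≟_ (Vec.≡-dec Bool._≟_)) (key i) (s , o , v)

  transition-hit : ∀ i is {s o v} → key i ≡ (s , o , v) → transition (i ∷ is) s o v ≡ just i
  transition-hit i is {s} {o} {v} eq with key≟ s o v i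
  ... | yes _ = refl
  ... | no ne = contradiction eq ne

  transition-miss : ∀ i is {s o v} → key i ≢ (s , o , v) → transition (i ∷ is) s o v ≡ transition is s o v
  transition-miss i is {s} {o} {v} ne with key≟ s o v i
  ... | yes eq = contradiction eq ne
  ... | no _ = refl

  -- The first matching instruction is executed, so an entry takes effect once all instructions in
  -- front of it belong to other states.
  Avoids : ℕ → TMProgram k → Set
  Avoids s = All λ i → TMInstr.state i ≢ s

  transition-avoids : ∀ {s} is js {o v} → Avoids s is → transition (is ++ js) s o v ≡ transition js s o v
  transition-avoids []       js []             = refl
  transition-avoids (i ∷ is) js (i≢s ∷ avoids) =
    trans (transition-miss i (is ++ js) (i≢s ∘ cong proj₁)) (transition-avoids is js avoids)

module _ {k} (work : Fin k) where

  scan-injective : ∀ {b c} → scan work b ≡ scan work c → b ≡ c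
  scan-injective {b} {c} eq = trans (sym (Vec.lookup∘update work (Vec.replicate k false) b))
    (trans (cong (λ v → lookup v work) eq) (Vec.lookup∘update work (Vec.replicate k false) c))

  transition-instructions : ∀ s a is o b → transition (instructions work s a ++ is) s o (scan work b) ≡
                            just (instruction work s o b a)
  transition-instructions s a is = found
    where
    i₁ = instruction work s false false a
    i₂ = instruction work s false true a
    i₃ = instruction work s true false a
    i₄ = instruction work s true true a
    differ : ∀ o → (s , o , scan work false) ≢ (s , o , scan work true)
    differ o eq = contradiction (scan-injective (cong (λ (_ , _ , v) → v) eq)) λ ()
    found : ∀ o b → transition (i₁ ∷ i₂ ∷ i₃ ∷ i₄ ∷ is) s o (scan work b) ≡ just (instruction work s o b a)
    found false false = transition-hit i₁ (i₂ ∷ i₃ ∷ i₄ ∷ is) {s} {false} {scan work false} refl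
    found false true  = trans (transition-miss i₁ (i₂ ∷ i₃ ∷ i₄ ∷ is) {s} {false} {scan work true}
      (differ false))
      (transition-hit i₂ (i₃ ∷ i₄ ∷ is) {s} {false} {scan work true} refl)
    found true  false = trans (transition-miss i₁ (i₂ ∷ i₃ ∷ i₄ ∷ is) {s} {true} {scan work false} λ ())
      (trans (transition-miss i₂ (i₃ ∷ i₄ ∷ is) {s} {true} {scan work false} λ ())
      (transition-hit i₃ (i₄ ∷ is) {s} {true} {scan work false} refl))
    found true  true  = trans (transition-miss i₁ (i₂ ∷ i₃ ∷ i₄ ∷ is) {s} {true} {scan work true} λ ())
      (trans (transition-miss i₂ (i₃ ∷ i₄ ∷ is) {s} {true} {scan work true} λ ())
      (trans (transition-miss i₃ (i₄ ∷ is) {s} {true} {scan work true} (differ true))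
      (transition-hit i₄ is {s} {true} {scan work true} refl)))

  Performs : TMProgram k → ℕ → Action → Set
  Performs Q s a = ∀ o b → transition Q s o (scan work b) ≡ just (instruction work s o b a)

  block-avoids : ∀ {ς} l as {s} → (∀ i → l ℕ.≤ i → i ℕ.< advance as l → ς i ≢ s) → Avoids s (block work ς l as)
  block-avoids l []       avoid = []
  block-avoids l (a ∷ as) avoid = here ∷ here ∷ here ∷ here ∷
    block-avoids (suc l) as (λ i l<i → avoid i (ℕ.<⇒≤ l<i))
    where
    here = avoid l ℕ.≤-refl
      (subst (l ℕ.<_) (sym (advance-length as (suc l))) (ℕ.m≤n+m (suc l) (length as)))

  block-performs : ∀ {ς} → (∀ {i j} → ς i ≡ ς j → i ≡ j) → ∀ pre l as rest →
    (∀ i → l ℕ.≤ i → i ℕ.< advance as l → Avoids (ς i) pre) →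
    At (λ i → Performs (pre ++ block work ς l as ++ rest) (ς i)) l as
  block-performs ς-inj pre l [] rest avoid = tt
  block-performs {ς} ς-inj pre l (a ∷ as) rest avoid =
    (λ o b → trans (transition-avoids pre _ (avoid l ℕ.≤-refl inside))
      (transition-instructions (ς l) a (block work ς (suc l) as ++ rest) o b)) ,
    subst (λ Q → At (λ i → Performs Q (ς i)) (suc l) as) (List.++-assoc pre (instructions work (ς l) a) _)
      (block-performs ς-inj (pre ++ instructions work (ς l) a) (suc l) as rest
        λ i l<i i<end → All.++⁺ (avoid i (ℕ.<⇒≤ l<i) i<end)
          (later i l<i ∷ later i l<i ∷ later i l<i ∷ later i l<i ∷ []))
    where
    inside = subst (l ℕ.<_) (sym (advance-length as (suc l))) (ℕ.m≤n+m (suc l) (length as))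
    later : ∀ i → l ℕ.< i → ς l ≢ ς i
    later i l<i eq = ℕ.<⇒≢ l<i (ς-inj eq)

-- Runs of routines on the first ω cells

module Running (em : ExcludedMiddle 1ℓ) {p} {T : Tape p} (laws : TapeLaws T) {k} (work out : Fin k)
               {Limit : Ord → (Ord → TM.Config T k) → TM.Config T k → Set (1ℓ ⊔ p)}
               (regular : ∀ P w → Regular (TM.system T k out Limit P w))
               (≐⇒~ : ∀ P w {c d} → TMRegular._≐ᵗ_ laws {k} c d → Regular._~_ (regular P w) c d) where
  open Tape T
  open TapeLaws laws
  open TM T k
  open TMRegular laws {k}

  extend : (ℕ → Bool) → Pos → Bool
  extend τ q with cell? q
  ... | yes (n , _) = τ n
  ... | no _        = false

  extend-cell : ∀ τ {q n} → q ≈ cell n → extend τ q ≡ τ n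
  extend-cell τ {q} {n} q≈n with cell? q
  ... | yes (m , q≈m) = cong τ (cell-injective (≈-trans (≈-sym q≈m) q≈n))
  ... | no ¬cell      = contradiction (n , q≈n) ¬cell

  extend-cong : ∀ {τ τ′} → τ ≗ τ′ → ∀ {q r} → q ≈ r → extend τ q ≡ extend τ′ r
  extend-cong {τ} {τ′} τ≗τ′ {q} {r} q≈r with cell? q
  ... | yes (n , q≈n) = trans (τ≗τ′ n) (sym (extend-cell τ′ (≈-trans (≈-sym q≈r) q≈n)))
  ... | no ¬cell with cell? r
  ...   | yes (n , r≈n) = contradiction (n , ≈-trans q≈r r≈n) ¬cell
  ...   | no _ = refl

  extend-update : ∀ τ {p b q} → ¬ q ≈ cell p → extend (τ ⟨ p ≔ b ⟩) q ≡ extend τ q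
  extend-update τ {p} {b} {q} q≉p with cell? q
  ... | yes (n , q≈n) = ⟨≔⟩-miss τ λ { refl → q≉p q≈n }
  ... | no _ = refl

  config : ℕ → (ℕ → Bool) → ℕ → Config
  config s τ h = record
    { state   = s
    ; head    = cell h
    ; content = λ t q → lookup (scan work (extend τ q)) t
    }

  config-cong : ∀ {s τ τ′ h} → τ ≗ τ′ → config s τ h ≐ᵗ config s τ′ h
  config-cong τ≗τ′ = mk≐ refl ≈-refl λ t q r q≈r → cong (λ b → lookup (scan work b) t) (extend-cong τ≗τ′ q≈r)

  scanned-config : ∀ s τ h → scanned (config s τ h) ≡ scan work (τ h)
  scanned-config s τ h = trans (Vec.tabulate∘lookup (scan work (extend τ (cell h))))
    (cong (scan work) (extend-cell τ ≈-refl))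

  oracleBit : ∀ w h → OracleBit w (cell h) (w h)
  oracleBit w h = mk⇔ (λ wh → h , ≈-refl , wh) λ (n , h≈n , wn) → subst (λ m → w m ≡ true)
    (sym (cell-injective h≈n)) wn

  module Steps (Q : TMProgram k) (w : Real) where

    infix 4 _⇒_
    _⇒_ : Config → Config → Set (1ℓ ⊔ p)
    _⇒_ = Reaches (regular Q w)

    step : ∀ {s τ h a h′} → Performs work Q s a → Moves (heads a) (cell h) (cell h′) →
           config s τ h ⇒ config (leadsTo a (w h) (τ h)) (τ ⟨ h ≔ writes a (τ h) ⟩) h′
    step {s} {τ} {h} {a} {h′} performs moves = prepend-step em (regular Q w)
      (≐⇒~ Q w (config-cong {τ = τ} λ _ → refl))
      (w h , oracleBit w h , instruction work s (w h) (τ h) a ,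
       trans (cong (transition Q s (w h)) (scanned-config s τ h)) (performs (w h) (τ h)) , record
        { state′    = refl
        ; head′     = moves
        ; written   = λ t q q≈h → cong (λ b → lookup (scan work b) t)
            (trans (extend-cell _ q≈h) (⟨≔⟩-hit τ h))
        ; unchanged = λ t q q≉h → cong (λ b → lookup (scan work b) t) (extend-update τ q≉h)
        })

    rewrite-same : ∀ {s τ h h′} → config s (τ ⟨ h ≔ τ h ⟩) h′ ⇒ config s τ h′
    rewrite-same {s} {τ} {h} = reaches-~ (regular Q w) (≐⇒~ Q w (config-cong same))
      where
      same : τ ⟨ h ≔ τ h ⟩ ≗ τ
      same q with q ≡ᵇ h in eq
      ... | true  = cong τ (sym (ℕ.≡ᵇ⇒≡ q h (subst Bool.T (sym eq) tt)))
      ... | false = refl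

    stepRight : ∀ {s τ h n} → Performs work Q s (go right n) → config s τ h ⇒ config n τ (suc h)
    stepRight {τ = τ} {h} {n} at x = step {τ = τ} {h} {a = go right n} {h′ = suc h} at (lift (cell-suc h))
      (rewrite-same {τ = τ} {h} x)

    stepLeft : ∀ {s τ h n} → Performs work Q s (go left n) → config s τ (suc h) ⇒ config n τ h
    stepLeft {τ = τ} {h} {n} at x = step {τ = τ} {suc h} {a = go left n} {h′ = h} at (left-cell h)
      (rewrite-same {τ = τ} {suc h} x)

    stepTest : ∀ {s τ h x m n} → Performs work Q s (test x m n) →
               config s τ h ⇒ config (if does (τ h Bool.≟ x) then m else n) τ (suc h)
    stepTest {τ = τ} {h} {x′} {m} {n} at x = step {τ = τ} {h} {a = test x′ m n} {h′ = suc h} at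
      (lift (cell-suc h)) (rewrite-same {τ = τ} {h} x)

    stepAsk : ∀ {s τ h m n} → Performs work Q s (ask m n) →
              config s τ h ⇒ config (if w h then m else n) τ (suc h)
    stepAsk {τ = τ} {h} {m} {n} at x = step {τ = τ} {h} {a = ask m n} {h′ = suc h} at (lift (cell-suc h))
      (rewrite-same {τ = τ} {h} x)

    Table : (ℕ → ℕ) → ℕ → Action → Set
    Table ς i a = Performs work Q (ς i) (mapAction ς a)

    -- The numbering of the states is arbitrary, because the gate runs some tables on one class of
    -- states and some on another.
    table-correct : ∀ {ς c τ h τ′ h′ l} → c ⊢ τ , h ⇓ τ′ , h′ → At (Table ς) l (table c l) →
                    config (ς l) τ h ⇒ config (ς (after c l)) τ′ h′
    table-correct skip⇓ at x = x
    table-correct right⇓ (at , _) = stepRight at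
    table-correct left⇓ (at , _) = stepLeft at
    table-correct {τ = τ} {h} {l = l} (write⇓ {b}) (at , at′ , _) x =
      step {τ = τ} {h} {a = put b _} {h′ = suc h} at (lift (cell-suc h)) (stepLeft at′ x)
    table-correct {ς} {c ⨟ d} {l = l} (p ⨟⇓ q) at x with atᶜ , atᵈ ← at-++ (table c l) at
      rewrite advance-table c l = table-correct p atᶜ (table-correct q atᵈ x)
    table-correct {ς} {while b c} {τ} {h} {l = l} (stop⇓ τh≡) (at , _ , at′ , _) x =
      stepTest at (subst (λ s → config s τ (suc h) ⇒ config (ς (after (while b c) l)) τ h) (exits b τh≡)
        (stepLeft at′) x)
      where
      exits : ∀ b → τ h ≡ not b → ς (2 + l) ≡ (if does (τ h Bool.≟ b) then ς (1 + l) else ς (2 + l))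
      exits b eq rewrite eq with b
      ... | true  = refl
      ... | false = refl
    table-correct {ς} {while b c} {τ} {h} {l = l} (loop⇓ τh≡ p q) whole@(at , at′ , _ , at″) x
      with atᶜ , atʳ , atˡ , _ ← at-++ (table c (3 + l)) at″ rewrite advance-table c (3 + l) =
      stepTest at (subst (λ s → config s τ (suc h) ⇒ config (ς (3 + l)) τ h) (enters b τh≡) (stepLeft at′)
        (table-correct p atᶜ (stepRight atʳ (stepLeft atˡ (table-correct {ς} q whole x)))))
      where
      enters : ∀ b → τ h ≡ b → ς (1 + l) ≡ (if does (τ h Bool.≟ b) then ς (1 + l) else ς (2 + l))
      enters b eq rewrite eq with b
      ... | true  = refl
      ... | false = refl

-- The gate for Turing machines

opaque
  bits-surjective : ∀ {n} (v : Vec Bool n) → ∃[ a ] bits n (ℕᵇ.fromℕ a) ≡ v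
  bits-surjective []          = 0 , refl
  bits-surjective (false ∷ v) = let a , eq = bits-surjective v in
    suc (2 * a) , trans (cong (bits _) (fromℕ-odd a)) (cong (false ∷_) eq)
  bits-surjective (true ∷ v)  = let a , eq = bits-surjective v in
    2 * suc a , trans (cong (bits _) (fromℕ-even a)) (cong (true ∷_) eq)

module _ {k : ℕ} where

  isRight : Direction → Bool
  isRight left  = false
  isRight right = true

  key-bits : Bool → Direction → Vec Bool k → Vec Bool k → Vec Bool (2 + (k + k))
  key-bits o d r w = o ∷ isRight d ∷ r Vec.++ w

  tmTokens : TMInstr k → List ℕ
  tmTokens (instr s o r w d s′) = s ∷ proj₁ (bits-surjective (key-bits o d r w)) ∷ s′ ∷ []

  parse-tmTokens : ∀ (is : TMProgram k) ts → parseTM (concatMap tmTokens is ++ ts) ≡ is ++ parseTM ts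
  parse-tmTokens []                          ts = refl
  parse-tmTokens (instr s o r w d s′ ∷ is) ts = cong₂ _∷_
    (trans (cong (λ v → fromBits s v s′) (proj₂ (bits-surjective (key-bits o d r w)))) (decode d))
    (parse-tmTokens is ts)
    where
    take≡ : Vec.take k (r Vec.++ w) ≡ r
    take≡ = Vec.++-injectiveˡ (Vec.take k (r Vec.++ w)) r (Vec.take++drop≡id k (r Vec.++ w))
    drop≡ : Vec.drop k (r Vec.++ w) ≡ w
    drop≡ = Vec.++-injectiveʳ (Vec.take k (r Vec.++ w)) r (Vec.take++drop≡id k (r Vec.++ w))
    decode : ∀ d → fromBits s (key-bits o d r w) s′ ≡ instr s o r w d s′
    decode left  = cong₂ (λ u v → instr s o u v left s′) take≡ drop≡
    decode right = cong₂ (λ u v → instr s o u v right s′) take≡ drop≡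

  parse-emits : ∀ is e → parseTM (tokensℕ (emits (concatMap tmTokens is) e)) ≡ is ++ parseTM {k} (tokensℕ e)
  parse-emits is e = trans (cong parseTM (tokens-emits (concatMap tmTokens is) e))
    (parse-tmTokens is (tokensℕ e))

at-map : ∀ {I K : Set} {F : ℕ → K → Set} (f : I → K) is {l} → At F l (List.map f is) → At (λ i → F i ∘ f) l is
at-map f []       at       = tt
at-map f (i ∷ is) (x , at) = x , at-map f is at

advance-map : ∀ {I K : Set} (f : I → K) is l → advance (List.map f is) l ≡ advance is l
advance-map f []       l = refl
advance-map f (i ∷ is) l = advance-map f is (suc l)

-- The states χ i initialise a counter with the code of the part of the gate that
-- has the states ς i, so the latter must not depend on the number of the former.
-- The odd states are those of the given program.

χ ς : ℕ → ℕ
χ i = 2 + i * 4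
ς i = i * 4

ς-injective : ∀ {i j} → ς i ≡ ς j → i ≡ j
ς-injective {i} {j} = ℕ.*-cancelʳ-≡ i j 4

χ-injective : ∀ {i j} → χ i ≡ χ j → i ≡ j
χ-injective eq = ς-injective (ℕ.suc-injective (ℕ.suc-injective eq))

χ≢ς : ∀ i j → χ i ≢ ς j
χ≢ς i j eq = contradiction (trans (sym ([m+kn]%n≡m%n 2 i 4)) (trans (cong (_% 4) eq) ([m+kn]%n≡m%n 0 j 4))) λ ()

odd≢even : ∀ i j → suc (i * 2) ≢ j * 2
odd≢even i j eq = contradiction (trans (sym ([m+kn]%n≡m%n 1 i 2))
  (trans (cong (_% 2) eq) ([m+kn]%n≡m%n 0 j 2))) λ ()

odd≢ς : ∀ i j → suc (i * 2) ≢ ς j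
odd≢ς i j eq = odd≢even i (j * 2) (trans eq (sym (ℕ.*-assoc j 2 2)))

odd≢χ : ∀ i j → suc (i * 2) ≢ χ j
odd≢χ i j eq = odd≢even i (suc (j * 2)) (trans eq (cong (2 +_) (sym (ℕ.*-assoc j 2 2))))

module _ {k : ℕ} (f : ℕ → ℕ) where

  renameInstr : TMInstr k → TMInstr k
  renameInstr i = record i { state = f (TMInstr.state i) ; next = f (TMInstr.next i) }

  transition-rename : (∀ {s s′} → f s ≡ f s′ → s ≡ s′) → ∀ P {s o v} →
    transition (List.map renameInstr P) (f s) o v ≡ Maybe.map renameInstr (transition P s o v)
  transition-rename f-inj []       = refl
  transition-rename f-inj (i ∷ P) {s} {o} {v} with key≟ s o v i
  ... | yes refl = transition-hit (renameInstr i) (List.map renameInstr P) refl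
  ... | no ne = trans
    (transition-miss (renameInstr i) (List.map renameInstr P) λ eq →
      ne (cong₂ _,_ (f-inj (cong proj₁ eq)) (cong proj₂ eq)))
    (transition-rename f-inj P)

opaque
  count : Routine
  count = routine (inc a#)

  count-correct : ∀ {σ τ} → Represents σ τ →
                  ∃[ τ′ ] Represents (σ [ a# ]%= suc) τ′ × count ⊢ τ , 0 ⇓ τ′ , 0
  count-correct = routine-correct (inc⇓ {a#})

width : ℕ
width = after count 0

after-count : ∀ j → after count (width * j) ≡ width * suc j
after-count j = trans (after-+ count 0 (width * j)) (sym (ℕ.*-suc width j))

module TMGate {k} (work : Fin k) (σ : ℕ → ℕ) (σ-injective : ∀ {s s′} → σ s ≡ σ s′ → s ≡ s′)
              (P : TMProgram k)
              (coded : ∀ Q → ∃[ n ] parseTM {k} (tokensℕ n) ≡ Q) where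

  rename : ℕ → ℕ
  rename s = suc (σ s * 2)

  rename-injective : ∀ {s s′} → rename s ≡ rename s′ → s ≡ s′
  rename-injective eq = σ-injective (ℕ.*-cancelʳ-≡ _ _ 2 (ℕ.suc-injective eq))

  countTable : ℕ → List Action
  countTable j = List.map (mapAction χ) (table count (width * j))

  countBlock : ℕ → TMProgram k
  countBlock j = block work χ (width * j) (countTable j)

  -- Later copies stand in front of earlier ones, which is the order that results when `main` emits
  -- them with increasing numbers.
  countBlocks : ℕ → TMProgram k
  countBlocks zero    = []
  countBlocks (suc n) = countBlock n ++ countBlocks n

  link : ℕ → TMProgram k
  link n = instructions work (χ (width * n)) (go right (ς 4))

  χᴸ : ℕ → Linear
  χᴸ i = width * 4 , 2 + i * 4

  χᴸ-value : ∀ i j → ⟦ χᴸ i ⟧ j ≡ χ (i + width * j)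
  χᴸ-value i j = lemma width i j
    where
    lemma : ∀ w i j → w * 4 * j + (2 + i * 4) ≡ 2 + (i + w * j) * 4
    lemma = solve-∀

  codeᴸ : Bool → Bool → Action → Linear
  codeᴸ o b a = 0 , proj₁ (bits-surjective (key-bits o (heads a) (scan work b) (scan work (writes a b))))

  -- Only the two states depend on `j`: a renumbering changes neither the symbols nor the direction,
  -- so the middle token is constant.
  instructionᴸ : ℕ → Bool → Bool → Action → List Linear
  instructionᴸ i o b a = χᴸ i ∷ codeᴸ o b a ∷ χᴸ (leadsTo a o b) ∷ []

  private
    move-by : ℕ → Action → Action
    move-by j a = mapAction χ (mapAction (_+ width * j) a)

  instructionᴸ-value : ∀ i o b a j → ⟦ instructionᴸ i o b a ⟧* j ≡
                       tmTokens (instruction work (χ (i + width * j)) o b (move-by j a))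
  instructionᴸ-value i o b a@(go d n) j =
    cong₂ (λ s s′ → s ∷ proj₂ (codeᴸ o b a) ∷ s′ ∷ []) (χᴸ-value i j) (χᴸ-value n j)
  instructionᴸ-value i o b a@(put x n) j =
    cong₂ (λ s s′ → s ∷ proj₂ (codeᴸ o b a) ∷ s′ ∷ []) (χᴸ-value i j) (χᴸ-value n j)
  instructionᴸ-value i o b a@(test x m n) j with does (b Bool.≟ x)
  ... | true  = cong₂ (λ s s′ → s ∷ proj₂ (codeᴸ o b a) ∷ s′ ∷ []) (χᴸ-value i j) (χᴸ-value m j)
  ... | false = cong₂ (λ s s′ → s ∷ proj₂ (codeᴸ o b a) ∷ s′ ∷ []) (χᴸ-value i j) (χᴸ-value n j)
  instructionᴸ-value i true  b a@(ask m n) j =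
    cong₂ (λ s s′ → s ∷ proj₂ (codeᴸ true b a) ∷ s′ ∷ []) (χᴸ-value i j) (χᴸ-value m j)
  instructionᴸ-value i false b a@(ask m n) j =
    cong₂ (λ s s′ → s ∷ proj₂ (codeᴸ false b a) ∷ s′ ∷ []) (χᴸ-value i j) (χᴸ-value n j)

  blockᴸ : ℕ → List Action → List Linear
  blockᴸ i []       = []
  blockᴸ i (a ∷ as) = instructionᴸ i false false a ++ instructionᴸ i false true a ++
                      instructionᴸ i true false a ++ instructionᴸ i true true a ++ blockᴸ (suc i) as

  blockᴸ-value : ∀ i as j → ⟦ blockᴸ i as ⟧* j ≡
                 concatMap tmTokens (block work χ (i + width * j)
                   (List.map (mapAction χ) (List.map (mapAction (_+ width * j)) as)))
  blockᴸ-value i []       j = refl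
  blockᴸ-value i (a ∷ as) j =
    join (instructionᴸ i false false a)
      (instructionᴸ i false true a ++ instructionᴸ i true false a ++ instructionᴸ i true true a ++ blockᴸ
        (suc i) as)
      (instructionᴸ-value i false false a j)
    (join (instructionᴸ i false true a) (instructionᴸ i true false a ++ instructionᴸ i true true a ++
      blockᴸ (suc i) as)
      (instructionᴸ-value i false true a j)
    (join (instructionᴸ i true false a) (instructionᴸ i true true a ++ blockᴸ (suc i) as)
      (instructionᴸ-value i true false a j)
    (join (instructionᴸ i true true a) (blockᴸ (suc i) as)
      (instructionᴸ-value i true true a j) (blockᴸ-value (suc i) as j))))
    where
    join : ∀ ls ls′ {ts ts′} → ⟦ ls ⟧* j ≡ ts → ⟦ ls′ ⟧* j ≡ ts′ → ⟦ ls ++ ls′ ⟧* j ≡ ts ++ ts′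
    join ls ls′ p q = trans (List.map-++ _ ls ls′) (cong₂ _++_ p q)

  -- The first number of linkᴸ is too small by 2, since the head has to find the
  -- position 2e and not the code e = emit (2 + a) d: as e = 4 (emit a d) + 6, it is
  -- the position of cell 4 of block 1 + emit a d.

  opaque
    countᴸ : List Linear
    countᴸ = blockᴸ 0 (table count 0)

    countᴸ-value : ∀ j → ⟦ countᴸ ⟧* j ≡ concatMap tmTokens (countBlock j)
    countᴸ-value j = trans (blockᴸ-value 0 (table count 0) j)
      (cong (λ as → concatMap tmTokens (block work χ (width * j) (List.map (mapAction χ) as)))
        (sym (table-+ count 0 (width * j))))

    linkᴸ : List Linear
    linkᴸ = (width * 4 , 0) ∷ codeᴸ false false (go right 0) ∷ (0 , ς 4) ∷
            χᴸ 0 ∷ codeᴸ false true (go right 0) ∷ (0 , ς 4) ∷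
            χᴸ 0 ∷ codeᴸ true false (go right 0) ∷ (0 , ς 4) ∷
            χᴸ 0 ∷ codeᴸ true true (go right 0) ∷ (0 , ς 4) ∷ []

    emits-linkᴸ : ∀ n e → 2 * suc (2 * suc (emits (⟦ linkᴸ ⟧* n) e)) ≡ emits (concatMap tmTokens (link n)) e
    emits-linkᴸ n e = trans (emit-2+ (trans (cong (2 +_) (ℕ.+-identityʳ _))
        (trans (ℕ.+-comm 2 _) (χᴸ-value 0 n))))
      (cong (λ s → emit (χ (width * n)) (emits (others s) e)) (χᴸ-value 0 n))
      where
      emit-2+ : ∀ {a e s} → 2 + a ≡ s → 2 * suc (2 * suc (emit a e)) ≡ emit s e
      emit-2+ {a} {e} refl = trans (cong (λ x → 2 * suc x) (sym (emit-suc a e))) (sym (emit-suc (suc a) e))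
      c : Bool → Bool → ℕ
      c o b = proj₂ (codeᴸ o b (go right 0))
      others : ℕ → List ℕ
      others s = c false false ∷ ς 4 ∷ s ∷ c false true ∷ ς 4 ∷ s ∷ c true false ∷ ς 4 ∷ s ∷ c true true ∷
        ς 4 ∷ []

  opaque
    main : Cmd
    -- The input `n` has two roles: as the code of `worker` it is the start of the code in `e#`, and
    -- as the number of copies of `count` it is the loop count in `p#`.
    main = drain a# (inc e# ⨾ inc p#) ⨾ drain p# (emitsᶜ countᴸ ⨾ inc j#) ⨾ emitsᶜ linkᴸ ⨾ inc e#

  blocksCode : ℕ → ℕ → ℕ
  blocksCode n zero    = n
  blocksCode n (suc j) = emits (⟦ countᴸ ⟧* j) (blocksCode n j)

  almost : ℕ → ℕ
  almost n = emits (⟦ linkᴸ ⟧* n) (blocksCode n n)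

  opaque
    unfolding main

    main⇓ : ∀ n → main ⊢ n ∷ 0 ∷ 0 ∷ 0 ∷ 0 ∷ 0 ∷ 0 ∷ [] ⇓ 0 ∷ 0 ∷ n ∷ suc (almost n) ∷ 0 ∷ 0 ∷ 0 ∷ []
    main⇓ n = copy n 0 (ℕ.+-identityʳ n) ⨾⇓ blocks n 0 (ℕ.+-identityʳ n) ⨾⇓ emitsᶜ⇓ linkᴸ n
      (blocksCode n n) ⨾⇓ inc⇓
      where
      copy : ∀ i m → i + m ≡ n → drain a# (inc e# ⨾ inc p#) ⊢
             i ∷ 0 ∷ 0 ∷ m ∷ 0 ∷ m ∷ 0 ∷ [] ⇓ 0 ∷ 0 ∷ 0 ∷ n ∷ 0 ∷ n ∷ 0 ∷ []
      copy zero    m refl = done⇓ refl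
      copy (suc i) m eq   = next⇓ refl (inc⇓ ⨾⇓ inc⇓) (copy i (suc m) (trans (ℕ.+-suc i m) eq))
      blocks : ∀ i j → i + j ≡ n → drain p# (emitsᶜ countᴸ ⨾ inc j#) ⊢
               0 ∷ 0 ∷ j ∷ blocksCode n j ∷ 0 ∷ i ∷ 0 ∷ [] ⇓ 0 ∷ 0 ∷ n ∷ blocksCode n n ∷ 0 ∷ 0 ∷ 0 ∷ []
      blocks zero    j refl = done⇓ refl
      blocks (suc i) j eq   = next⇓ refl (emitsᶜ⇓ countᴸ j (blocksCode n j) ⨾⇓ inc⇓)
        (blocks i (suc j) (trans (ℕ.+-suc i j) eq))

  opaque
    compute accept reject : Routine
    compute = routine main ⨟ rights 4 ⨟ while true (rights 8)
    accept  = home 4 ⨟ routine (drain j# skip ⨾ drain e# skip) ⨟ write false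
    -- Only the output matters here. If `work` is also the output tape, the mark on cell 0 has to
    -- go; the remaining traces may stay.
    reject  = home 4 ⨟ write false

    compute-correct : ∀ n {τ} → Represents (n ∷ 0 ∷ 0 ∷ 0 ∷ 0 ∷ 0 ∷ 0 ∷ []) τ → ∃[ τ′ ]
      Represents (0 ∷ 0 ∷ n ∷ suc (almost n) ∷ 0 ∷ 0 ∷ 0 ∷ []) τ′ ×
      compute ⊢ τ , 0 ⇓ τ′ , suc (almost n) * 8 + 4
    compute-correct n rep = let τ′ , rep′ , run = routine-correct (main⇓ n) rep in
      τ′ , rep′ , run ⨟⇓ rights⇓ 4 0 refl ⨟⇓ scan⇓ e# rep′ (suc (almost n)) 0 (ℕ.+-identityʳ _) refl

    private
      blank : ∀ {τ} → Represents (0 ∷ 0 ∷ 0 ∷ 0 ∷ 0 ∷ 0 ∷ 0 ∷ []) τ → τ ⟨ 0 ≔ false ⟩ ≗ const false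
      blank rep zero = refl
      blank {τ} rep p@(suc q) = trans (cong τ position)
        (trans (symbol≡ rep (p / 8) t) (zeros (p / 8) t nonzero))
        where
        open Represents
        t : Fin 8
        t = fromℕ< (m%n<n p 8)
        position : p ≡ p / 8 * 8 + toℕ t
        position = trans (m≡m%n+[m/n]*n p 8) (trans (ℕ.+-comm (p % 8) _)
          (cong (p / 8 * 8 +_) (sym (Fin.toℕ-fromℕ< (m%n<n p 8)))))
        nonzero : p / 8 * 8 + toℕ t ≢ 0
        nonzero eq = ℕ.1+n≢0 (trans position eq)
        zeros : ∀ i t → i * 8 + toℕ t ≢ 0 → symbol (0 ∷ 0 ∷ 0 ∷ 0 ∷ 0 ∷ 0 ∷ 0 ∷ []) i t ≡ false
        zeros zero    zero    ≢0 = contradiction refl ≢0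
        zeros (suc i) zero    ≢0 = refl
        zeros i (suc r) _ = symbol-zero i r

    accept-correct : ∀ n e {τ} → Represents (0 ∷ 0 ∷ n ∷ e ∷ 0 ∷ 0 ∷ 0 ∷ []) τ → ∃[ τ′ ]
      τ′ ≗ const false × accept ⊢ τ , e * 8 + 4 ⇓ τ′ , 0
    accept-correct n e rep = let τ′ , rep′ , run = routine-correct (clear-n n ⨾⇓ clear-e e) rep in
      τ′ ⟨ 0 ≔ false ⟩ , blank rep′ , home⇓ 4F e rep ⨟⇓ run ⨟⇓ write⇓
      where
      clear-n : ∀ n → drain j# skip ⊢ 0 ∷ 0 ∷ n ∷ e ∷ 0 ∷ 0 ∷ 0 ∷ [] ⇓ 0 ∷ 0 ∷ 0 ∷ e ∷ 0 ∷ 0 ∷ 0 ∷ []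
      clear-n zero    = done⇓ refl
      clear-n (suc n) = next⇓ refl skip⇓ (clear-n n)
      clear-e : ∀ e → drain e# skip ⊢ 0 ∷ 0 ∷ 0 ∷ e ∷ 0 ∷ 0 ∷ 0 ∷ [] ⇓ 0 ∷ 0 ∷ 0 ∷ 0 ∷ 0 ∷ 0 ∷ 0 ∷ []
      clear-e zero    = done⇓ refl
      clear-e (suc e) = next⇓ refl skip⇓ (clear-e e)

    reject-correct : ∀ n e {τ} → Represents (0 ∷ 0 ∷ n ∷ e ∷ 0 ∷ 0 ∷ 0 ∷ []) τ →
      ∃[ τ′ ] τ′ 0 ≡ false × reject ⊢ τ , e * 8 + 4 ⇓ τ′ , 0
    reject-correct n e rep = _ , refl , home⇓ 4F e rep ⨟⇓ write⇓

  computed accepting accepted rejecting rejected : ℕ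
  computed  = after compute 5
  accepting = suc computed
  accepted  = after accept (suc accepting)
  rejecting = 2 + accepted
  rejected  = after reject (suc rejecting)

  -- A step to the right followed by one to the left serves as a jump. The run begins in `ς 0`,
  -- which is 0, by marking block 0, leaves for the counting states at `χ 0`, and is handed back by
  -- `link` at `ς 4`.
  finish query actions : List Action
  finish  = go right (ς (suc accepted)) ∷ go left (rename 0) ∷
            go left (ς (suc rejecting)) ∷ List.map (mapAction ς) (table reject (suc rejecting))
  query   = ask (ς rejecting) (ς accepting) ∷ go left (ς (suc accepting)) ∷
            List.map (mapAction ς) (table accept (suc accepting)) ++ finish
  actions = put true (ς 1) ∷ go left (ς 2) ∷ go right (ς 3) ∷ go left (χ 0) ∷ go left (ς 5) ∷
            List.map (mapAction ς) (table compute 5) ++ query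

  advance-mapped : ∀ f c l → advance (List.map (mapAction f) (table c l)) l ≡ after c l
  advance-mapped f c l = trans (advance-map (mapAction f) (table c l) l) (advance-table c l)

  advance-mapped-++ : ∀ f c l as → advance (List.map (mapAction f) (table c l) ++ as) l ≡ advance as (after c l)
  advance-mapped-++ f c l as = trans (advance-++ (List.map (mapAction f) (table c l)) as l)
    (cong (advance as) (advance-mapped f c l))

  advance-actions : advance actions 0 ≡ rejected
  advance-actions = trans (advance-mapped-++ ς compute 5 query)
    (trans (advance-mapped-++ ς accept (suc accepting) finish) (advance-mapped ς reject (suc rejecting)))

  renamed : TMProgram k
  renamed = List.map (renameInstr rename) P

  worker : TMProgram k
  worker = block work ς 0 actions ++ renamed

  opaque
    workerCode : ∃[ n ] parseTM {k} (tokensℕ n) ≡ worker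
    workerCode = coded worker

  private
    n = proj₁ workerCode

  gate : TMProgram k
  gate = link n ++ countBlocks n ++ worker

  index : ℕ
  index = 2 * suc (2 * suc (almost n))

  -- `worker` mentions no number that depends on how many copies of `count` there are, so its code
  -- `n` can be chosen first. Then `index`, obtained from `n` alone, describes the program that
  -- counts up to `n`.
  parse-index : parseTM (tokensℕ index) ≡ gate
  parse-index = trans (cong (parseTM ∘ tokensℕ) (emits-linkᴸ n (blocksCode n n)))
    (trans (parse-emits (link n) (blocksCode n n)) (cong (link n ++_) (blocks n)))
    where
    blocks : ∀ j → parseTM (tokensℕ (blocksCode n j)) ≡ countBlocks j ++ worker
    blocks zero    = proj₂ workerCode
    blocks (suc j) = trans (cong (λ ts → parseTM (tokensℕ (emits ts (blocksCode n j)))) (countᴸ-value j))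
      (trans (parse-emits (countBlock j) (blocksCode n j))
      (trans (cong (countBlock j ++_) (blocks j)) (sym (List.++-assoc (countBlock j) (countBlocks j) worker))))

  advance-countTable : ∀ j → advance (countTable j) (width * j) ≡ width * suc j
  advance-countTable j = trans (advance-mapped χ count (width * j)) (after-count j)

  private
    link-avoids : ∀ m {s} → χ (width * m) ≢ s → Avoids s (link m)
    link-avoids m ne = ne ∷ ne ∷ ne ∷ ne ∷ []

    blocks-avoid : ∀ m {s} → (∀ i → χ i ≢ s) → Avoids s (countBlocks m)
    blocks-avoid zero    ne = []
    blocks-avoid (suc m) ne = All.++⁺ (block-avoids work (width * m) (countTable m) (λ i _ _ → ne i))
      (blocks-avoid m ne)

    initial-avoids : ∀ {s} → (∀ i → χ i ≢ s) → Avoids s (link n ++ countBlocks n)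
    initial-avoids ne = All.++⁺ (link-avoids n (ne (width * n))) (blocks-avoid n ne)

    -- The copies occupy disjoint intervals of states, so those standing in front do not intercept
    -- the transitions of copy `j`.
    blocks-perform : ∀ m pre rest → (∀ i → i ℕ.< width * m → Avoids (χ i) pre) → ∀ j → j ℕ.< m →
      At (λ i → Performs work (pre ++ countBlocks m ++ rest) (χ i)) (width * j) (countTable j)
    blocks-perform (suc m) pre rest avoid j j<1+m with ℕ.m<1+n⇒m<n∨m≡n j<1+m
    ... | inj₂ refl = subst (λ Q → At (λ i → Performs work Q (χ i)) (width * j) (countTable j))
      (cong (pre ++_) (sym (List.++-assoc (countBlock j) (countBlocks j) rest)))
      (block-performs work χ-injective pre (width * j) (countTable j) (countBlocks j ++ rest)
        λ i _ i< → avoid i (subst (i ℕ.<_) (advance-countTable j) i<))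
    ... | inj₁ j<m = subst (λ Q → At (λ i → Performs work Q (χ i)) (width * j) (countTable j))
      (trans (List.++-assoc pre (countBlock m) _) (cong (pre ++_)
        (sym (List.++-assoc (countBlock m) (countBlocks m) rest))))
      (blocks-perform m (pre ++ countBlock m) rest
        (λ i i<wm → All.++⁺ (avoid i (ℕ.<-≤-trans i<wm (ℕ.*-monoʳ-≤ width (ℕ.n≤1+n m))))
          (block-avoids work (width * m) (countTable m) λ i′ wm≤i′ _ eq →
            ℕ.<⇒≢ (ℕ.<-≤-trans i<wm wm≤i′) (sym (χ-injective eq))))
        j j<m)

  link-performs : Performs work gate (χ (width * n)) (go right (ς 4))
  link-performs = transition-instructions work (χ (width * n)) (go right (ς 4)) (countBlocks n ++ worker)

  count-performs : ∀ j → j ℕ.< n → At (λ i a → Performs work gate (χ i) (mapAction χ a)) (width * j)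
    (table count (width * j))
  count-performs j j<n = at-map (mapAction χ) (table count (width * j))
    (blocks-perform n (link n) worker (λ i i<wn → link-avoids n λ eq → ℕ.<⇒≢ i<wn (sym (χ-injective eq))) j j<n)

  private
    gate-assoc : gate ≡ (link n ++ countBlocks n) ++ worker
    gate-assoc = sym (List.++-assoc (link n) (countBlocks n) worker)

  actions-perform : At (λ i → Performs work gate (ς i)) 0 actions
  actions-perform = subst (λ Q → At (λ i → Performs work Q (ς i)) 0 actions) (sym gate-assoc)
    (block-performs work ς-injective (link n ++ countBlocks n) 0 actions renamed
      λ i _ _ → initial-avoids λ i′ → χ≢ς i′ i)

  transition-renamed : ∀ s {o v} → transition gate (rename s) o v ≡ Maybe.map (renameInstr rename)
    (transition P s o v)
  transition-renamed s {o} {v} = trans (cong (λ Q → transition Q (rename s) o v) gate-assoc)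
    (trans (transition-avoids (link n ++ countBlocks n) worker (initial-avoids λ i eq → odd≢χ (σ s) i (sym eq)))
    (trans (transition-avoids (block work ς 0 actions) renamed
      (block-avoids work 0 actions λ i _ _ eq → odd≢ς (σ s) i (sym eq)))
    (transition-rename rename rename-injective P)))

  transition-rejected : ∀ {o v} → transition gate (ς rejected) o v ≡ nothing
  transition-rejected {o} {v} = trans (cong (λ Q → transition Q (ς rejected) o v)
    (sym (List.++-identityʳ gate)))
    (transition-avoids gate [] (subst (Avoids (ς rejected)) (sym gate-assoc)
      (All.++⁺ (initial-avoids λ i → χ≢ς i rejected)
      (All.++⁺ (block-avoids work 0 actions λ i _ i< eq →
          ℕ.<⇒≢ (subst (i ℕ.<_) advance-actions i<) (ς-injective eq))
        (All.map⁺ (All.universal (λ i → odd≢ς (σ (TMInstr.state i)) rejected) P))))))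

  actions-blocks :
    let F = λ i → Performs work gate (ς i) ; G = λ i a → Performs work gate (ς i) (mapAction ς a) in
    At F 0 (put true (ς 1) ∷ go left (ς 2) ∷ go right (ς 3) ∷ go left (χ 0) ∷ go left (ς 5) ∷ []) ×
    At G 5 (table compute 5) ×
    At F computed (ask (ς rejecting) (ς accepting) ∷ go left (ς (suc accepting)) ∷ []) ×
    At G (suc accepting) (table accept (suc accepting)) ×
    At F accepted (go right (ς (suc accepted)) ∷ go left (rename 0) ∷ go left (ς (suc rejecting)) ∷ []) ×
    At G (suc rejecting) (table reject (suc rejecting))
  actions-blocks =
    let a₀ , a₁ , a₂ , a₃ , a₄ , at = actions-perform
        c , at₁ = split compute 5 at
        a₅ , a₆ , at₂ = at₁
        d , at₃ = split accept (suc accepting) at₂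
        a₇ , a₈ , a₉ , at₄ = at₃
    in (a₀ , a₁ , a₂ , a₃ , a₄ , tt) , c , (a₅ , a₆ , tt) , d , (a₇ , a₈ , a₉ , tt) ,
       at-map (mapAction ς) (table reject (suc rejecting)) at₄
    where
    split : ∀ c l {rest} → At (λ i → Performs work gate (ς i)) l (List.map (mapAction ς) (table c l) ++ rest) →
            At (λ i a → Performs work gate (ς i) (mapAction ς a)) l (table c l) ×
            At (λ i → Performs work gate (ς i)) (after c l) rest
    split c l {rest} at =
      let at₁ , at₂ = at-++ (List.map (mapAction ς) (table c l)) at
      in at-map (mapAction ς) (table c l) at₁ ,
         subst (λ l′ → At (λ i → Performs work gate (ς i)) l′ rest) (advance-mapped ς c l) at₂

  module Run (em : ExcludedMiddle 1ℓ) {p} {T : Tape p} (laws : TapeLaws T) (out : Fin k)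
             {Limit : Ord → (Ord → TM.Config T k) → TM.Config T k → Set (1ℓ ⊔ p)}
             (regular : ∀ P w → Regular (TM.system T k out Limit P w))
             (≐⇒~ : ∀ P w {c d} → TMRegular._≐ᵗ_ laws {k} c d → Regular._~_ (regular P w) c d)
             (~⇒≐ : ∀ P w {c d} → Regular._~_ (regular P w) c d → TMRegular._≐ᵗ_ laws {k} c d)
             (w : Real) where

    open Tape T
    open TapeLaws laws
    open TM T k
    open TMRegular laws {k}
    open Running em laws work out regular ≐⇒~
    open Steps gate w

    renameConfig : Config → Config
    renameConfig c = record { state = rename (state c) ; head = head c ; content = content c }
      where
      open Config

    counted : ∀ m → m ℕ.≤ n → ∀ {τ} → Represents (0 ∷ 0 ∷ 0 ∷ 0 ∷ 0 ∷ 0 ∷ 0 ∷ []) τ → ∃[ τ′ ]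
      Represents (m ∷ 0 ∷ 0 ∷ 0 ∷ 0 ∷ 0 ∷ 0 ∷ []) τ′ × (config (χ 0) τ 0 ⇒ config (χ (width * m)) τ′ 0)
    counted zero m≤n {τ} rep = τ , rep ,
      subst (λ l → config (χ 0) τ 0 ⇒ config (χ l) τ 0) (sym (ℕ.*-zeroʳ width)) (λ x → x)
    counted (suc m) m<n {τ} rep =
      let τ₁ , rep₁ , run₁ = counted m (ℕ.<⇒≤ m<n) rep
          τ₂ , rep₂ , run₂ = count-correct rep₁
      in τ₂ , rep₂ , λ x → run₁ (subst (λ l → config (χ (width * m)) τ₁ 0 ⇒ config (χ l) τ₂ 0) (after-count m)
           (table-correct {χ} run₂ (count-performs m m<n)) x)

    marked : ℕ → Bool
    marked = const false ⟨ 0 ≔ true ⟩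

    marked-represents : Represents (0 ∷ 0 ∷ 0 ∷ 0 ∷ 0 ∷ 0 ∷ 0 ∷ []) marked
    marked-represents = represents marks
      where
      marks : ∀ i t → marked (i * 8 + toℕ t) ≡ symbol (0 ∷ 0 ∷ 0 ∷ 0 ∷ 0 ∷ 0 ∷ 0 ∷ []) i t
      marks zero zero = refl
      marks (suc i) zero = refl
      marks zero (suc r) = sym (symbol-zero 0 r)
      marks (suc i) (suc r) = sym (symbol-zero (suc i) r)

    double-index : suc (almost n) * 8 + 4 ≡ 2 * index
    double-index = lemma (almost n)
      where
      lemma : ∀ e → suc e * 8 + 4 ≡ 2 * (2 * suc (2 * suc e))
      lemma = solve-∀

    queried : ∃[ τ ] Represents (0 ∷ 0 ∷ n ∷ suc (almost n) ∷ 0 ∷ 0 ∷ 0 ∷ []) τ ×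
      (config 0 (const false) 0 ⇒
       config (if w (2 * index) then ς rejecting else ς accepting) τ (suc (suc (almost n) * 8 + 4)))
    queried =
      let (a₀ , a₁ , a₂ , a₃ , a₄ , _) , c , (a₅ , _) , _ = actions-blocks
          τ₁ , rep₁ , run₁ = counted n ℕ.≤-refl marked-represents
          τ₂ , rep₂ , run₂ = compute-correct n rep₁
      in τ₂ , rep₂ , λ x →
        step {τ = const false} {h = 0} {a = put true (ς 1)} {h′ = 1} a₀ (lift (cell-suc 0))
        (stepLeft {τ = marked} {h = 0} a₁ (stepRight {τ = marked} {h = 0} a₂ (stepLeft {τ = marked} {h = 0} a₃
        (run₁ (stepRight {τ = τ₁} {h = 0} link-performs (stepLeft {τ = τ₁} {h = 0} a₄
        (table-correct {ς} run₂ c (stepAsk {τ = τ₂} a₅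
          (transport (cong (λ m → config (if w m then ς rejecting else ς accepting) τ₂
            (suc (suc (almost n) * 8 + 4)))
            double-index) x)))))))))
      where
      transport : ∀ {c d} → c ≡ d → c ⇒ d
      transport refl x = x

    lookup-blank : ∀ t → lookup (scan work false) t ≡ false
    lookup-blank t with t Fin.≟ work
    ... | yes refl = Vec.lookup∘update work (Vec.replicate k false) false
    ... | no t≢    = trans (Vec.lookup∘update′ t≢ (Vec.replicate k false) false) (Vec.lookup-replicate t false)

    content-blank : ∀ {s τ h} → τ ≗ const false → ∀ t q → Config.content (config s τ h) t q ≡ false
    content-blank {s} {τ} {h} τ≗0 t q = trans (cong (λ b → lookup (scan work b) t) off) (lookup-blank t)
      where
      off : extend τ q ≡ false
      off with cell? q
      ... | yes (m , _) = τ≗0 m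
      ... | no _        = refl

    private
      initially : ∀ {c} → Lift (1ℓ ⊔ p) (Regular._~_ (regular gate w) (config 0 (const false) 0) c) →
                  System.Initial (system out Limit gate w) c
      initially (lift c₀~c) = let c₀≐c = ~⇒≐ gate w c₀~c in
        lift (sym (state≡ c₀≐c) , ≈-sym (head≈ c₀≐c) ,
              λ t q → trans (sym (content≡ c₀≐c t q q ≈-refl))
                (content-blank {0} {const false} {0} (λ _ → refl) t q))

    tm-rejects : w (2 * index) ≡ true → HaltsWith (system out Limit gate w) 0
    tm-rejects bit =
      let _ , _ , _ , _ , (_ , _ , a₉ , _) , d = actions-blocks
          τ , rep , start = queried
          τ′ , τ′0≡ , run = reject-correct n (suc (almost n)) rep
      in weaken-initial (regular gate w) initially (start
        (subst (λ b → HaltsWith (restart (system out Limit gate w) λ e → Lift (1ℓ ⊔ p)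
            (Regular._~_ (regular gate w) (config (if b then ς rejecting else ς accepting) τ
              (suc (suc (almost n) * 8 + 4))) e)) 0)
          (sym bit) (stepLeft {τ = τ} a₉ (table-correct {ς} run d
          (halted-now {M = system out Limit gate w} {c = config (ς rejected) τ′ 0}
            (lift (≐⇒~ gate w (config-cong {τ = τ′} λ _ → refl)))
            (lift (w 0 , oracleBit w 0 , transition-rejected))
            ((λ _ ()) , trans (cong (λ b → lookup (scan work b) out) (trans (extend-cell τ′ ≈-refl) τ′0≡))
              (lookup-blank out)))))))

    tm-accepts : (∀ {μ C c} → IsLimit μ → Limit μ C c → Limit μ (renameConfig ∘ C) (renameConfig c)) →
      w (2 * index) ≡ false → ∀ {i} → HaltsWith (system out Limit P w) i → HaltsWith (system out Limit gate w) i
    tm-accepts rename-limit bit {i} halts =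
      let _ , _ , (_ , a₆ , _) , d , (a₇ , a₈ , _) , _ = actions-blocks
          τ , rep , start = queried
          τ′ , τ′≗0 , run = accept-correct n (suc (almost n)) rep
      in weaken-initial (regular gate w) initially (start
        (subst (λ b → HaltsWith (restart (system out Limit gate w) λ e → Lift (1ℓ ⊔ p)
            (Regular._~_ (regular gate w) (config (if b then ς rejecting else ς accepting) τ
              (suc (suc (almost n) * 8 + 4))) e)) i)
          (sym bit) (stepLeft {τ = τ} a₆ (table-correct {ς} run d
          (stepRight {τ = τ′} {h = 0} a₇ (stepLeft {τ = τ′} {h = 0} a₈ (simulated τ′≗0)))))))
      where
      open Config
      simulated : ∀ {τ′} → τ′ ≗ const false → HaltsWith (restart (system out Limit gate w) λ e →
        Lift (1ℓ ⊔ p) (Regular._~_ (regular gate w) (config (rename 0) τ′ 0) e)) i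
      simulated {τ′} τ′≗0 = simulation {M = system out Limit P w} {N = system out Limit gate w} renameConfig
        (λ { {c} (lift (s≡0 , h≈0 , blank)) → lift (≐⇒~ gate w (mk≐ (cong rename (sym s≡0)) (≈-sym h≈0)
            λ t q r _ → trans (content-blank {rename 0} {τ′} {0} τ′≗0 t q) (sym (blank t r)))) })
        (λ { {c} (o , ob , i′ , eq , a) → o , ob , renameInstr rename i′ ,
            trans (transition-renamed (state c)) (cong (Maybe.map (renameInstr rename)) eq) , record
              { state′    = cong rename (Applies.state′ a)
              ; head′     = Applies.head′ a
              ; written   = Applies.written a
              ; unchanged = Applies.unchanged a
              } })
        rename-limit
        (λ { {c} (lift (o , ob , stop)) → lift (o , ob ,
            trans (transition-renamed (state c)) (cong (Maybe.map (renameInstr rename)) stop)) })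
        (λ {c} {j} out′ → out′)
        halts

-- The renaming has to fix the limit state 1 of an ITTM. Since `suc (swap01 1 * 2)` is 1 it does,
-- and the start state 0 of `P` becomes 3.
swap01 : ℕ → ℕ
swap01 0 = 1
swap01 1 = 0
swap01 s = s

swap01-involutive : ∀ s → swap01 (swap01 s) ≡ s
swap01-involutive 0 = refl
swap01-involutive 1 = refl
swap01-involutive (suc (suc s)) = refl

swap01-injective : ∀ {s s′} → swap01 s ≡ swap01 s′ → s ≡ s′
swap01-injective {s} {s′} eq = trans (sym (swap01-involutive s)) (trans (cong swap01 eq) (swap01-involutive s′))

-- Gates for the three models

module _ (em : ExcludedMiddle 1ℓ) where

  -- All that the diagonal argument needs from the recursion theorem: a program with access to one
  -- bit at its own code. The position is `2 * e` because `z ⊕ x` carries `z` on the even numbers.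
  Gate : (M : Model) → Program M → Set₁
  Gate M P = ∃[ e ] ∀ w →
    (w (2 * e) ≡ true → _^_↓_ {M} (program M e) w 0) ×
    (w (2 * e) ≡ false → ∀ {j} → _^_↓_ {M} P w j → _^_↓_ {M} (program M e) w j)

  itrm-gate : ∀ P → Gate ITRM P
  itrm-gate P = index , λ w → subst (λ Q → (w (2 * index) ≡ true → HaltsWith (itrm Q w) 0) ×
      (w (2 * index) ≡ false → ∀ {j} → HaltsWith (itrm P w) j → HaltsWith (itrm Q w) j))
    (sym program-index) (itrm-rejects em w , itrm-accepts em w)
    where
    open ITRMGate P

  ittm-gate : ∀ P → Gate ITTM P
  ittm-gate P = index , λ w → subst (λ Q → (w (2 * index) ≡ true → HaltsWith (ittm Q w) 0) ×
      (w (2 * index) ≡ false → ∀ {j} → HaltsWith (ittm P w) j → HaltsWith (ittm Q w) j))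
    (sym parse-index) (tm-rejects w , tm-accepts w λ _ (s , h , r) → cong rename s , h , r)
    where
    open TMGate zero swap01 swap01-injective P (program-surjective ITTM)
    open Run em (ωTape-laws em) (suc (suc zero)) (ittm-regular em) (λ _ _ → id) (λ _ _ → id)

  otm-gate : ∀ P → Gate OTM P
  otm-gate P = index , λ w → subst (λ Q → (w (2 * index) ≡ true → HaltsWith (otm Q w) 0) ×
      (w (2 * index) ≡ false → ∀ {j} → HaltsWith (otm P w) j → HaltsWith (otm Q w) j))
    (sym parse-index) (tm-rejects w , tm-accepts w rename-limit)
    where
    open TMGate zero id id P (program-surjective OTM)
    open Run em (OrdTape-laws em) zero (otm-regular em) (λ _ _ → id) (λ _ _ → id)
    open TM OrdTape 1
    open Config
    -- The renaming has a lower adjoint and hence commutes with the inferior limit of the states. It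
    -- is injective, so the times selected for the head position remain the same.
    rename-limit : ∀ {μ C c} → IsLimit μ → OTMLimit μ C c →
      OTMLimit μ (λ γ → record { state = rename (state (C γ)) ; head = head (C γ) ; content = content (C γ) })
                 (record { state = rename (state c) ; head = head c ; content = content c })
    rename-limit lim (s , h , r) =
      liminf-map em rename ψ (λ m≤n → ℕ.s≤s (ℕ.*-monoˡ-≤ 2 m≤n)) to from lim s ,
      liminf-resp (λ { b (β , β<μ , p) → β , β<μ , λ γ q q′ eq → p γ q q′ (rename-injective eq) })
                  (λ { b (β , β<μ , p) → β , β<μ , λ γ q q′ eq → p γ q q′ (cong rename eq) })
                  (λ _ → id) (λ _ → id) h ,
      r
      where
      -- Half of the argument, rounded down: the lower adjoint of the map taking `n` to `2 * n + 1`.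
      ψ : ℕ → ℕ
      ψ 0 = 0
      ψ 1 = 0
      ψ (suc (suc m)) = suc (ψ m)
      to : ∀ {m n} → m ℕ.≤ suc (n * 2) → ψ m ℕ.≤ n
      to {0}           _ = ℕ.z≤n
      to {1}           _ = ℕ.z≤n
      to {suc (suc m)} {zero}  (ℕ.s≤s ())
      to {suc (suc m)} {suc n} (ℕ.s≤s (ℕ.s≤s le)) = ℕ.s≤s (to le)
      from : ∀ {m n} → ψ m ℕ.≤ n → m ℕ.≤ suc (n * 2)
      from {0}           _ = ℕ.z≤n
      from {1}           _ = ℕ.s≤s ℕ.z≤n
      from {suc (suc m)} {suc n} (ℕ.s≤s le) = ℕ.s≤s (ℕ.s≤s (from le))

  gate-exists : ∀ M P → Gate M P
  gate-exists ITRM = itrm-gate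
  gate-exists ITTM = ittm-gate
  gate-exists OTM  = otm-gate

  ↓-unique : ∀ M {P : Program M} {w i j} → _^_↓_ {M} P w i → _^_↓_ {M} P w j → i ≡ j
  ↓-unique ITRM {P} {w} = halts-unique em (itrm-regular P w) λ { (lift (p , q)) (lift (p′ , q′)) →
    trans p (sym p′) , λ n → trans (q n) (sym (q′ n)) }
  ↓-unique ITTM {P} {w} = halts-unique em (ittm-regular em P w) λ { (lift (p , q , r)) (lift (p′ , q′ , r′)) →
    TMRegular.mk≐ (trans p (sym p′)) (trans q (sym q′)) λ t x y _ → trans (r t x) (sym (r′ t y)) }
  ↓-unique OTM {P} {w} = halts-unique em (otm-regular em P w)
    λ { {c} {d} (lift (p , q , r)) (lift (p′ , q′ , r′)) →
    TMRegular.mk≐ (trans p (sym p′))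
      (≈ₒ-trans {TM.Config.head c} {zeroₒ} {TM.Config.head d} q (≈ₒ-sym {TM.Config.head d} q′))
      λ t x y _ → trans (r t x) (sym (r′ t y)) }

-- The diagonal argument

⊕-even : ∀ z x n → (z ⊕ x) (2 * n) ≡ z n
⊕-even z x n = trans (cong (z ⊕ x) (ℕ.*-comm 2 n))
  (trans (cong (λ r → if r ≡ᵇ 0 then z (n * 2 / 2) else x (n * 2 / 2)) (m*n%n≡0 n 2)) (cong z (m*n/n≡m n 2)))

module _ (em : ExcludedMiddle 1ℓ) where

  δ-≗ : ∀ {z y} → z ≗ y → δ em z y ≡ 1
  δ-≗ {z} {y} z≗y = cong (λ b → if b then 1 else 0) (dec-true (em {Lift 1ℓ (z ≗ y)}) (lift z≗y))

  δ-≢ : ∀ {z y} n → z n ≢ y n → δ em z y ≡ 0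
  δ-≢ {z} {y} n ne = cong (λ b → if b then 1 else 0) (dec-false (em {Lift 1ℓ (z ≗ y)}) λ (lift z≗y) → ne
    (z≗y n))

mainTheorem14 : (em : ExcludedMiddle 1ℓ) (M : Model) (x : Real) →
    ¬ RecognizableRelativeTo em M (recognizableJump em M x) x
mainTheorem14 em M x (P , recognizes) = impossible (em {InJump})
  where
  A = recognizableJump em M x
  e = proj₁ (gate-exists em M P)
  InJump = Σ Real λ y → Recognizes em M (program M e) y x

  rejects : ∀ z → z e ≡ true → _^_↓_ {M} (program M e) (z ⊕ x) 0
  rejects z ze = proj₁ (proj₂ (gate-exists em M P) (z ⊕ x)) (trans (⊕-even z x e) ze)

  accepts : ∀ z → z e ≡ false → _^_↓_ {M} (program M e) (z ⊕ x) (δ em z A)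
  accepts z ze = proj₂ (proj₂ (gate-exists em M P) (z ⊕ x)) (trans (⊕-even z x e) ze) (recognizes z)

  impossible : ¬ Dec InJump
  impossible (yes (y , rec)) with y e in ye
  ... | true  = contradiction (trans (sym (δ-≗ em {y} (λ _ → refl)))
    (↓-unique em M (rec y) (rejects y ye))) λ ()
  ... | false = contradiction (trans (sym (δ-≗ em {y} (λ _ → refl)))
      (trans (↓-unique em M (rec y) (accepts y ye)) (δ-≢ em {y} {A} e y≢A))) λ ()
    where
    y≢A : y e ≢ A e
    y≢A eq = contradiction (trans (sym ye) (trans eq (dec-true (em {InJump}) (y , rec)))) λ ()
  impossible (no ¬rec) = ¬rec (A , recognized)
    where
    Ae : A e ≡ false
    Ae = dec-false (em {InJump}) ¬rec
    recognized : Recognizes em M (program M e) A x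
    recognized z with z e in ze
    ... | false = accepts z ze
    -- `z` and `A` differ at `e`, so the answer 0 of the gate is the value of `δ` required here.
    ... | true  = subst (_^_↓_ {M} (program M e) (z ⊕ x))
      (sym (δ-≢ em {z} {A} e λ eq → contradiction (trans (sym ze) (trans eq Ae)) λ ())) (rejects z ze)
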